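{- There exist absolute constants $C_{\rm tr}>0$ and $c_{\rm sp}>0$ such that the following holds. For every positive integer $n$, let $\Omega_n$ be a finite set and let $\mathcal A_n\subseteq\binom{\Omega_n}{h_n}$, where $h_n\to\infty$. Let $\vartheta_n\in(0,1]$ and let $$a_n=\mathbb P[(\Omega_n)_{\vartheta_n}\text{ contains a member of }\mathcal A_n].$$ Suppose that $a_n>0$ for every $n$ and that $q_n:=\vartheta_n/a_n\le 1/2$ for all sufficiently large $n$. Then: (1) $\mathcal A_n$ supports a $q_n$-spread measure. (2) Upon colouring the members of $\Omega_n$ independently and uniformly using the palette $[h_n]$, $$\mathbb P[(\Omega_n)_{\rho_n}\text{ admits a rainbow member of }\mathcal A_n]=1-o(1)$$ holds whenever $\rho_n\in(0,1]$ satisfies $\rho_n\ge 2C_{\rm tr}\,q_n\log h_n$, where the probability is over both the colouring and the $\rho_n$-percolation. (3) In particular, whenever $q_n\log h_n\le c_{\rm sp}$ for all sufficiently large $n$, an independent uniform colouring of $\Omega_n$ from $[h_n]$ a.a.s. admits a rainbow member of $\mathcal A_n$.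
   Context: $\binom{\Omega}{h}$ is the family of $h$-element subsets of $\Omega$; $[h]=\{1,\dots,h\}$; $\log$ is the natural logarithm. For a finite set $\Omega$ and $\rho\in[0,1]$, the random set $\Omega_\rho$ retains each element of $\Omega$ independently with probability $\rho$. The final percolation $(\Omega_n)_{\rho_n}$ is sampled from $\Omega_n$ independently of the colouring. For $S\subseteq\Omega$ write $\langle S\rangle=\{A\subseteq\Omega:S\subseteq A\}$. For $q>0$, a probability measure $\mu$ on $2^\Omega$ is $q$-spread if $\mu(\langle S\rangle)\le q^{|S|}$ for every $S\subseteq\Omega$; a family $\mathcal A\subseteq2^\Omega$ supports such a measure if $\mu(\mathcal A)=1$. A member of $\mathcal A_n$ is rainbow if its elements receive pairwise distinct colours; a random set admits/contains a member if the member is a subset of it. Asymptotics are as $n\to\infty$, and a.a.s. means with probability tending to $1$. -}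

module Defs where

open import Data.Bool.Base using (Bool; T; if_then_else_)
open import Data.Bool.Properties using (T?)
open import Data.Fin.Base using (Fin)
import Data.Fin.Properties as Fin
open import Data.Fin.Subset using (Subset; Side; inside; outside; _∈_; _⊆_; ∣_∣)
open import Data.Fin.Subset.Properties using (_∈?_; _⊆?_; anySubset?)
import Data.Integer.Base as ℤ
import Data.Integer.Properties as ℤ
open import Data.List.Base
  using (List; []; _∷_; foldr; map; allFin; cartesianProduct; cartesianProductWith)
open import Data.Nat.Base as ℕ using (ℕ; zero; suc)
import Data.Nat.Properties as ℕ
open import Data.Product using (Σ; ∃; ∃-syntax; _×_; _,_; proj₁; proj₂; uncurry)
open import Data.Rational.Base as ℚ using (ℚ; 0ℚ; 1ℚ; ½)
import Data.Rational.Properties as ℚ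
open import Data.Rational.Solver using (module +-*-Solver)
import Data.Rational.Unnormalised.Base as ℚᵘ
import Data.Rational.Unnormalised.Properties as ℚᵘ
open import Data.Sum.Base using (inj₁; inj₂)
open import Data.Vec.Base as Vec using (Vec; []; _∷_)
open import Level using (0ℓ)
open import Relation.Binary.PropositionalEquality
  using (_≡_; _≢_; refl; sym; trans; cong; cong₂; subst)
open import Relation.Nullary using (Dec; yes; no; does; contradiction)
open import Relation.Nullary.Decidable using (_×-dec_; _→-dec_)
open import Relation.Unary using (Pred; Decidable)

open +-*-Solver using (solve; _:=_; _:+_; _:*_; _:-_; :-_; con)

Eventually : (ℕ → Set) → Set
Eventually P = ∃[ N ] ∀ n → N ℕ.≤ n → P n

private

  ½+½ : ∀ p → p ℚ.* ½ ℚ.+ p ℚ.* ½ ≡ p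
  ½+½ = solve 1 (λ p → p :* con ½ :+ p :* con ½ := p) refl

  ½>0 : ∀ {p} → 0ℚ ℚ.< p → 0ℚ ℚ.< p ℚ.* ½
  ½>0 {p} p>0 = subst (ℚ._< p ℚ.* ½) (ℚ.*-zeroˡ ½) (ℚ.*-monoˡ-<-pos ½ p>0)

  *>0 : ∀ {p q} → 0ℚ ℚ.< p → 0ℚ ℚ.< q → 0ℚ ℚ.< p ℚ.* q
  *>0 {p} {q} p>0 q>0 =
    subst (ℚ._< p ℚ.* q) (ℚ.*-zeroˡ q) (ℚ.*-monoˡ-<-pos q {{ℚ.positive q>0}} p>0)

  *≥0 : ∀ {p q} → 0ℚ ℚ.≤ p → 0ℚ ℚ.≤ q → 0ℚ ℚ.≤ p ℚ.* q
  *≥0 {p} {q} p≥0 q≥0 =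
    subst (ℚ._≤ p ℚ.* q) (ℚ.*-zeroˡ q)
      (ℚ.*-monoʳ-≤-nonNeg q {{ℚ.nonNegative q≥0}} p≥0)

  *-mono-≤ : ∀ p p′ q q′ → 0ℚ ℚ.≤ q → 0ℚ ℚ.≤ p′ →
             p ℚ.≤ p′ → q ℚ.≤ q′ → p ℚ.* q ℚ.≤ p′ ℚ.* q′
  *-mono-≤ p p′ q q′ q≥0 p′≥0 p≤p′ q≤q′ = ℚ.≤-trans
    (ℚ.*-monoʳ-≤-nonNeg q {{ℚ.nonNegative q≥0}} p≤p′)
    (ℚ.*-monoˡ-≤-nonNeg p′ {{ℚ.nonNegative p′≥0}} q≤q′)

  p≤p+q : ∀ p {q} → 0ℚ ℚ.≤ q → p ℚ.≤ p ℚ.+ q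
  p≤p+q p {q} q≥0 =
    subst (ℚ._≤ p ℚ.+ q) (ℚ.+-identityʳ p) (ℚ.+-monoʳ-≤ p q≥0)

  p-q≥0 : ∀ {p q} → q ℚ.≤ p → 0ℚ ℚ.≤ p ℚ.- q
  p-q≥0 {p} {q} q≤p =
    subst (ℚ._≤ p ℚ.- q) (ℚ.+-inverseʳ q) (ℚ.+-monoˡ-≤ (ℚ.- q) q≤p)

  ∣p-q∣≡∣q-p∣ : ∀ p q → ℚ.∣ p ℚ.- q ∣ ≡ ℚ.∣ q ℚ.- p ∣
  ∣p-q∣≡∣q-p∣ p q = trans
    (cong ℚ.∣_∣ (solve 2 (λ p q → p :- q := :- (q :- p)) refl p q))
    (ℚ.∣-p∣≡∣p∣ (q ℚ.- p))

  split-+ : ∀ a a′ b b′ →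
            (a ℚ.+ b) ℚ.- (a′ ℚ.+ b′) ≡ (a ℚ.- a′) ℚ.+ (b ℚ.- b′)
  split-+ = solve 4 (λ a a′ b b′ →
    (a :+ b) :- (a′ :+ b′) := (a :- a′) :+ (b :- b′)) refl

  split-* : ∀ a a′ b b′ →
            a ℚ.* b ℚ.- a′ ℚ.* b′ ≡ a ℚ.* (b ℚ.- b′) ℚ.+ (a ℚ.- a′) ℚ.* b′
  split-* = solve 4 (λ a a′ b b′ →
    a :* b :- a′ :* b′ := a :* (b :- b′) :+ (a :- a′) :* b′) refl

  p≡[p-q]+q : ∀ p q → p ≡ (p ℚ.- q) ℚ.+ q
  p≡[p-q]+q = solve 2 (λ p q → p := (p :- q) :+ q) refl

  [p+q]-p≡q : ∀ p q → (p ℚ.+ q) ℚ.- p ≡ q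
  [p+q]-p≡q = solve 2 (λ p q → (p :+ q) :- p := q) refl

  factor : ∀ B B′ e i →
           B ℚ.* (e ℚ.* i) ℚ.+ (e ℚ.* i) ℚ.* B′ ≡ e ℚ.* (i ℚ.* (B ℚ.+ B′))
  factor = solve 4 (λ B B′ e i →
    B :* (e :* i) :+ (e :* i) :* B′ := e :* (i :* (B :+ B′))) refl

  cross : ∀ a b i j → (i ℚ.- j) ℚ.* (a ℚ.* b) ≡ (i ℚ.* a) ℚ.* b ℚ.- (j ℚ.* b) ℚ.* a
  cross = solve 4 (λ a b i j →
    (i :- j) :* (a :* b) := (i :* a) :* b :- (j :* b) :* a) refl

  potential : ∀ s y u H r →
    s ℚ.+ y ℚ.* u ℚ.+ (H ℚ.* ((1ℚ ℚ.- r) ℚ.* y)) ℚ.* u ≡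
    s ℚ.+ (H ℚ.* y) ℚ.* u ℚ.+ (1ℚ ℚ.- H ℚ.* r) ℚ.* (y ℚ.* u)
  potential = solve 5 (λ s y u H r →
    s :+ y :* u :+ (H :* ((con 1ℚ :- r) :* y)) :* u :=
    s :+ (H :* y) :* u :+ (con 1ℚ :- H :* r) :* (y :* u)) refl

  p+0*q≡p : ∀ p q → p ℚ.+ (1ℚ ℚ.- 1ℚ) ℚ.* q ≡ p
  p+0*q≡p = solve 2 (λ p q → p :+ (con 1ℚ :- con 1ℚ) :* q := p) refl

-- The reciprocal extended by inv 0 = 0.
inv : ℚ → ℚ
inv p with p ℚ.≟ 0ℚ
... | yes _   = 0ℚ
... | no  p≢0 = (ℚ.1/ p) {{ℚ.≢-nonZero p≢0}}

private

  inv-inverse : ∀ p → 0ℚ ℚ.< p → inv p ℚ.* p ≡ 1ℚ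
  inv-inverse p p>0 with p ℚ.≟ 0ℚ
  ... | yes p≡0 = contradiction p>0 (ℚ.<-irrefl (sym p≡0))
  ... | no  p≢0 = ℚ.*-inverseˡ p {{ℚ.≢-nonZero p≢0}}

  inv>0 : ∀ p → 0ℚ ℚ.< p → 0ℚ ℚ.< inv p
  inv>0 p p>0 = ℚ.*-cancelʳ-<-nonNeg p
    {{ℚ.nonNegative (ℚ.<⇒≤ p>0)}}
    (subst (ℚ._< inv p ℚ.* p) (sym (ℚ.*-zeroˡ p))
      (subst (0ℚ ℚ.<_) (sym (inv-inverse p p>0)) (ℚ.positive⁻¹ 1ℚ)))

-- Real numbers are Cauchy sequences of rationals, considered up to _≃_.

IsCauchy : (ℕ → ℚ) → Set
IsCauchy s = ∀ ε → 0ℚ ℚ.< ε →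
  ∃[ N ] ∀ m n → N ℕ.≤ m → N ℕ.≤ n → ℚ.∣ s m ℚ.- s n ∣ ℚ.≤ ε

record ℝ : Set where
  constructor mkℝ
  field
    seq    : ℕ → ℚ
    cauchy : IsCauchy seq

open ℝ

infix 4 _≤_ _<_ _≃_

_≤_ : ℝ → ℝ → Set
x ≤ y = ∀ ε → 0ℚ ℚ.< ε → Eventually λ n → seq x n ℚ.≤ seq y n ℚ.+ ε

_<_ : ℝ → ℝ → Set
x < y = ∃[ ε ] 0ℚ ℚ.< ε × Eventually λ n → seq x n ℚ.+ ε ℚ.≤ seq y n

_≃_ : ℝ → ℝ → Set
x ≃ y = x ≤ y × y ≤ x

fromℚ : ℚ → ℝ
fromℚ p = mkℝ (λ _ → p) λ ε ε>0 → 0 , λ _ _ _ _ →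
  subst (λ d → ℚ.∣ d ∣ ℚ.≤ ε) (sym (ℚ.+-inverseʳ p)) (ℚ.<⇒≤ ε>0)

0ℝ 1ℝ 2ℝ ½ℝ : ℝ
0ℝ = fromℚ 0ℚ
1ℝ = fromℚ 1ℚ
2ℝ = fromℚ (ℤ.+ 2 ℚ./ 1)
½ℝ = fromℚ ½

infix  8 -_
infixl 7 _*_
infixl 6 _+_ _-_

_+_ : ℝ → ℝ → ℝ
x + y = mkℝ (λ n → seq x n ℚ.+ seq y n) c
  where
  c : IsCauchy (λ n → seq x n ℚ.+ seq y n)
  c ε ε>0 with cauchy x (ε ℚ.* ½) (½>0 ε>0) | cauchy y (ε ℚ.* ½) (½>0 ε>0)
  ... | M , p | N , q = M ℕ.⊔ N , λ m n M⊔N≤m M⊔N≤n →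
    let a = seq x m ; a′ = seq x n ; b = seq y m ; b′ = seq y n
        open ℚ.≤-Reasoning
    in begin
      ℚ.∣ (a ℚ.+ b) ℚ.- (a′ ℚ.+ b′) ∣
        ≡⟨ cong ℚ.∣_∣ (split-+ a a′ b b′) ⟩
      ℚ.∣ (a ℚ.- a′) ℚ.+ (b ℚ.- b′) ∣
        ≤⟨ ℚ.∣p+q∣≤∣p∣+∣q∣ (a ℚ.- a′) (b ℚ.- b′) ⟩
      ℚ.∣ a ℚ.- a′ ∣ ℚ.+ ℚ.∣ b ℚ.- b′ ∣
        ≤⟨ ℚ.+-mono-≤
             (p m n (ℕ.m⊔n≤o⇒m≤o M N M⊔N≤m) (ℕ.m⊔n≤o⇒m≤o M N M⊔N≤n))
             (q m n (ℕ.m⊔n≤o⇒n≤o M N M⊔N≤m) (ℕ.m⊔n≤o⇒n≤o M N M⊔N≤n)) ⟩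
      ε ℚ.* ½ ℚ.+ ε ℚ.* ½
        ≡⟨ ½+½ ε ⟩
      ε ∎

-_ : ℝ → ℝ
- x = mkℝ (λ n → ℚ.- seq x n) λ ε ε>0 →
  let N , p = cauchy x ε ε>0 in
  N , λ m n N≤m N≤n → subst (ℚ._≤ ε)
    (trans (sym (ℚ.∣-p∣≡∣p∣ (seq x m ℚ.- seq x n)))
      (cong ℚ.∣_∣ (ℚ.neg-distrib-+ (seq x m) (ℚ.- seq x n))))
    (p m n N≤m N≤n)

_-_ : ℝ → ℝ → ℝ
x - y = x + - y

private

  bounded : ∀ x → ∃[ B ] 0ℚ ℚ.< B × Eventually λ n → ℚ.∣ seq x n ∣ ℚ.≤ B
  bounded x with cauchy x 1ℚ (ℚ.positive⁻¹ 1ℚ)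
  ... | N , p = 1ℚ ℚ.+ ℚ.∣ b ∣ , B>0 , N , λ n N≤n →
    let a = seq x n
        open ℚ.≤-Reasoning
    in begin
      ℚ.∣ a ∣
        ≡⟨ cong ℚ.∣_∣ (p≡[p-q]+q a b) ⟩
      ℚ.∣ (a ℚ.- b) ℚ.+ b ∣
        ≤⟨ ℚ.∣p+q∣≤∣p∣+∣q∣ (a ℚ.- b) b ⟩
      ℚ.∣ a ℚ.- b ∣ ℚ.+ ℚ.∣ b ∣
        ≤⟨ ℚ.+-monoˡ-≤ ℚ.∣ b ∣ (p n N N≤n ℕ.≤-refl) ⟩
      1ℚ ℚ.+ ℚ.∣ b ∣ ∎
    where
    b = seq x N
    B>0 : 0ℚ ℚ.< 1ℚ ℚ.+ ℚ.∣ b ∣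
    B>0 = ℚ.<-≤-trans (ℚ.positive⁻¹ 1ℚ) (p≤p+q 1ℚ (ℚ.0≤∣p∣ b))

private

  *-close : ∀ a a′ b b′ B B′ ε → 0ℚ ℚ.< B → 0ℚ ℚ.< ε → 0ℚ ℚ.< B ℚ.+ B′ →
            let δ = ε ℚ.* inv (B ℚ.+ B′) in
            ℚ.∣ a ∣ ℚ.≤ B → ℚ.∣ b′ ∣ ℚ.≤ B′ →
            ℚ.∣ a ℚ.- a′ ∣ ℚ.≤ δ → ℚ.∣ b ℚ.- b′ ∣ ℚ.≤ δ →
            ℚ.∣ a ℚ.* b ℚ.- a′ ℚ.* b′ ∣ ℚ.≤ ε
  *-close a a′ b b′ B B′ ε B>0 ε>0 D>0 ∣a∣≤B ∣b′∣≤B′ a~a′ b~b′ = begin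
    ℚ.∣ a ℚ.* b ℚ.- a′ ℚ.* b′ ∣
      ≡⟨ cong ℚ.∣_∣ (split-* a a′ b b′) ⟩
    ℚ.∣ a ℚ.* (b ℚ.- b′) ℚ.+ (a ℚ.- a′) ℚ.* b′ ∣
      ≤⟨ ℚ.∣p+q∣≤∣p∣+∣q∣ (a ℚ.* (b ℚ.- b′)) ((a ℚ.- a′) ℚ.* b′) ⟩
    ℚ.∣ a ℚ.* (b ℚ.- b′) ∣ ℚ.+ ℚ.∣ (a ℚ.- a′) ℚ.* b′ ∣
      ≡⟨ cong₂ ℚ._+_ (ℚ.∣p*q∣≡∣p∣*∣q∣ a (b ℚ.- b′)) (ℚ.∣p*q∣≡∣p∣*∣q∣ (a ℚ.- a′) b′) ⟩
    ℚ.∣ a ∣ ℚ.* ℚ.∣ b ℚ.- b′ ∣ ℚ.+ ℚ.∣ a ℚ.- a′ ∣ ℚ.* ℚ.∣ b′ ∣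
      ≤⟨ ℚ.+-mono-≤
           (*-mono-≤ ℚ.∣ a ∣ B ℚ.∣ b ℚ.- b′ ∣ δ
             (ℚ.0≤∣p∣ (b ℚ.- b′)) (ℚ.<⇒≤ B>0) ∣a∣≤B b~b′)
           (*-mono-≤ ℚ.∣ a ℚ.- a′ ∣ δ ℚ.∣ b′ ∣ B′
             (ℚ.0≤∣p∣ b′) (ℚ.<⇒≤ (*>0 ε>0 (inv>0 (B ℚ.+ B′) D>0))) a~a′ ∣b′∣≤B′) ⟩
    B ℚ.* δ ℚ.+ δ ℚ.* B′
      ≡⟨ factor B B′ ε (inv (B ℚ.+ B′)) ⟩
    ε ℚ.* (inv (B ℚ.+ B′) ℚ.* (B ℚ.+ B′))
      ≡⟨ cong (ε ℚ.*_) (inv-inverse (B ℚ.+ B′) D>0) ⟩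
    ε ℚ.* 1ℚ
      ≡⟨ ℚ.*-identityʳ ε ⟩
    ε ∎
    where
    open ℚ.≤-Reasoning
    δ = ε ℚ.* inv (B ℚ.+ B′)

  *-cauchy : ∀ x y → IsCauchy (λ n → seq x n ℚ.* seq y n)
  *-cauchy x y ε ε>0 = go (bounded x) (bounded y)
    where
    go : (∃[ B ] 0ℚ ℚ.< B × Eventually λ n → ℚ.∣ seq x n ∣ ℚ.≤ B) →
         (∃[ B ] 0ℚ ℚ.< B × Eventually λ n → ℚ.∣ seq y n ∣ ℚ.≤ B) →
         ∃[ N ] ∀ m n → N ℕ.≤ m → N ℕ.≤ n →
           ℚ.∣ seq x m ℚ.* seq y m ℚ.- seq x n ℚ.* seq y n ∣ ℚ.≤ ε
    go (B , B>0 , K , p) (B′ , B′>0 , K′ , p′) =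
      (K ℕ.⊔ K′) ℕ.⊔ (L ℕ.⊔ L′) , λ m n N≤m N≤n →
      *-close (seq x m) (seq x n) (seq y m) (seq y n) B B′ ε B>0 ε>0 D>0
        (p m (K≤ m N≤m)) (p′ n (K′≤ n N≤n))
        (proj₂ (cauchy x δ δ>0) m n (L≤ m N≤m) (L≤ n N≤n))
        (proj₂ (cauchy y δ δ>0) m n (L′≤ m N≤m) (L′≤ n N≤n))
      where
      D>0 : 0ℚ ℚ.< B ℚ.+ B′
      D>0 = ℚ.<-≤-trans B>0 (p≤p+q B (ℚ.<⇒≤ B′>0))
      δ : ℚ
      δ = ε ℚ.* inv (B ℚ.+ B′)
      δ>0 : 0ℚ ℚ.< δ
      δ>0 = *>0 ε>0 (inv>0 (B ℚ.+ B′) D>0)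
      L L′ : ℕ
      L  = proj₁ (cauchy x δ δ>0)
      L′ = proj₁ (cauchy y δ δ>0)
      module _ k (N≤k : (K ℕ.⊔ K′) ℕ.⊔ (L ℕ.⊔ L′) ℕ.≤ k) where
        K≤ : K ℕ.≤ k
        K≤ = ℕ.m⊔n≤o⇒m≤o K K′ (ℕ.m⊔n≤o⇒m≤o (K ℕ.⊔ K′) (L ℕ.⊔ L′) N≤k)
        K′≤ : K′ ℕ.≤ k
        K′≤ = ℕ.m⊔n≤o⇒n≤o K K′ (ℕ.m⊔n≤o⇒m≤o (K ℕ.⊔ K′) (L ℕ.⊔ L′) N≤k)
        L≤ : L ℕ.≤ k
        L≤ = ℕ.m⊔n≤o⇒m≤o L L′ (ℕ.m⊔n≤o⇒n≤o (K ℕ.⊔ K′) (L ℕ.⊔ L′) N≤k)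
        L′≤ : L′ ℕ.≤ k
        L′≤ = ℕ.m⊔n≤o⇒n≤o L L′ (ℕ.m⊔n≤o⇒n≤o (K ℕ.⊔ K′) (L ℕ.⊔ L′) N≤k)

_*_ : ℝ → ℝ → ℝ
x * y = mkℝ (λ n → seq x n ℚ.* seq y n) (*-cauchy x y)

infixr 8 _^_

_^_ : ℝ → ℕ → ℝ
x ^ zero  = 1ℝ
x ^ suc k = x * x ^ k

private

  inv-close : ∀ a b δ ε → 0ℚ ℚ.< δ → δ ℚ.≤ a → δ ℚ.≤ b →
              ℚ.∣ b ℚ.- a ∣ ℚ.≤ ε ℚ.* (δ ℚ.* δ) → ℚ.∣ inv a ℚ.- inv b ∣ ℚ.≤ ε
  inv-close a b δ ε δ>0 δ≤a δ≤b a~b =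
    ℚ.*-cancelʳ-≤-pos (δ ℚ.* δ) {{ℚ.positive (*>0 δ>0 δ>0)}} (begin
    D ℚ.* (δ ℚ.* δ)
      ≤⟨ ℚ.*-monoˡ-≤-nonNeg D {{ℚ.nonNegative (ℚ.0≤∣p∣ (inv a ℚ.- inv b))}}
           (*-mono-≤ δ a δ b (ℚ.<⇒≤ δ>0) (ℚ.<⇒≤ a>0) δ≤a δ≤b) ⟩
    D ℚ.* (a ℚ.* b)
      ≡⟨ cong (D ℚ.*_) (ℚ.0≤p⇒∣p∣≡p (*≥0 (ℚ.<⇒≤ a>0) (ℚ.<⇒≤ b>0))) ⟨
    D ℚ.* ℚ.∣ a ℚ.* b ∣
      ≡⟨ ℚ.∣p*q∣≡∣p∣*∣q∣ (inv a ℚ.- inv b) (a ℚ.* b) ⟨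
    ℚ.∣ (inv a ℚ.- inv b) ℚ.* (a ℚ.* b) ∣
      ≡⟨ cong ℚ.∣_∣ (cross a b (inv a) (inv b)) ⟩
    ℚ.∣ (inv a ℚ.* a) ℚ.* b ℚ.- (inv b ℚ.* b) ℚ.* a ∣
      ≡⟨ cong₂ (λ u v → ℚ.∣ u ℚ.* b ℚ.- v ℚ.* a ∣)
           (inv-inverse a a>0) (inv-inverse b b>0) ⟩
    ℚ.∣ 1ℚ ℚ.* b ℚ.- 1ℚ ℚ.* a ∣
      ≡⟨ cong₂ (λ u v → ℚ.∣ u ℚ.- v ∣) (ℚ.*-identityˡ b) (ℚ.*-identityˡ a) ⟩
    ℚ.∣ b ℚ.- a ∣
      ≤⟨ a~b ⟩
    ε ℚ.* (δ ℚ.* δ) ∎)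
    where
    open ℚ.≤-Reasoning
    D = ℚ.∣ inv a ℚ.- inv b ∣
    a>0 : 0ℚ ℚ.< a
    a>0 = ℚ.<-≤-trans δ>0 δ≤a
    b>0 : 0ℚ ℚ.< b
    b>0 = ℚ.<-≤-trans δ>0 δ≤b

  recip-cauchy : ∀ x → 0ℝ < x → IsCauchy (λ n → inv (seq x n))
  recip-cauchy x (δ , δ>0 , K , 0+δ≤x) ε ε>0 = K ℕ.⊔ L , λ m n N≤m N≤n →
    inv-close (seq x m) (seq x n) δ ε δ>0
      (δ≤ m (ℕ.m⊔n≤o⇒m≤o K L N≤m)) (δ≤ n (ℕ.m⊔n≤o⇒m≤o K L N≤n))
      (proj₂ (cauchy x η η>0) n m (ℕ.m⊔n≤o⇒n≤o K L N≤n) (ℕ.m⊔n≤o⇒n≤o K L N≤m))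
    where
    δ≤ : ∀ n → K ℕ.≤ n → δ ℚ.≤ seq x n
    δ≤ n K≤n = subst (ℚ._≤ seq x n) (ℚ.+-identityˡ δ) (0+δ≤x n K≤n)
    η : ℚ
    η = ε ℚ.* (δ ℚ.* δ)
    η>0 : 0ℚ ℚ.< η
    η>0 = *>0 ε>0 (*>0 δ>0 δ>0)
    L : ℕ
    L = proj₁ (cauchy x η η>0)

recip : (x : ℝ) → 0ℝ < x → ℝ
recip x x>0 = mkℝ (λ n → inv (seq x n)) (recip-cauchy x x>0)

infix 4 _⟶_

_⟶_ : (ℕ → ℝ) → ℝ → Set
x ⟶ l = ∀ ε → 0ℝ < ε → Eventually λ n → l - ε < x n × x n < l + ε

infixr 8 _^ℚ_

_^ℚ_ : ℚ → ℕ → ℚ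
x ^ℚ zero  = 1ℚ
x ^ℚ suc k = x ℚ.* x ^ℚ k

-- log-series x k = Σ_{j=1}^{k} x^j / j, converging to - log (1 - x).
log-series : ℚ → ℕ → ℚ
log-series x zero    = 0ℚ
log-series x (suc k) = log-series x k ℚ.+ x ^ℚ suc k ℚ.* (ℤ.+ 1 ℚ./ suc k)

private

  1/>0 : ∀ k → 0ℚ ℚ.< ℤ.+ 1 ℚ./ suc k
  1/>0 k = ℚ.positive⁻¹ (ℤ.+ 1 ℚ./ suc k) {{ℚ.normalize-pos 1 (suc k)}}

  1/-antitone : ∀ {k l} → k ℕ.≤ l → ℤ.+ 1 ℚ./ suc l ℚ.≤ ℤ.+ 1 ℚ./ suc k
  1/-antitone {k} {l} k≤l = ℚ.toℚᵘ-cancel-≤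
    (ℚᵘ.≤-respˡ-≃ (ℚᵘ.≃-sym (ℚ.toℚᵘ-fromℚᵘ (ℚᵘ.mkℚᵘ (ℤ.+ 1) l)))
    (ℚᵘ.≤-respʳ-≃ (ℚᵘ.≃-sym (ℚ.toℚᵘ-fromℚᵘ (ℚᵘ.mkℚᵘ (ℤ.+ 1) k)))
      (ℚᵘ.*≤* (ℤ.*-monoˡ-≤-nonNeg (ℤ.+ 1) (ℤ.+≤+ (ℕ.s≤s k≤l))))))

  1/-inverse : ∀ k → ℤ.+ suc k ℚ./ 1 ℚ.* (ℤ.+ 1 ℚ./ suc k) ≡ 1ℚ
  1/-inverse k = ℚ.toℚᵘ-injective (ℚᵘ.≃-trans
    (ℚ.toℚᵘ-homo-* (ℤ.+ suc k ℚ./ 1) (ℤ.+ 1 ℚ./ suc k)) (ℚᵘ.≃-trans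
    (ℚᵘ.*-cong (ℚ.toℚᵘ-fromℚᵘ (ℚᵘ.mkℚᵘ (ℤ.+ suc k) 0))
               (ℚ.toℚᵘ-fromℚᵘ (ℚᵘ.mkℚᵘ (ℤ.+ 1) k)))
    (ℚᵘ.*≡* (cong ℤ.+_ (trans (ℕ.*-identityʳ _) (trans (ℕ.*-identityʳ (suc k))
      (sym (trans (ℕ.*-identityˡ _) (ℕ.*-identityˡ (suc k))))))))))

  archimedean : ∀ m ε → 0ℚ ℚ.< ε →
                ∃[ N ] ℤ.+ suc m ℚ./ 1 ℚ.* (ℤ.+ 1 ℚ./ suc N) ℚ.≤ ε
  archimedean m ε@(ℚ.mkℚ (ℤ.+ zero) d c) ε>0 =
    contradiction ε>0 (λ { (ℚ.*<* (ℤ.+<+ ())) })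
  archimedean m ε@(ℚ.mkℚ ℤ.-[1+ _ ] d c) ε>0 =
    contradiction ε>0 (λ { (ℚ.*<* ()) })
  archimedean m ε@(ℚ.mkℚ (ℤ.+ suc a) d c) ε>0 = N , ℚ.toℚᵘ-cancel-≤
    (ℚᵘ.≤-respˡ-≃ (ℚᵘ.≃-sym (ℚᵘ.≃-trans
      (ℚ.toℚᵘ-homo-* (ℤ.+ suc m ℚ./ 1) (ℤ.+ 1 ℚ./ suc N))
      (ℚᵘ.*-cong (ℚ.toℚᵘ-fromℚᵘ (ℚᵘ.mkℚᵘ (ℤ.+ suc m) 0))
                 (ℚ.toℚᵘ-fromℚᵘ (ℚᵘ.mkℚᵘ (ℤ.+ 1) N)))))
      (ℚᵘ.*≤* (ℤ.+≤+ le)))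
    where
    N = d ℕ.+ m ℕ.* suc d
    le : (suc m ℕ.* 1) ℕ.* suc d ℕ.≤ suc a ℕ.* (1 ℕ.* suc N)
    le = ℕ.≤-trans
      (ℕ.≤-reflexive (trans (cong (ℕ._* suc d) (ℕ.*-identityʳ (suc m)))
                            (sym (ℕ.*-identityˡ (suc N)))))
      (ℕ.m≤n*m (1 ℕ.* suc N) (suc a))

module _ (m : ℕ) where

  private
    r x H : ℚ
    r = ℤ.+ 1 ℚ./ suc m
    x = 1ℚ ℚ.- r
    H = ℤ.+ suc m ℚ./ 1

    s : ℕ → ℚ
    s = log-series x

    x≥0 : 0ℚ ℚ.≤ x
    x≥0 = p-q≥0 (1/-antitone {0} {m} ℕ.z≤n)

    x≤1 : x ℚ.≤ 1ℚ
    x≤1 = subst (x ℚ.≤_) (sym (p≡[p-q]+q 1ℚ r))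
      (p≤p+q x (ℚ.<⇒≤ (1/>0 m)))

    H≥0 : 0ℚ ℚ.≤ H
    H≥0 = ℚ.<⇒≤ (ℚ.positive⁻¹ H {{ℚ.normalize-pos (suc m) 1}})

    x^≥0 : ∀ k → 0ℚ ℚ.≤ x ^ℚ k
    x^≥0 zero    = ℚ.nonNegative⁻¹ 1ℚ
    x^≥0 (suc k) = *≥0 x≥0 (x^≥0 k)

    x^-step : ∀ k → x ^ℚ suc k ℚ.≤ x ^ℚ k
    x^-step k = subst (x ^ℚ suc k ℚ.≤_) (ℚ.*-identityˡ (x ^ℚ k))
      (ℚ.*-monoʳ-≤-nonNeg (x ^ℚ k) {{ℚ.nonNegative (x^≥0 k)}} x≤1)

    x^≤1 : ∀ k → x ^ℚ k ℚ.≤ 1ℚ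
    x^≤1 zero    = ℚ.≤-refl
    x^≤1 (suc k) = ℚ.≤-trans (x^-step k) (x^≤1 k)

    s-step : ∀ k → s k ℚ.≤ s (suc k)
    s-step k = p≤p+q (s k) (*≥0 (x^≥0 (suc k)) (ℚ.<⇒≤ (1/>0 k)))

    s-mono : ∀ k l → s k ℚ.≤ s (l ℕ.+ k)
    s-mono k zero    = ℚ.≤-refl
    s-mono k (suc l) = ℚ.≤-trans (s-mono k l) (s-step (l ℕ.+ k))

    module _ (N : ℕ) where
      u : ℚ
      u = ℤ.+ 1 ℚ./ suc N

      φ : ℕ → ℚ
      φ k = s k ℚ.+ (H ℚ.* x ^ℚ k) ℚ.* u

      φ-step : ∀ k → N ℕ.≤ k → φ (suc k) ℚ.≤ φ k
      φ-step k N≤k = begin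
        s k ℚ.+ x ^ℚ suc k ℚ.* (ℤ.+ 1 ℚ./ suc k) ℚ.+ (H ℚ.* (x ℚ.* x ^ℚ k)) ℚ.* u
          ≤⟨ ℚ.+-monoˡ-≤ ((H ℚ.* (x ℚ.* x ^ℚ k)) ℚ.* u) (ℚ.+-monoʳ-≤ (s k)
               (*-mono-≤ (x ^ℚ suc k) (x ^ℚ k) (ℤ.+ 1 ℚ./ suc k) u
                 (ℚ.<⇒≤ (1/>0 k)) (x^≥0 k) (x^-step k) (1/-antitone N≤k))) ⟩
        s k ℚ.+ x ^ℚ k ℚ.* u ℚ.+ (H ℚ.* (x ℚ.* x ^ℚ k)) ℚ.* u
          ≡⟨ potential (s k) (x ^ℚ k) u H r ⟩
        s k ℚ.+ (H ℚ.* x ^ℚ k) ℚ.* u ℚ.+ (1ℚ ℚ.- H ℚ.* r) ℚ.* (x ^ℚ k ℚ.* u)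
          ≡⟨ cong (λ z → φ k ℚ.+ (1ℚ ℚ.- z) ℚ.* (x ^ℚ k ℚ.* u)) (1/-inverse m) ⟩
        φ k ℚ.+ (1ℚ ℚ.- 1ℚ) ℚ.* (x ^ℚ k ℚ.* u)
          ≡⟨ p+0*q≡p (φ k) (x ^ℚ k ℚ.* u) ⟩
        φ k ∎
        where open ℚ.≤-Reasoning

      φ-antitone : ∀ k l → N ℕ.≤ k → φ (l ℕ.+ k) ℚ.≤ φ k
      φ-antitone k zero    N≤k = ℚ.≤-refl
      φ-antitone k (suc l) N≤k = ℚ.≤-trans
        (φ-step (l ℕ.+ k) (ℕ.≤-trans N≤k (ℕ.m≤n+m k l))) (φ-antitone k l N≤k)

      tail : ∀ k l → N ℕ.≤ k → s (l ℕ.+ k) ℚ.- s k ℚ.≤ H ℚ.* u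
      tail k l N≤k = begin
        s (l ℕ.+ k) ℚ.- s k
          ≤⟨ ℚ.+-monoˡ-≤ (ℚ.- s k) (p≤p+q (s (l ℕ.+ k))
               (*≥0 (*≥0 H≥0 (x^≥0 (l ℕ.+ k))) (ℚ.<⇒≤ (1/>0 N)))) ⟩
        φ (l ℕ.+ k) ℚ.- s k
          ≤⟨ ℚ.+-monoˡ-≤ (ℚ.- s k) (φ-antitone k l N≤k) ⟩
        φ k ℚ.- s k
          ≡⟨ [p+q]-p≡q (s k) ((H ℚ.* x ^ℚ k) ℚ.* u) ⟩
        (H ℚ.* x ^ℚ k) ℚ.* u
          ≤⟨ ℚ.*-monoʳ-≤-nonNeg u {{ℚ.nonNegative (ℚ.<⇒≤ (1/>0 N))}}
               (ℚ.*-monoˡ-≤-nonNeg H {{ℚ.nonNegative H≥0}} (x^≤1 k)) ⟩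
        (H ℚ.* 1ℚ) ℚ.* u
          ≡⟨ cong (ℚ._* u) (ℚ.*-identityʳ H) ⟩
        H ℚ.* u ∎
        where open ℚ.≤-Reasoning

      close : ∀ k n → k ℕ.≤ n → N ℕ.≤ k → ℚ.∣ s n ℚ.- s k ∣ ℚ.≤ H ℚ.* u
      close k n k≤n N≤k = subst (λ j → ℚ.∣ s j ℚ.- s k ∣ ℚ.≤ H ℚ.* u) (ℕ.m∸n+n≡m k≤n)
        (subst (ℚ._≤ H ℚ.* u)
          (sym (ℚ.0≤p⇒∣p∣≡p (p-q≥0 (s-mono k (n ℕ.∸ k)))))
          (tail k (n ℕ.∸ k) N≤k))

  log-series-cauchy : IsCauchy (log-series (1ℚ ℚ.- ℤ.+ 1 ℚ./ suc m))
  log-series-cauchy ε ε>0 with archimedean m ε ε>0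
  ... | N , Hu≤ε = N , est
    where
    est : ∀ k n → N ℕ.≤ k → N ℕ.≤ n → ℚ.∣ s k ℚ.- s n ∣ ℚ.≤ ε
    est k n N≤k N≤n with ℕ.≤-total k n
    ... | inj₁ k≤n = ℚ.≤-trans
      (subst (ℚ._≤ H ℚ.* (ℤ.+ 1 ℚ./ suc N)) (∣p-q∣≡∣q-p∣ (s n) (s k)) (close N k n k≤n N≤k)) Hu≤ε
    ... | inj₂ n≤k = ℚ.≤-trans (close N n k n≤k N≤n) Hu≤ε

-- The natural logarithm, as log h = - log (1 - (1 - 1/h)) for h ≥ 1; log 0 is a junk value.
log : ℕ → ℝ
log zero    = 0ℝ
log (suc m) = mkℝ (log-series (1ℚ ℚ.- ℤ.+ 1 ℚ./ suc m)) (log-series-cauchy m)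

∑ : {A : Set} → List A → (A → ℝ) → ℝ
∑ xs f = foldr _+_ 0ℝ (map f xs)

record FinSpace (A : Set) : Set where
  field
    outcomes : List A
    mass     : A → ℝ

open FinSpace

IsProbability : {A : Set} → FinSpace A → Set
IsProbability X = (∀ x → 0ℝ ≤ mass X x) × ∑ (outcomes X) (mass X) ≃ 1ℝ

ℙ : {A : Set} {P : Pred A 0ℓ} → FinSpace A → Decidable P → ℝ
ℙ X P? = ∑ (outcomes X) λ x → if does (P? x) then mass X x else 0ℝ

bernoulli : ℝ → FinSpace Side
bernoulli ρ = record
  { outcomes = inside ∷ outside ∷ []
  ; mass     = λ { inside → ρ ; outside → 1ℝ - ρ }
  }

uniform : ∀ h → FinSpace (Fin h)
uniform zero    = record { outcomes = [] ; mass = λ () }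
uniform (suc k) = record
  { outcomes = allFin (suc k) ; mass = λ _ → fromℚ (ℤ.+ 1 ℚ./ suc k) }

infixr 2 _⊗_

_⊗_ : {A B : Set} → FinSpace A → FinSpace B → FinSpace (A × B)
X ⊗ Y = record
  { outcomes = cartesianProduct (outcomes X) (outcomes Y)
  ; mass     = λ (x , y) → mass X x * mass Y y
  }

vectors : {A : Set} → List A → ∀ m → List (Vec A m)
vectors xs zero    = [] ∷ []
vectors xs (suc m) = cartesianProductWith _∷_ xs (vectors xs m)

iid : {A : Set} → FinSpace A → ∀ m → FinSpace (Vec A m)
iid X m = record
  { outcomes = vectors (outcomes X) m
  ; mass     = λ v → Vec.foldr′ _*_ 1ℝ (Vec.map (mass X) v)
  }

percolation : ∀ m → ℝ → FinSpace (Subset m)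
percolation m ρ = iid (bernoulli ρ) m

Colouring : ℕ → ℕ → Set
Colouring m h = Vec (Fin h) m

colouring : ∀ m h → FinSpace (Colouring m h)
colouring m h = iid (uniform h) m

Family : ℕ → Set
Family m = Subset m → Bool

infix 4 _∈ᶠ_

_∈ᶠ_ : ∀ {m} → Subset m → Family m → Set
A ∈ᶠ 𝒜 = T (𝒜 A)

_IsUniform_ : ∀ {m} → Family m → ℕ → Set
𝒜 IsUniform h = ∀ A → A ∈ᶠ 𝒜 → ∣ A ∣ ≡ h

module _ {m : ℕ} where

  Contains : Family m → Pred (Subset m) 0ℓ
  Contains 𝒜 S = ∃ λ A → A ∈ᶠ 𝒜 × A ⊆ S

  contains? : (𝒜 : Family m) → Decidable (Contains 𝒜)
  contains? 𝒜 S = anySubset? λ A → T? (𝒜 A) ×-dec (A ⊆? S)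

  measureOn : (Subset m → ℝ) → FinSpace (Subset m)
  measureOn μ = record { outcomes = vectors (inside ∷ outside ∷ []) m ; mass = μ }

  IsSpread : ℝ → (Subset m → ℝ) → Set
  IsSpread q μ = ∀ S → ℙ (measureOn μ) (S ⊆?_) ≤ q ^ ∣ S ∣

  SupportsSpread : Family m → ℝ → Set
  SupportsSpread 𝒜 q = Σ (Subset m → ℝ) λ μ →
    IsProbability (measureOn μ) ×
    IsSpread q μ ×
    ℙ (measureOn μ) (λ A → T? (𝒜 A)) ≃ 1ℝ

module _ {m h : ℕ} where

  Rainbow : Colouring m h → Pred (Subset m) 0ℓ
  Rainbow c A = ∀ i → i ∈ A → ∀ j → j ∈ A → Vec.lookup c i ≡ Vec.lookup c j → i ≡ j

  rainbow? : (c : Colouring m h) → Decidable (Rainbow c)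
  rainbow? c A = Fin.all? λ i → (i ∈? A) →-dec Fin.all? λ j → (j ∈? A) →-dec
    ((Vec.lookup c i Fin.≟ Vec.lookup c j) →-dec (i Fin.≟ j))

  AdmitsRainbow : Family m → Pred (Colouring m h) 0ℓ
  AdmitsRainbow 𝒜 c = ∃ λ A → A ∈ᶠ 𝒜 × Rainbow c A

  admitsRainbow? : (𝒜 : Family m) → Decidable (AdmitsRainbow 𝒜)
  admitsRainbow? 𝒜 c = anySubset? λ A → T? (𝒜 A) ×-dec rainbow? c A

  ContainsRainbow : Family m → Pred (Colouring m h × Subset m) 0ℓ
  ContainsRainbow 𝒜 (c , S) = ∃ λ A → A ∈ᶠ 𝒜 × Rainbow c A × A ⊆ S

  containsRainbow? : (𝒜 : Family m) → Decidable (ContainsRainbow 𝒜)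
  containsRainbow? 𝒜 (c , S) =
    anySubset? λ A → T? (𝒜 A) ×-dec (rainbow? c A ×-dec (A ⊆? S))

{-# OPTIONS --safe #-}
module Submission where

-- Conditioning the ϑ-percolation on containing a member, and then choosing one contained member,
-- gives a measure with μ⟨S⟩ ≤ ϑ^|S| / a ≤ (ϑ/a)^|S|.
--
-- For the rainbow statements, equip each member with a uniformly random bijective colouring.  Since
-- h^s (h - s)! ≤ 4^s h!, this is a 4q/h-spread measure on the h-subsets of Ω × [h] which use each
-- point and each colour at most once.  Exposing a random set W, replace every e in its support by a
-- minimum fragment e' \ W with e' ⊆ e ∪ W a member.  A fragment T is contained in every member
-- inside W ∪ T, so the pair (W , T) is determined by W ∪ T up to a choice of a subset of one member,
-- and the expected mass of the fragments larger than half the original size is exponentially small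
-- already when W has density 64 q/h.  After about log₂ h rounds all sizes are at most a constant s,
-- and one last round of density larger by a factor log h finishes: the failure probability is at
-- most 2^(1-s) once h ≥ 2^(4^s).  Finally, McDiarmid's clutter inequality replaces the independent
-- percolation of Ω × [h] by the percolation of Ω with independent uniform colours.
--
-- All of this is a finite computation valid in any ordered semiring with the reciprocals of the
-- positive integers; only the limits and the comparison of log with log₂ concern ℝ itself.

open import Algebra.Bundles using (CommutativeSemiring)
import Algebra.Properties.CommutativeSemiring.Exp as Exp
import Algebra.Properties.Semiring.Mult as Mult
import Algebra.Solver.Ring.NaturalCoefficients.Default as RingSolver
open import Data.Bool.Base using (T; true; false; if_then_else_; _∨_)
import Data.Bool.Properties as Bool
open import Data.Bool.Properties using (T?)
open import Data.Fin.Base using (Fin; zero; suc)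
import Data.Fin.Properties as Fin
open import Data.Fin.Subset
  using (Subset; Side; inside; outside; ∣_∣; _⊆_; ⊥; ⊤; ⁅_⁆; ∁; _∪_; _─_; Nonempty; Empty)
  renaming (_∈_ to _∈ˢ_; _∉_ to _∉ˢ_; _-_ to _-ˢ_)
open import Data.Fin.Subset.Properties
  using (_∈?_; _⊆?_; nonempty?; x∈p∪q⁺; x∈p∪q⁻; p⊆p∪q; q⊆p∪q; p─q⊆p; p─⊥≡p; x∈p∧x∉q⇒x∈p─q;
         p⊂q⇒∣p∣<∣q∣; p⊆q⇒∣p∣≤∣q∣; ∣q∣≤∣p∪q∣; ∣⁅x⁆∣≡1; ∣⊥∣≡0; ∣⊤∣≡n; ⊆-refl; ⊆-trans; ⊥⊆; ∉⊥;
         x∉p⇒x∈∁p; x∈⁅x⁆; x∈⁅y⁆⇒x≡y; Empty-unique; drop-∷-⊆; s⊆s; out⊆)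
import Data.Integer.Base as ℤ
import Data.Integer.Properties as ℤ
open import Data.List.Base as List
  using (List; []; _∷_; map; foldr; filter; length; allFin; concatMap;
         cartesianProduct; cartesianProductWith)
import Data.List.Extrema.Nat as Extrema
open import Data.List.Membership.Propositional using (_∈_; lose; find)
open import Data.List.Membership.Propositional.Properties
  using (∈-allFin; ∈-cartesianProductWith⁺; ∈-concatMap⁻; ∈-filter⁺; ∈-filter⁻; ∈-map⁻)
open import Data.List.Properties using (length-tabulate; map-tabulate)
import Data.List.Relation.Unary.All as All
open import Data.List.Relation.Unary.Any as Any using (Any; any?; here; there)
open import Data.Maybe.Base using (Maybe; just; nothing)
open import Data.Nat.Base as ℕ using (ℕ; zero; suc; _!; ⌊_/2⌋; ⌈_/2⌉)
import Data.Nat.Properties as ℕ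
import Data.Nat.Solver as ℕ
open import Data.Product using (Σ; ∃-syntax; _×_; _,_; proj₁; proj₂)
open import Data.Rational.Base as ℚ using (ℚ; 0ℚ; 1ℚ)
import Data.Rational.Properties as ℚ
open import Data.Rational.Solver using (module +-*-Solver)
import Data.Rational.Unnormalised.Base as ℚᵘ
import Data.Rational.Unnormalised.Properties as ℚᵘ
open import Data.Sum.Base using (inj₁; inj₂)
import Data.Unit.Base as Unit
open import Data.Vec.Base as Vec using (Vec; []; _∷_; _++_; concat; here; there)
import Data.Vec.Properties as Vec
open import Function.Base using (_∘_; id; case_of_)
open import Level using (0ℓ)
open import Relation.Binary.Bundles using (Poset)
open import Relation.Binary.PropositionalEquality as ≡
  using (_≡_; refl; sym; trans; cong; cong₂; subst)
import Relation.Binary.Reasoning.PartialOrder as PosetReasoning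
open import Relation.Binary.Structures using (IsPartialOrder)
open import Relation.Nullary using (Dec; yes; no; does; ¬_; ¬?; contradiction; _×-dec_)
open import Relation.Unary using (Pred; Decidable)

open import Defs
  using (vectors; Family; _∈ᶠ_; _IsUniform_; Contains; contains?; Rainbow;
         admitsRainbow?; ContainsRainbow; containsRainbow?; inv)

-- The fragment argument needs a product measure, because mass is moved from W to W ∪ T coordinate
-- by coordinate. A uniform colouring is not one on Ω × [h], as the colours of a single point
-- exclude each other. Hence the detour through independent percolation of Ω × [h] at density ρ/h.
-- Since members have h points and the palette h colours, a rainbow member is exactly a bijectively
-- coloured one, so the h! bijections carry all the mass.
--
-- Constants: the ratio θ = 1/16 is chosen so that the 2^L subsets of a member of size L, weighted
-- by θ^(L/2) = 4^(-L), leave 2^(-L). Half of ρ/h is shared by r + 1 halving rounds, where 2^r ≤ h <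
-- 2^(r+1), and half is kept for the last round. Spread 4q/h then asks for ρ ≥ 4 · 16 · 2 (r + 1) q
-- = 128 (r + 1) q. Finally r + 1 ≤ 2r and r ≤ 4 log h give ρ ≥ 1024 q log h.
--
-- A semiring has no subtraction and its order is not decidable. So complementary probabilities are
-- variables of their own, and case distinctions concern only finite sets and natural numbers, never
-- weights.

private variable
  k l h m : ℕ

∈-vectors : ∀ {A : Set} {xs : List A} → (∀ x → x ∈ xs) → ∀ {m} (v : Vec A m) → v ∈ vectors xs m
∈-vectors all∈ []      = here ≡.refl
∈-vectors all∈ (x ∷ v) = ∈-cartesianProductWith⁺ _∷_ (all∈ x) (∈-vectors all∈ v)

-- Finite sums and expectations over an ordered semiring

record OrderedSemiring : Set₁ where
  field
    commutativeSemiring : CommutativeSemiring 0ℓ 0ℓ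

  open CommutativeSemiring commutativeSemiring public hiding (refl; sym; trans; reflexive; zero)

  infix 4 _≤_
  field
    _≤_            : Carrier → Carrier → Set
    isPartialOrder : IsPartialOrder _≈_ _≤_
    +-mono-≤       : ∀ {x x′ y y′} → x ≤ x′ → y ≤ y′ → x + y ≤ x′ + y′
    -- Cancellation is what remains of subtraction: inequalities between differences are proved
    -- after adding a common term to both sides.
    +-cancelʳ-≤    : ∀ z {x y} → x + z ≤ y + z → x ≤ y
    *-monoʳ-≤      : ∀ {x y z} → 0# ≤ z → x ≤ y → x * z ≤ y * z
    0≤1            : 0# ≤ 1#

  poset : Poset 0ℓ 0ℓ 0ℓ
  poset = record { isPartialOrder = isPartialOrder }

  open Mult semiring public using (×1-homo-*; ×-homo-+) renaming (_×_ to _·_)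

  field
    1/suc         : ℕ → Carrier
    0≤1/suc       : ∀ n → 0# ≤ 1/suc n
    1/suc-inverse : ∀ n → 1/suc n * (suc n · 1#) ≈ 1#

module FiniteSums (K : OrderedSemiring) where

  open OrderedSemiring K public renaming (Carrier to R)
  open IsPartialOrder isPartialOrder public
    using (module Eq) renaming (refl to ≤-refl; trans to ≤-trans; reflexive to ≤-reflexive)
  open Eq public using () renaming (refl to ≈-refl; sym to ≈-sym; trans to ≈-trans)
  open PosetReasoning poset public
  open RingSolver commutativeSemiring public using (solve; _:+_; _:*_; _:=_; con)
  open Exp commutativeSemiring public using (_^_; ^-homo-*; ^-distrib-*; ^-congˡ)

  private variable
    A B : Set
    x y z x′ y′ : R

  *-monoˡ-≤ : 0# ≤ z → x ≤ y → z * x ≤ z * y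
  *-monoˡ-≤ {z} {x} {y} z≥0 x≤y = begin
    z * x ≈⟨ *-comm z x ⟩
    x * z ≤⟨ *-monoʳ-≤ z≥0 x≤y ⟩
    y * z ≈⟨ *-comm y z ⟩
    z * y ∎

  *-mono-≤ : 0# ≤ y → 0# ≤ x′ → x ≤ x′ → y ≤ y′ → x * y ≤ x′ * y′
  *-mono-≤ y≥0 x′≥0 x≤x′ y≤y′ = ≤-trans (*-monoʳ-≤ y≥0 x≤x′) (*-monoˡ-≤ x′≥0 y≤y′)

  +-nonneg : 0# ≤ x → 0# ≤ y → 0# ≤ x + y
  +-nonneg x≥0 y≥0 = ≤-trans (≤-reflexive (≈-sym (+-identityˡ 0#))) (+-mono-≤ x≥0 y≥0)

  *-nonneg : 0# ≤ x → 0# ≤ y → 0# ≤ x * y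
  *-nonneg {x} {y} x≥0 y≥0 = ≤-trans (≤-reflexive (≈-sym (zeroˡ y))) (*-monoʳ-≤ y≥0 x≥0)

  x≤x+y : 0# ≤ y → x ≤ x + y
  x≤x+y {y} {x} y≥0 = ≤-trans (≤-reflexive (≈-sym (+-identityʳ x))) (+-mono-≤ ≤-refl y≥0)

  y≤x+y : 0# ≤ x → y ≤ x + y
  y≤x+y {x} {y} x≥0 = ≤-trans (x≤x+y x≥0) (≤-reflexive (+-comm y x))

  ≡⇒≈ : x ≡ y → x ≈ y
  ≡⇒≈ ≡.refl = ≈-refl

  antisym-0 : 0# ≤ x → x ≤ 0# → x ≈ 0#
  antisym-0 x≥0 x≤0 = IsPartialOrder.antisym isPartialOrder x≤0 x≥0

  ·-cong : ∀ {m n} → m ≡ n → m · 1# ≈ n · 1#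
  ·-cong ≡.refl = ≈-refl

  ^-nonneg : 0# ≤ x → ∀ n → 0# ≤ x ^ n
  ^-nonneg x≥0 zero    = 0≤1
  ^-nonneg x≥0 (suc n) = *-nonneg x≥0 (^-nonneg x≥0 n)

  ^-mono-≤ : 0# ≤ x → x ≤ y → ∀ n → x ^ n ≤ y ^ n
  ^-mono-≤ x≥0 x≤y zero    = ≤-refl
  ^-mono-≤ x≥0 x≤y (suc n) =
    *-mono-≤ (^-nonneg x≥0 n) (≤-trans x≥0 x≤y) x≤y (^-mono-≤ x≥0 x≤y n)

  ^-antitone : 0# ≤ x → x ≤ 1# → ∀ {m n} → m ℕ.≤ n → x ^ n ≤ x ^ m
  ^-antitone x≥0 x≤1 {n = zero}  ℕ.z≤n = ≤-refl
  ^-antitone {x} x≥0 x≤1 {n = suc n} ℕ.z≤n = begin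
    x * x ^ n ≤⟨ *-monoʳ-≤ (^-nonneg x≥0 n) x≤1 ⟩
    1# * x ^ n ≈⟨ *-identityˡ _ ⟩
    x ^ n ≤⟨ ^-antitone x≥0 x≤1 {n = n} ℕ.z≤n ⟩
    1# ∎
  ^-antitone x≥0 x≤1 (ℕ.s≤s m≤n) = *-monoˡ-≤ x≥0 (^-antitone x≥0 x≤1 m≤n)

  ·-nonneg : ∀ n → 0# ≤ n · 1#
  ·-nonneg zero    = ≤-refl
  ·-nonneg (suc n) = +-nonneg 0≤1 (·-nonneg n)

  ·-mono-≤ : ∀ {m n} → m ℕ.≤ n → m · 1# ≤ n · 1#
  ·-mono-≤ {n = n} ℕ.z≤n = ·-nonneg n
  ·-mono-≤ (ℕ.s≤s m≤n) = +-mono-≤ ≤-refl (·-mono-≤ m≤n)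

  [_] : {P : Set} → Dec P → R
  [ P? ] = if does P? then 1# else 0#

  module _ {P : Set} where

    []-nonneg : (P? : Dec P) → 0# ≤ [ P? ]
    []-nonneg (yes _) = 0≤1
    []-nonneg (no _)  = ≤-refl

    []≤1 : (P? : Dec P) → [ P? ] ≤ 1#
    []≤1 (yes _) = ≤-refl
    []≤1 (no _)  = 0≤1

    []-true : (P? : Dec P) → P → [ P? ] ≈ 1#
    []-true (yes _) _ = ≈-refl
    []-true (no ¬p) p = contradiction p ¬p

    []-false : (P? : Dec P) → ¬ P → [ P? ] ≈ 0#
    []-false (yes p) ¬p = contradiction p ¬p
    []-false (no _)  _  = ≈-refl

    []-¬ : (P? : Dec P) → [ P? ] + [ ¬? P? ] ≈ 1#
    []-¬ (yes _) = +-identityʳ 1#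
    []-¬ (no _)  = +-identityˡ 1#

    []*-mono : (P? : Dec P) → (P → x ≤ y) → [ P? ] * x ≤ [ P? ] * y
    []*-mono (yes p) h = *-monoˡ-≤ 0≤1 (h p)
    []*-mono {x} {y} (no _) h = ≤-reflexive (≈-trans (zeroˡ x) (≈-sym (zeroˡ y)))

    []*-cong : (P? : Dec P) → (P → x ≈ y) → [ P? ] * x ≈ [ P? ] * y
    []*-cong (yes p) h = *-congˡ (h p)
    []*-cong {x} {y} (no _) h = ≈-trans (zeroˡ x) (≈-sym (zeroˡ y))

    []*-nonneg : (P? : Dec P) → 0# ≤ x → 0# ≤ [ P? ] * x
    []*-nonneg P? = *-nonneg ([]-nonneg P?)

    []*≤ : (P? : Dec P) → 0# ≤ x → [ P? ] * x ≤ x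
    []*≤ {x} P? x≥0 = ≤-trans (*-monoʳ-≤ x≥0 ([]≤1 P?)) (≤-reflexive (*-identityˡ x))

  []-mono : {P Q : Set} (P? : Dec P) (Q? : Dec Q) → (P → Q) → [ P? ] ≤ [ Q? ]
  []-mono (yes p) (yes _) f = ≤-refl
  []-mono (yes p) (no ¬q) f = contradiction (f p) ¬q
  []-mono (no _)  Q?      f = []-nonneg Q?

  []-cong : {P Q : Set} (P? : Dec P) (Q? : Dec Q) → (P → Q) → (Q → P) → [ P? ] ≈ [ Q? ]
  []-cong (yes p) Q? f g = ≈-sym ([]-true Q? (f p))
  []-cong (no ¬p) Q? f g = ≈-sym ([]-false Q? (¬p ∘ g))

  []-× : {P Q : Set} (P? : Dec P) (Q? : Dec Q) → [ P? ×-dec Q? ] ≈ [ P? ] * [ Q? ]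
  []-× (yes _) (yes _) = ≈-sym (*-identityˡ 1#)
  []-× (yes _) (no _)  = ≈-sym (*-identityˡ 0#)
  []-× (no _)  Q?      = ≈-sym (zeroˡ [ Q? ])

  -- Opaque, like the expectations and `subsets` below: later arguments use only their algebraic
  -- laws, never the underlying folds.
  opaque

    ∑ : List A → (A → R) → R
    ∑ xs f = foldr _+_ 0# (map f xs)

  module _ {f g : A → R} where

    opaque
      unfolding ∑

      ∑-cong : ∀ xs → (∀ x → f x ≈ g x) → ∑ xs f ≈ ∑ xs g
      ∑-cong []       h = ≈-refl
      ∑-cong (x ∷ xs) h = +-cong (h x) (∑-cong xs h)

      ∑-cong-∈ : ∀ xs → (∀ {x} → x ∈ xs → f x ≈ g x) → ∑ xs f ≈ ∑ xs g
      ∑-cong-∈ []       h = ≈-refl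
      ∑-cong-∈ (x ∷ xs) h = +-cong (h (here ≡.refl)) (∑-cong-∈ xs (h ∘ there))

      ∑-mono-∈ : ∀ xs → (∀ {x} → x ∈ xs → f x ≤ g x) → ∑ xs f ≤ ∑ xs g
      ∑-mono-∈ []       h = ≤-refl
      ∑-mono-∈ (x ∷ xs) h = +-mono-≤ (h (here ≡.refl)) (∑-mono-∈ xs (h ∘ there))

      ∑-mono : ∀ xs → (∀ x → f x ≤ g x) → ∑ xs f ≤ ∑ xs g
      ∑-mono xs h = ∑-mono-∈ xs (λ {x} _ → h x)

      ∑-+ : ∀ xs → ∑ xs (λ x → f x + g x) ≈ ∑ xs f + ∑ xs g
      ∑-+ []       = ≈-sym (+-identityˡ 0#)
      ∑-+ (x ∷ xs) = ≈-trans (+-congˡ (∑-+ xs))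
        (solve 4 (λ a b c d → (a :+ b) :+ (c :+ d) := (a :+ c) :+ (b :+ d)) ≈-refl
          (f x) (g x) (∑ xs f) (∑ xs g))

  opaque
    unfolding ∑

    ∑-[] : (f : A → R) → ∑ [] f ≈ 0#
    ∑-[] f = ≈-refl

    ∑-∷ : ∀ {f : A → R} x xs → ∑ (x ∷ xs) f ≈ f x + ∑ xs f
    ∑-∷ x xs = ≈-refl

    ∑-zero : (xs : List A) → ∑ xs (λ _ → 0#) ≈ 0#
    ∑-zero []       = ≈-refl
    ∑-zero (x ∷ xs) = ≈-trans (+-identityˡ _) (∑-zero xs)

  module _ {f : A → R} where

    opaque
      unfolding ∑

      ∑-nonneg : ∀ xs → (∀ x → 0# ≤ f x) → 0# ≤ ∑ xs f
      ∑-nonneg xs h = ≤-trans (≤-reflexive (≈-sym (∑-zero xs))) (∑-mono xs h)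

      ∑-*ˡ : ∀ c xs → ∑ xs (λ x → c * f x) ≈ c * ∑ xs f
      ∑-*ˡ c []       = ≈-sym (zeroʳ c)
      ∑-*ˡ c (x ∷ xs) = ≈-trans (+-congˡ (∑-*ˡ c xs)) (≈-sym (distribˡ c (f x) (∑ xs f)))

      ∑-*ʳ : ∀ c xs → ∑ xs (λ x → f x * c) ≈ ∑ xs f * c
      ∑-*ʳ c xs = ≈-trans (∑-cong xs (λ x → *-comm (f x) c))
        (≈-trans (∑-*ˡ c xs) (*-comm c (∑ xs f)))

      ∑-++ : ∀ xs ys → ∑ (xs List.++ ys) f ≈ ∑ xs f + ∑ ys f
      ∑-++ []       ys = ≈-sym (+-identityˡ _)
      ∑-++ (x ∷ xs) ys = ≈-trans (+-congˡ (∑-++ xs ys)) (≈-sym (+-assoc _ _ _))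

      ∑-filter : {P : Pred A 0ℓ} (P? : Decidable P) → ∀ xs →
                 ∑ (filter P? xs) f ≈ ∑ xs (λ x → [ P? x ] * f x)
      ∑-filter P? [] = ≈-refl
      ∑-filter P? (x ∷ xs) with P? x
      ... | yes _ = +-cong (≈-sym (*-identityˡ _)) (∑-filter P? xs)
      ... | no _  = ≈-trans (∑-filter P? xs)
        (≈-trans (≈-sym (+-identityˡ _)) (+-cong (≈-sym (zeroˡ (f x))) ≈-refl))

      term≤∑ : ∀ {x} xs → (∀ x → 0# ≤ f x) → x ∈ xs → f x ≤ ∑ xs f
      term≤∑ (x ∷ xs) h (here ≡.refl) = x≤x+y (∑-nonneg xs h)
      term≤∑ (x ∷ xs) h (there x∈xs)  = ≤-trans (term≤∑ xs h x∈xs) (y≤x+y (h x))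

  opaque
    unfolding ∑

    ∑-map : (f : B → R) (t : A → B) → ∀ xs → ∑ (map t xs) f ≈ ∑ xs (f ∘ t)
    ∑-map f t []       = ≈-refl
    ∑-map f t (x ∷ xs) = +-congˡ (∑-map f t xs)

    ∑-concatMap : (f : B → R) (t : A → List B) → ∀ xs →
                  ∑ (concatMap t xs) f ≈ ∑ xs (λ x → ∑ (t x) f)
    ∑-concatMap f t []       = ≈-refl
    ∑-concatMap f t (x ∷ xs) =
      ≈-trans (∑-++ (t x) _) (+-congˡ (∑-concatMap f t xs))

    ∑-swap : (f : A → B → R) → ∀ xs ys →
             ∑ xs (λ x → ∑ ys (f x)) ≈ ∑ ys (λ y → ∑ xs (λ x → f x y))
    ∑-swap f []       ys = ≈-sym (∑-zero ys)
    ∑-swap f (x ∷ xs) ys = ≈-trans (+-congˡ (∑-swap f xs ys)) (≈-sym (∑-+ ys))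

    ∑-product : {C : Set} (f : C → R) (t : A → B → C) → ∀ xs ys →
                ∑ (cartesianProductWith t xs ys) f ≈ ∑ xs (λ x → ∑ ys (λ y → f (t x y)))
    ∑-product f t []       ys = ≈-refl
    ∑-product f t (x ∷ xs) ys = ≈-trans (∑-++ (map (t x) ys) _)
      (+-cong (∑-map f (t x) ys) (∑-product f t xs ys))

    ∑-const : ∀ (xs : List A) c → ∑ xs (λ _ → c) ≈ (length xs · 1#) * c
    ∑-const []       c = ≈-sym (zeroˡ c)
    ∑-const (x ∷ xs) c = ≈-trans (+-cong (≈-sym (*-identityˡ c)) (∑-const xs c))
      (≈-sym (distribʳ c 1# _))

  opaque
    unfolding ∑

    𝔼 : List A → (A → R) → (A → R) → R
    𝔼 xs w f = ∑ xs (λ x → w x * f x)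

  module _ (xs : List A) (w : A → R) where

    opaque
      unfolding ∑ 𝔼

      𝔼-cong : ∀ {f g} → (∀ x → f x ≈ g x) → 𝔼 xs w f ≈ 𝔼 xs w g
      𝔼-cong h = ∑-cong xs (λ x → *-congˡ (h x))

      𝔼-+ : ∀ f g → 𝔼 xs w (λ x → f x + g x) ≈ 𝔼 xs w f + 𝔼 xs w g
      𝔼-+ f g = ≈-trans (∑-cong xs (λ x → distribˡ (w x) (f x) (g x))) (∑-+ xs)

      𝔼-*ˡ : ∀ c f → 𝔼 xs w (λ x → c * f x) ≈ c * 𝔼 xs w f
      𝔼-*ˡ c f = ≈-trans
        (∑-cong xs (λ x → solve 3 (λ a b c → a :* (b :* c) := b :* (a :* c)) ≈-refl (w x) c (f x)))
        (∑-*ˡ c xs)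

      𝔼-const : ∀ c → 𝔼 xs w (λ _ → c) ≈ ∑ xs w * c
      𝔼-const c = ∑-*ʳ c xs

      𝔼-∑ : (f : A → B → R) → ∀ ys → 𝔼 xs w (λ x → ∑ ys (f x)) ≈ ∑ ys (λ y → 𝔼 xs w (λ x → f x y))
      𝔼-∑ f ys = ≈-trans (∑-cong xs (λ x → ≈-sym (∑-*ˡ (w x) ys)))
        (∑-swap (λ x y → w x * f x y) xs ys)

      𝔼-mono : (∀ x → 0# ≤ w x) → ∀ {f g} → (∀ x → f x ≤ g x) → 𝔼 xs w f ≤ 𝔼 xs w g
      𝔼-mono w≥0 h = ∑-mono xs (λ x → *-monoˡ-≤ (w≥0 x) (h x))

  opaque
    unfolding ∑ 𝔼

    𝔼-uniform : ∀ (xs : List A) u f → 𝔼 xs (λ _ → u) f ≈ u * ∑ xs f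
    𝔼-uniform xs u f = ∑-*ˡ u xs

  ∏ : (A → R) → ∀ {m} → Vec A m → R
  ∏ w v = Vec.foldr′ _*_ 1# (Vec.map w v)

  ∏-nonneg : {w : A → R} → (∀ x → 0# ≤ w x) → ∀ {m} (v : Vec A m) → 0# ≤ ∏ w v
  ∏-nonneg w≥0 []      = 0≤1
  ∏-nonneg w≥0 (x ∷ v) = *-nonneg (w≥0 x) (∏-nonneg w≥0 v)

  ∏-cong : {w w′ : A → R} → (∀ x → w x ≈ w′ x) → ∀ {m} (v : Vec A m) → ∏ w v ≈ ∏ w′ v
  ∏-cong h []      = ≈-refl
  ∏-cong h (x ∷ v) = *-cong (h x) (∏-cong h v)

  opaque
    unfolding ∑ 𝔼

    𝔼ⁿ : List A → (A → R) → ∀ m → (Vec A m → R) → R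
    𝔼ⁿ xs w m = 𝔼 (vectors xs m) (∏ w)

  module _ (xs : List A) (w : A → R) where

    opaque
      unfolding ∑ 𝔼 𝔼ⁿ

      𝔼ⁿ-zero : ∀ f → 𝔼ⁿ xs w 0 f ≈ f []
      𝔼ⁿ-zero f = ≈-trans (+-identityʳ _) (*-identityˡ _)

      𝔼ⁿ-suc : ∀ m f → 𝔼ⁿ xs w (suc m) f ≈ 𝔼 xs w (λ a → 𝔼ⁿ xs w m (λ v → f (a ∷ v)))
      𝔼ⁿ-suc m f = ≈-trans (∑-product (λ v → ∏ w v * f v) _∷_ xs (vectors xs m))
        (∑-cong xs (λ a → ≈-trans
          (∑-cong (vectors xs m) (λ v → *-assoc (w a) (∏ w v) (f (a ∷ v))))
          (∑-*ˡ (w a) (vectors xs m))))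

      ∏-total : ∑ xs w ≈ 1# → ∀ m → ∑ (vectors xs m) (∏ w) ≈ 1#
      ∏-total total zero    = +-identityʳ 1#
      ∏-total total (suc m) = ≈-trans (∑-product (∏ w) _∷_ xs (vectors xs m))
        (≈-trans (∑-cong xs (λ a → ≈-trans (∑-*ˡ (w a) (vectors xs m))
          (≈-trans (*-congˡ (∏-total total m)) (*-identityʳ (w a))))) total)

      𝔼ⁿ-const : ∑ xs w ≈ 1# → ∀ m c → 𝔼ⁿ xs w m (λ _ → c) ≈ c
      𝔼ⁿ-const total m c = ≈-trans (𝔼-const (vectors xs m) (∏ w) c)
        (≈-trans (*-cong (∏-total total m) ≈-refl) (*-identityˡ c))

      𝔼ⁿ-++ : ∀ k m f → 𝔼ⁿ xs w (k ℕ.+ m) f ≈ 𝔼ⁿ xs w k (λ u → 𝔼ⁿ xs w m (λ v → f (u ++ v)))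
      𝔼ⁿ-++ zero    m f = ≈-sym (𝔼ⁿ-zero (λ u → 𝔼ⁿ xs w m (λ v → f (u ++ v))))
      𝔼ⁿ-++ (suc k) m f = ≈-trans (𝔼ⁿ-suc (k ℕ.+ m) f)
        (≈-trans (𝔼-cong xs w (λ a → 𝔼ⁿ-++ k m (f ∘ (a ∷_)))) (≈-sym (𝔼ⁿ-suc k _)))

  module _ (xs : List A) (w : A → R) (w≥0 : ∀ x → 0# ≤ w x) {m} {f g : Vec A m → R} where

    opaque
      unfolding ∑ 𝔼 𝔼ⁿ

      𝔼ⁿ-mono : (∀ v → f v ≤ g v) → 𝔼ⁿ xs w m f ≤ 𝔼ⁿ xs w m g
      𝔼ⁿ-mono = 𝔼-mono (vectors xs m) (∏ w) (∏-nonneg w≥0)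

  opaque
    unfolding ∑ 𝔼 𝔼ⁿ

    𝔼ⁿ-cong : ∀ (xs : List A) w {m} {f g : Vec A m → R} → (∀ v → f v ≈ g v) → 𝔼ⁿ xs w m f ≈ 𝔼ⁿ xs w m g
    𝔼ⁿ-cong xs w {m} = 𝔼-cong (vectors xs m) (∏ w)

    𝔼ⁿ-+ : ∀ (xs : List A) w {m} {f g : Vec A m → R} →
           𝔼ⁿ xs w m (λ v → f v + g v) ≈ 𝔼ⁿ xs w m f + 𝔼ⁿ xs w m g
    𝔼ⁿ-+ xs w {m} = 𝔼-+ (vectors xs m) (∏ w) _ _

    𝔼ⁿ-*ˡ : ∀ (xs : List A) w {m c} {f : Vec A m → R} →
            𝔼ⁿ xs w m (λ v → c * f v) ≈ c * 𝔼ⁿ xs w m f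
    𝔼ⁿ-*ˡ xs w {m} = 𝔼-*ˡ (vectors xs m) (∏ w) _ _

  sides : List Side
  sides = inside ∷ outside ∷ []

  -- The mass of `outside` is a separate parameter because `1 - p` cannot be formed in a semiring;
  -- `IsBernoulli` ties the two together.
  bernoulli : R → R → Side → R
  bernoulli p p̄ inside  = p
  bernoulli p p̄ outside = p̄

  opaque

    subsets : ∀ n → List (Subset n)
    subsets = vectors sides

    𝔼ₚ : R → R → ∀ {n} → (Subset n → R) → R
    𝔼ₚ p p̄ {n} = 𝔼ⁿ sides (bernoulli p p̄) n

  opaque
    unfolding ∑ 𝔼 𝔼ⁿ 𝔼ₚ subsets

    ∑-subsets-zero : ∀ f → ∑ (subsets 0) f ≈ f []
    ∑-subsets-zero f = +-identityʳ (f [])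

    ∑-subsets : ∀ n f → ∑ (subsets (suc n)) f ≈
                ∑ (subsets n) (f ∘ (inside ∷_)) + ∑ (subsets n) (f ∘ (outside ∷_))
    ∑-subsets n f = ≈-trans (∑-product f _∷_ sides (subsets n))
      (+-congˡ (+-identityʳ _))

    ∈-subsets : ∀ {n} (S : Subset n) → S ∈ subsets n
    ∈-subsets = ∈-vectors λ { inside → here ≡.refl ; outside → there (here ≡.refl) }

  module _ {p p̄ : R} {n : ℕ} where

    opaque
      unfolding ∑ 𝔼 𝔼ⁿ 𝔼ₚ subsets

      𝔼ₚ-cong : {f g : Subset n → R} → (∀ S → f S ≈ g S) → 𝔼ₚ p p̄ f ≈ 𝔼ₚ p p̄ g
      𝔼ₚ-cong = 𝔼ⁿ-cong sides _

      𝔼ₚ-+ : {f g : Subset n → R} → 𝔼ₚ p p̄ (λ S → f S + g S) ≈ 𝔼ₚ p p̄ f + 𝔼ₚ p p̄ g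
      𝔼ₚ-+ = 𝔼-+ (subsets n) _ _ _

      𝔼ₚ-*ˡ : ∀ {c} {f : Subset n → R} → 𝔼ₚ p p̄ (λ S → c * f S) ≈ c * 𝔼ₚ p p̄ f
      𝔼ₚ-*ˡ = 𝔼-*ˡ (subsets n) _ _ _

      𝔼ₚ-∑ : ∀ {f : Subset n → A → R} (ys : List A) →
             𝔼ₚ p p̄ (λ S → ∑ ys (f S)) ≈ ∑ ys (λ y → 𝔼ₚ p p̄ (λ S → f S y))
      𝔼ₚ-∑ ys = 𝔼-∑ (subsets n) _ _ ys

  opaque
    unfolding ∑ 𝔼 𝔼ⁿ 𝔼ₚ subsets

    𝔼ₚ-zero : ∀ {p p̄} (f : Subset 0 → R) → 𝔼ₚ p p̄ f ≈ f []
    𝔼ₚ-zero {p} {p̄} f = 𝔼ⁿ-zero sides (bernoulli p p̄) f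

    𝔼ₚ-suc : ∀ {p p̄ n} (f : Subset (suc n) → R) →
             𝔼ₚ p p̄ f ≈ p * 𝔼ₚ p p̄ (f ∘ (inside ∷_)) + p̄ * 𝔼ₚ p p̄ (f ∘ (outside ∷_))
    𝔼ₚ-suc {p} {p̄} {n} f = ≈-trans (𝔼ⁿ-suc sides (bernoulli p p̄) n f)
      (+-congˡ (+-identityʳ _))

    𝔼ₚ-++ : ∀ {p p̄} k m (f : Subset (k ℕ.+ m) → R) →
            𝔼ₚ p p̄ f ≈ 𝔼ₚ p p̄ {k} (λ S → 𝔼ₚ p p̄ {m} (λ T → f (S ++ T)))
    𝔼ₚ-++ {p} {p̄} = 𝔼ⁿ-++ sides (bernoulli p p̄)

  record IsBernoulli (p p̄ : R) : Set where
    constructor bern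
    field
      p≥0   : 0# ≤ p
      p̄≥0   : 0# ≤ p̄
      total : p + p̄ ≈ 1#

    mass≥0 : ∀ s → 0# ≤ bernoulli p p̄ s
    mass≥0 inside  = p≥0
    mass≥0 outside = p̄≥0

    p≤1 : p ≤ 1#
    p≤1 = ≤-trans (x≤x+y p̄≥0) (≤-reflexive total)

    p̄≤1 : p̄ ≤ 1#
    p̄≤1 = ≤-trans (y≤x+y p≥0) (≤-reflexive total)

    opaque
      unfolding ∑ 𝔼 𝔼ⁿ 𝔼ₚ

      ∑≈1 : ∑ sides (bernoulli p p̄) ≈ 1#
      ∑≈1 = ≈-trans (+-congˡ (+-identityʳ p̄)) total

      𝔼ₚ-mono : ∀ {n} {f g : Subset n → R} → (∀ S → f S ≤ g S) → 𝔼ₚ p p̄ f ≤ 𝔼ₚ p p̄ g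
      𝔼ₚ-mono = 𝔼ⁿ-mono sides _ mass≥0

      𝔼ₚ-const : ∀ {n} c → 𝔼ₚ p p̄ {n} (λ _ → c) ≈ c
      𝔼ₚ-const {n} = 𝔼ⁿ-const sides _ ∑≈1 n

    𝔼ₚ-nonneg : ∀ {n} {f : Subset n → R} → (∀ S → 0# ≤ f S) → 0# ≤ 𝔼ₚ p p̄ f
    𝔼ₚ-nonneg h = ≤-trans (≤-reflexive (≈-sym (𝔼ₚ-const 0#))) (𝔼ₚ-mono h)

x∈p─q⇒x∉q : ∀ (p q : Subset k) {x} → x ∈ˢ p ─ q → x ∉ˢ q
x∈p─q⇒x∉q (_ ∷ p) (inside  ∷ q) {zero}  ()
x∈p─q⇒x∉q (_ ∷ p) (outside ∷ q) {zero}  _ ()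
x∈p─q⇒x∉q (_ ∷ p) (_ ∷ q) {suc x} (Vec.there h) (Vec.there h′) = x∈p─q⇒x∉q p q h h′

-- Minimum fragments

in⊈out : ∀ {p q : Subset k} → ¬ (inside ∷ p ⊆ outside ∷ q)
in⊈out h = case h Vec.here of λ ()

p⊆q∪[p─q] : ∀ (p q : Subset k) → p ⊆ q ∪ (p ─ q)
p⊆q∪[p─q] p q {x} x∈p with x ∈? q
... | yes x∈q = x∈p∪q⁺ (inj₁ x∈q)
... | no  x∉q = x∈p∪q⁺ {p = q} (inj₂ (x∈p∧x∉q⇒x∈p─q x∈p x∉q))

∪-lub : ∀ {p q r : Subset k} → p ⊆ r → q ⊆ r → p ∪ q ⊆ r
∪-lub {p = p} {q} p⊆r q⊆r x∈ with x∈p∪q⁻ p q x∈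
... | inj₁ x∈p = p⊆r x∈p
... | inj₂ x∈q = q⊆r x∈q

⊆∧∣∣≤⇒⊇ : ∀ {p q : Subset k} → p ⊆ q → ∣ q ∣ ℕ.≤ ∣ p ∣ → q ⊆ p
⊆∧∣∣≤⇒⊇ {p = p} {q} p⊆q ∣q∣≤∣p∣ {x} x∈q with x ∈? p
... | yes x∈p = x∈p
... | no  x∉p = contradiction (p⊂q⇒∣p∣<∣q∣ (p⊆q , x , x∈q , x∉p)) (ℕ.≤⇒≯ ∣q∣≤∣p∣)

∣p∣≡0⇒p⊆q : ∀ {p q : Subset k} → ∣ p ∣ ≡ 0 → p ⊆ q
∣p∣≡0⇒p⊆q {p = outside ∷ p} {_ ∷ q} eq (Vec.there x∈p) = Vec.there (∣p∣≡0⇒p⊆q eq x∈p)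

module Fragments {J : Set} {n : ℕ} (e : J → Subset n) (js : List J) where

  Covered : Subset n → Set
  Covered W = Any (λ j → e j ⊆ W) js

  covered? : ∀ W → Dec (Covered W)
  covered? W = any? (λ j → e j ⊆? W) js

  module _ (W : Subset n) where

    candidates : J → List J
    candidates j = filter (λ c → e c ⊆? e j ∪ W) js

    -- The default value `j` is itself admissible, as `e j ⊆ e j ∪ W`; no argument for the existence
    -- of a candidate is needed.
    best : J → J
    best j = Extrema.argmin (λ c → ∣ e c ─ W ∣) j (candidates j)

    fragment : J → Subset n
    fragment j = e (best j) ─ W

    best-spec : ∀ {j} → j ∈ js → best j ∈ js × e (best j) ⊆ e j ∪ W
    best-spec {j} j∈js = Extrema.argmin-all (λ c → ∣ e c ─ W ∣)
      {P = λ c → c ∈ js × e c ⊆ e j ∪ W} (j∈js , p⊆p∪q W)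
      (All.tabulate (∈-filter⁻ (λ c → e c ⊆? e j ∪ W)))

    fragment⊆ : ∀ {j} → j ∈ js → fragment j ⊆ e j
    fragment⊆ {j} j∈js {x} x∈ with x∈p∪q⁻ (e j) W (proj₂ (best-spec j∈js) (p─q⊆p _ W x∈))
    ... | inj₁ x∈e = x∈e
    ... | inj₂ x∈W = contradiction x∈W (x∈p─q⇒x∉q (e (best j)) W x∈)

    fragment-minimal : ∀ {j d} → d ∈ js → e d ⊆ e j ∪ W → ∣ fragment j ∣ ℕ.≤ ∣ e d ─ W ∣
    fragment-minimal {j} d∈js d⊆ =
      All.lookup (Extrema.f[argmin]≤f[xs] {f = λ c → ∣ e c ─ W ∣} j (candidates j))
        (∈-filter⁺ (λ c → e c ⊆? e j ∪ W) d∈js d⊆)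

    -- The reason one may continue with fragments: once W′ captures the fragment, W ∪ W′ contains
    -- the whole of `e (best j)`, though perhaps not `e j`.
    covered-by-fragment : ∀ {j W′} → j ∈ js → fragment j ⊆ W′ → Covered (W ∪ W′)
    covered-by-fragment {j} {W′} j∈js f⊆W′ = lose (proj₁ (best-spec j∈js))
      (⊆-trans (p⊆q∪[p─q] (e (best j)) W)
        (∪-lub {p = W} (p⊆p∪q W′) (⊆-trans f⊆W′ (q⊆p∪q W W′))))

    fragment-empty : ∀ {j} → j ∈ js → ∣ fragment j ∣ ≡ 0 → Covered W
    fragment-empty {j} j∈js eq = lose (proj₁ (best-spec j∈js))
      (⊆-trans (p⊆q∪[p─q] (e (best j)) W) (∪-lub {p = W} ⊆-refl (∣p∣≡0⇒p⊆q eq)))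

  IsFragment : Subset n → Subset n → Set
  IsFragment W T = Any (λ j → fragment W j ≡ T) js

  module _ {Z T : Subset n} (T⊆Z : T ⊆ Z) (frag : IsFragment (Z ─ T) T) where

    private
      W = Z ─ T
      j = proj₁ (find frag)
      j∈js = proj₁ (proj₂ (find frag))
      eq : fragment W j ≡ T
      eq = proj₂ (proj₂ (find frag))
      spec = best-spec W j∈js

      best⊆Z : e (best W j) ⊆ Z
      best⊆Z = ⊆-trans (p⊆q∪[p─q] (e (best W j)) W)
        (∪-lub {p = W} (p─q⊆p Z T) (subst (_⊆ Z) (sym eq) T⊆Z))

      T⊆e : T ⊆ e j
      T⊆e = subst (_⊆ e j) eq (fragment⊆ W j∈js)

    -- The member that produced T lies in W ∪ T = Z. This supplies the single member to which
    -- `fragment⊆member` is later applied.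
    fragment⇒covered : Covered Z
    fragment⇒covered = lose (proj₁ spec) best⊆Z

    -- By minimality a member inside Z = W ∪ T cannot avoid any point of T: this is what makes
    -- T recoverable from Z at the price of a choice of a subset of a single member.
    fragment⊆member : ∀ {d} → d ∈ js → e d ⊆ Z → T ⊆ e d
    fragment⊆member {d} d∈js d⊆Z = ⊆-trans
      (⊆∧∣∣≤⇒⊇ d─W⊆T (subst (λ t → ∣ t ∣ ℕ.≤ ∣ e d ─ W ∣) eq (fragment-minimal W d∈js d⊆e∪W)))
      (p─q⊆p (e d) W)
      where
      Z⊆W∪T : Z ⊆ T ∪ W
      Z⊆W∪T = p⊆q∪[p─q] Z T
      -- As T lies in `e j`, every member inside Z competes in the minimisation for `j`, whose
      -- minimum is T.
      d⊆e∪W : e d ⊆ e j ∪ W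
      d⊆e∪W x∈d with x∈p∪q⁻ T W (Z⊆W∪T (d⊆Z x∈d))
      ... | inj₁ x∈T = x∈p∪q⁺ (inj₁ (T⊆e x∈T))
      ... | inj₂ x∈W = x∈p∪q⁺ {p = e j} (inj₂ x∈W)
      d─W⊆T : e d ─ W ⊆ T
      d─W⊆T x∈ with x∈p∪q⁻ T W (Z⊆W∪T (d⊆Z (p─q⊆p (e d) W x∈)))
      ... | inj₁ x∈T = x∈T
      ... | inj₂ x∈W = contradiction x∈W (x∈p─q⇒x∉q (e d) W x∈)

  fragment-disjoint : ∀ {W T} → IsFragment W T → ∀ {x} → x ∈ˢ T → x ∉ˢ W
  fragment-disjoint {W} frag {x} x∈T with find frag
  ... | j , _ , refl = x∈p─q⇒x∉q (e (best W j)) W x∈T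

-- Exposing a random set

module Percolation (K : OrderedSemiring) where

  open FiniteSums K

  []*≤-if : {P : Set} (P? : Dec P) {x y : R} → 0# ≤ y → (P → x ≤ y) → [ P? ] * x ≤ y
  []*≤-if (yes p) y≥0 h = ≤-trans (≤-reflexive (*-identityˡ _)) (h p)
  []*≤-if (no _)  y≥0 h = ≤-trans (≤-reflexive (zeroˡ _)) y≥0

  module _ {n} (S T : Subset n) where

    in⊆in-[] : [ inside ∷ S ⊆? inside ∷ T ] ≈ [ S ⊆? T ]
    in⊆in-[] = []-cong (inside ∷ S ⊆? inside ∷ T) (S ⊆? T) drop-∷-⊆ s⊆s

    in⊆out-[] : [ inside ∷ S ⊆? outside ∷ T ] ≈ 0#
    in⊆out-[] = []-false (inside ∷ S ⊆? outside ∷ T) in⊈out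

    out⊆-[] : ∀ s → [ outside ∷ S ⊆? s ∷ T ] ≈ [ S ⊆? T ]
    out⊆-[] s = []-cong (outside ∷ S ⊆? s ∷ T) (S ⊆? T) drop-∷-⊆ out⊆

  ∑-⊆ : ∀ {n} (S : Subset n) → ∑ (subsets n) (λ T → [ T ⊆? S ]) ≈ (2 ℕ.^ ∣ S ∣) · 1#
  ∑-⊆ [] = ≈-trans (∑-subsets-zero _) (≈-sym (+-identityʳ 1#))
  ∑-⊆ {suc n} (inside ∷ S) = begin-equality
    ∑ (subsets (suc n)) (λ T → [ T ⊆? inside ∷ S ])
      ≈⟨ ∑-subsets n (λ T → [ T ⊆? inside ∷ S ]) ⟩
    ∑ (subsets n) (λ T → [ inside ∷ T ⊆? inside ∷ S ]) + ∑ (subsets n) (λ T → [ outside ∷ T ⊆? inside ∷ S ])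
      ≈⟨ +-cong (∑-cong (subsets n) (λ T → in⊆in-[] T S))
                (∑-cong (subsets n) (λ T → out⊆-[] T S inside)) ⟩
    ∑ (subsets n) (λ T → [ T ⊆? S ]) + ∑ (subsets n) (λ T → [ T ⊆? S ])
      ≈⟨ +-cong (∑-⊆ S) (≈-trans (∑-⊆ S) (≈-sym (+-identityʳ _))) ⟩
    (2 ℕ.^ ∣ S ∣) · 1# + ((2 ℕ.^ ∣ S ∣) · 1# + 0#)
      ≈⟨ +-congˡ (×-homo-+ 1# (2 ℕ.^ ∣ S ∣) 0) ⟨
    (2 ℕ.^ ∣ S ∣) · 1# + (2 ℕ.^ ∣ S ∣ ℕ.+ 0) · 1#
      ≈⟨ ×-homo-+ 1# (2 ℕ.^ ∣ S ∣) (2 ℕ.^ ∣ S ∣ ℕ.+ 0) ⟨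
    (2 ℕ.^ suc ∣ S ∣) · 1# ∎
  ∑-⊆ {suc n} (outside ∷ S) = begin-equality
    ∑ (subsets (suc n)) (λ T → [ T ⊆? outside ∷ S ])
      ≈⟨ ∑-subsets n (λ T → [ T ⊆? outside ∷ S ]) ⟩
    ∑ (subsets n) (λ T → [ inside ∷ T ⊆? outside ∷ S ]) + ∑ (subsets n) (λ T → [ outside ∷ T ⊆? outside ∷ S ])
      ≈⟨ +-cong (∑-cong (subsets n) (λ T → in⊆out-[] T S))
                (∑-cong (subsets n) (λ T → out⊆-[] T S outside)) ⟩
    ∑ (subsets n) (λ T → 0#) + ∑ (subsets n) (λ T → [ T ⊆? S ])
      ≈⟨ +-cong (∑-zero (subsets n)) (∑-⊆ S) ⟩
    0# + (2 ℕ.^ ∣ S ∣) · 1#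
      ≈⟨ +-identityˡ _ ⟩
    (2 ℕ.^ ∣ S ∣) · 1# ∎

  module _ {p p̄ q θ : R} (bernoulli-p : IsBernoulli p p̄) (q≥0 : 0# ≤ q) (θ≥0 : 0# ≤ θ)
           (q≤θp : q ≤ θ * p) where

    open IsBernoulli bernoulli-p

    -- The change of variables Z = W ∪ T, one coordinate at a time. A point of T contributes
    -- `q * p̄ ≤ q ≤ θ * p`, the price of missing it in W against that of hitting it in Z; off T
    -- both sides agree.
    shift : ∀ {n} (T : Subset n) (f : Subset n → R) → (∀ W → 0# ≤ f W) →
            q ^ ∣ T ∣ * 𝔼ₚ p p̄ (λ W → [ T ⊆? ∁ W ] * f W) ≤
            θ ^ ∣ T ∣ * 𝔼ₚ p p̄ (λ Z → [ T ⊆? Z ] * f (Z ─ T))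
    shift [] f f≥0 = *-monoˡ-≤ 0≤1 (≤-reflexive (≈-trans (𝔼ₚ-zero _) (≈-sym (𝔼ₚ-zero _))))
    shift (inside ∷ T) f f≥0 = begin
      q * q ^ t * 𝔼ₚ p p̄ (λ W → [ inside ∷ T ⊆? ∁ W ] * f W)
        ≈⟨ *-congˡ (≈-trans (𝔼ₚ-suc _) (+-cong (*-congˡ (≈-trans
             (𝔼ₚ-cong (λ W → ≈-trans (*-cong (in⊆out-[] T (∁ W)) ≈-refl) (zeroˡ _)))
             (𝔼ₚ-const 0#)))
             (*-congˡ (𝔼ₚ-cong (λ W → *-cong
               (in⊆in-[] T (∁ W)) ≈-refl))))) ⟩
      q * q ^ t * (p * 0# + p̄ * X)
        ≈⟨ solve 5 (λ q qt p p̄ X → q :* qt :* (p :* con 0 :+ p̄ :* X) := p̄ :* (q :* (qt :* X))) ≈-refl q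
          (q ^ t) p p̄ X ⟩
      p̄ * (q * (q ^ t * X))
        ≤⟨ *-monoʳ-≤ (*-nonneg q≥0 (*-nonneg (^-nonneg q≥0 t) X≥0)) p̄≤1 ⟩
      1# * (q * (q ^ t * X))
        ≈⟨ *-identityˡ _ ⟩
      q * (q ^ t * X)
        ≤⟨ *-mono-≤ (*-nonneg (^-nonneg q≥0 t) X≥0) (*-nonneg θ≥0 p≥0) q≤θp
             (shift T (f ∘ (outside ∷_)) (f≥0 ∘ (outside ∷_))) ⟩
      θ * p * (θ ^ t * Y)
        ≈⟨ solve 5 (λ θ θt p p̄ Y → θ :* p :* (θt :* Y) := θ :* θt :* (p :* Y :+ p̄ :* con 0)) ≈-refl θ (θ ^ t) p p̄ Y ⟩
      θ * θ ^ t * (p * Y + p̄ * 0#)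
        ≈⟨ *-congˡ (≈-trans (𝔼ₚ-suc _) (+-cong
             (*-congˡ (𝔼ₚ-cong (λ W → *-cong
               (in⊆in-[] T W) ≈-refl)))
             (*-congˡ (≈-trans
             (𝔼ₚ-cong (λ W → ≈-trans (*-cong (in⊆out-[] T W) ≈-refl) (zeroˡ _)))
             (𝔼ₚ-const 0#))))) ⟨
      θ * θ ^ t * 𝔼ₚ p p̄ (λ Z → [ inside ∷ T ⊆? Z ] * f (Z ─ (inside ∷ T))) ∎
      where
      t = ∣ T ∣
      X = 𝔼ₚ p p̄ (λ W → [ T ⊆? ∁ W ] * f (outside ∷ W))
      Y = 𝔼ₚ p p̄ (λ Z → [ T ⊆? Z ] * f (outside ∷ (Z ─ T)))
      X≥0 : 0# ≤ X
      X≥0 = 𝔼ₚ-nonneg (λ W → []*-nonneg (T ⊆? ∁ W) (f≥0 (outside ∷ W)))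
    shift (outside ∷ T) f f≥0 = begin
      q ^ t * 𝔼ₚ p p̄ (λ W → [ outside ∷ T ⊆? ∁ W ] * f W)
        ≈⟨ *-congˡ (≈-trans (𝔼ₚ-suc _) (+-cong
             (*-congˡ (𝔼ₚ-cong (λ W → *-cong
               (out⊆-[] T (∁ W) outside) ≈-refl)))
             (*-congˡ (𝔼ₚ-cong (λ W → *-cong
               (out⊆-[] T (∁ W) inside) ≈-refl))))) ⟩
      q ^ t * (p * X inside + p̄ * X outside)
        ≈⟨ solve 5 (λ qt p p̄ X X′ → qt :* (p :* X :+ p̄ :* X′) := p :* (qt :* X) :+ p̄ :* (qt :* X′)) ≈-refl
          (q ^ t) p p̄ (X inside) (X outside) ⟩
      p * (q ^ t * X inside) + p̄ * (q ^ t * X outside)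
        ≤⟨ +-mono-≤ (*-monoˡ-≤ p≥0 (shift T (f ∘ (inside ∷_)) (f≥0 ∘ (inside ∷_))))
                    (*-monoˡ-≤ p̄≥0 (shift T (f ∘ (outside ∷_)) (f≥0 ∘ (outside ∷_)))) ⟩
      p * (θ ^ t * Y inside) + p̄ * (θ ^ t * Y outside)
        ≈⟨ solve 5 (λ qt p p̄ X X′ → qt :* (p :* X :+ p̄ :* X′) := p :* (qt :* X) :+ p̄ :* (qt :* X′)) ≈-refl
          (θ ^ t) p p̄ (Y inside) (Y outside) ⟨
      θ ^ t * (p * Y inside + p̄ * Y outside)
        ≈⟨ *-congˡ (≈-trans (𝔼ₚ-suc _) (+-cong
             (*-congˡ (𝔼ₚ-cong (λ W → *-cong
               (out⊆-[] T W inside) ≈-refl)))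
             (*-congˡ (𝔼ₚ-cong (λ W → *-cong
               (out⊆-[] T W outside) ≈-refl))))) ⟨
      θ ^ t * 𝔼ₚ p p̄ (λ Z → [ outside ∷ T ⊆? Z ] * f (Z ─ (outside ∷ T))) ∎
      where
      t = ∣ T ∣
      X = λ s → 𝔼ₚ p p̄ (λ W → [ T ⊆? ∁ W ] * f (s ∷ W))
      Y = λ s → 𝔼ₚ p p̄ (λ Z → [ T ⊆? Z ] * f (s ∷ (Z ─ T)))

  module _ {p r r̄ : R} (p≥0 : 0# ≤ p) (r≥0 : 0# ≤ r) (r̄≥0 : 0# ≤ r̄) (total : p + (r + r̄) ≈ 1#) where

    private
      x*t≈x : ∀ {x} → x * (p + (r + r̄)) ≈ x
      x*t≈x = ≈-trans (*-congˡ total) (*-identityʳ _)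

      p-bernoulli : IsBernoulli p (r + r̄)
      p-bernoulli = bern p≥0 (+-nonneg r≥0 r̄≥0) total

      r-bernoulli : IsBernoulli r (p + r̄)
      r-bernoulli = bern r≥0 (+-nonneg p≥0 r̄≥0)
        (≈-trans (solve 3 (λ p r r̄ → r :+ (p :+ r̄) := p :+ (r :+ r̄)) ≈-refl p r r̄) total)

      exposed : ∀ {n} → (Subset n → R) → R
      exposed f = 𝔼ₚ p (r + r̄) (λ W → 𝔼ₚ r (p + r̄) (λ W′ → f (W ∪ W′)))

      exposed-suc : ∀ {n} (f : Subset (suc n) → R) →
        let a = exposed (f ∘ (inside ∷_)) ; b = exposed (f ∘ (outside ∷_)) in
        exposed f ≈ p * (r * a + (p + r̄) * a) + (r + r̄) * (r * a + (p + r̄) * b)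
      exposed-suc f = ≈-trans (𝔼ₚ-suc _)
        (+-cong (*-congˡ (expand inside)) (*-congˡ (expand outside)))
        where
        E = λ s → 𝔼ₚ p (r + r̄) (λ W → 𝔼ₚ r (p + r̄) (λ W′ → f (s ∷ (W ∪ W′))))
        expand : ∀ s → 𝔼ₚ p (r + r̄) (λ W → 𝔼ₚ r (p + r̄) (λ W′ → f ((s ∷ W) ∪ W′)))
                 ≈ r * E (s ∨ inside) + (p + r̄) * E (s ∨ outside)
        expand s = ≈-trans (𝔼ₚ-cong (λ W → 𝔼ₚ-suc _))
          (≈-trans (𝔼ₚ-+) (+-cong (𝔼ₚ-*ˡ) (𝔼ₚ-*ˡ)))

      exposed-mono : ∀ {n} {f g : Subset n → R} → (∀ S → f S ≤ g S) → exposed f ≤ exposed g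
      exposed-mono h = IsBernoulli.𝔼ₚ-mono p-bernoulli
        (λ W → IsBernoulli.𝔼ₚ-mono r-bernoulli (λ W′ → h (W ∪ W′)))

    -- The union of independent sets of densities p and r has density p + r - pr, at most p + r, and
    -- f is antitone. Stating it with p + r keeps the densities of successive rounds additive.
    two-exposures : ∀ {n} (f : Subset n → R) → (∀ {S T} → S ⊆ T → f T ≤ f S) →
                    𝔼ₚ (p + r) r̄ f ≤ 𝔼ₚ p (r + r̄) (λ W → 𝔼ₚ r (p + r̄) (λ W′ → f (W ∪ W′)))
    two-exposures {zero} f anti = ≤-reflexive (≈-trans (𝔼ₚ-zero f)
      (≈-sym (≈-trans (𝔼ₚ-zero _) (𝔼ₚ-zero _))))
    two-exposures {suc n} f anti = begin
      𝔼ₚ (p + r) r̄ f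
        ≈⟨ 𝔼ₚ-suc f ⟩
      (p + r) * 𝔼ₚ (p + r) r̄ (f ∘ (inside ∷_)) + r̄ * 𝔼ₚ (p + r) r̄ (f ∘ (outside ∷_))
        ≤⟨ +-mono-≤ (*-monoˡ-≤ (+-nonneg p≥0 r≥0) (two-exposures (f ∘ (inside ∷_)) (anti ∘ s⊆s′)))
                    (*-monoˡ-≤ r̄≥0 (two-exposures (f ∘ (outside ∷_)) (anti ∘ s⊆s′))) ⟩
      (p + r) * a + r̄ * b
        -- Multiplying by `t ≈ 1` makes both sides quadratic. They then differ in one term `r * p`,
        -- the event that both exposures hit the point, which p + r counts twice: it carries `a` on
        -- one side and `b` on the other.
        ≈⟨ +-cong (*-cong (+-cong x*t≈x x*t≈x) ≈-refl) (*-cong x*t≈x ≈-refl) ⟨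
      (p * t + r * t) * a + r̄ * t * b
        ≈⟨ solve 5 (λ p r r̄ a b → let t = p :+ (r :+ r̄) in
             (p :* t :+ r :* t) :* a :+ r̄ :* t :* b :=
             (p :* t :+ r :* (r :+ r̄)) :* a :+ r̄ :* t :* b :+ r :* p :* a) ≈-refl p r r̄ a b ⟩
      (p * t + r * (r + r̄)) * a + r̄ * t * b + r * p * a
        ≤⟨ +-mono-≤ ≤-refl (*-monoˡ-≤ (*-nonneg r≥0 p≥0) a≤b) ⟩
      (p * t + r * (r + r̄)) * a + r̄ * t * b + r * p * b
        ≈⟨ solve 5 (λ p r r̄ a b → let t = p :+ (r :+ r̄) in
             (p :* t :+ r :* (r :+ r̄)) :* a :+ r̄ :* t :* b :+ r :* p :* b :=
             p :* (r :* a :+ (p :+ r̄) :* a) :+ (r :+ r̄) :* (r :* a :+ (p :+ r̄) :* b)) ≈-refl p r r̄ a b ⟩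
      p * (r * a + (p + r̄) * a) + (r + r̄) * (r * a + (p + r̄) * b)
        ≈⟨ exposed-suc f ⟨
      exposed f ∎
      where
      t = p + (r + r̄)
      a = exposed (f ∘ (inside ∷_))
      b = exposed (f ∘ (outside ∷_))
      a≤b : a ≤ b
      a≤b = exposed-mono (λ S → anti {outside ∷ S} {inside ∷ S} (out⊆ {p = S} {q = S} ⊆-refl))
      s⊆s′ : ∀ {s} {S T : Subset n} → S ⊆ T → s ∷ S ⊆ s ∷ T
      s⊆s′ S⊆T = s⊆s S⊆T

-- Iterated exposure: halving the sizes of the fragments

_≟ˢ_ : ∀ {n} (S T : Subset n) → Dec (S ≡ T)
_≟ˢ_ = Vec.≡-dec Bool._≟_

module Sparsification (K : OrderedSemiring) where

  open FiniteSums K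
  open Percolation K

  total-density : R → R → ℕ → R
  total-density p₁ p₂ zero    = p₂
  total-density p₁ p₂ (suc k) = p₁ + total-density p₁ p₂ k

  -- Accumulated bounds from `large-fragments`. A round starting with sizes at most `s * 2^(k+1)`
  -- drops the fragments larger than `s * 2^k`; the last one starts with sizes at most `s` and drops
  -- every nonempty fragment.
  loss : R → R → ℕ → ℕ → R
  loss θ θ₂ s zero    = (2 ℕ.^ s) · 1# * θ₂ ^ 1
  loss θ θ₂ s (suc k) = loss θ θ₂ s k + (2 ℕ.^ (s ℕ.* 2 ℕ.^ suc k)) · 1# * θ ^ suc (s ℕ.* 2 ℕ.^ k)

  module _ {J : Set} {n : ℕ} where

    uncovered : (J → Subset n) → List J → Subset n → R
    uncovered e js W = [ ¬? (Fragments.covered? e js W) ]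

    uncovered-antitone : ∀ e js {S T} → S ⊆ T → uncovered e js T ≤ uncovered e js S
    uncovered-antitone e js {S} {T} S⊆T = []-mono (¬? (Fragments.covered? e js T)) (¬? (Fragments.covered? e js S))
      (λ ¬cov cov → ¬cov (Any.map {P = λ j → e j ⊆ S} {Q = λ j → e j ⊆ T} (λ e⊆S x∈ → S⊆T (e⊆S x∈)) cov))

  module _ {J : Set} (w : J → R) (w≥0 : ∀ j → 0# ≤ w j) {n : ℕ} where

    -- The weights are not normalised, since mass is lost whenever members are dropped. The case of
    -- empty S only bounds the total mass by 1.
    IsSpreadWeight : R → (J → Subset n) → List J → Set
    IsSpreadWeight q e js = ∀ S → ∑ js (λ j → w j * [ S ⊆? e j ]) ≤ q ^ ∣ S ∣

    module _ {p p̄ q θ : R} (p-bernoulli : IsBernoulli p p̄) (q≥0 : 0# ≤ q)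
             (θ≥0 : 0# ≤ θ) (θ≤1 : θ ≤ 1#) (q≤θp : q ≤ θ * p)
             (e : J → Subset n) (js : List J) (spread : IsSpreadWeight q e js) where

      open IsBernoulli p-bernoulli using (𝔼ₚ-mono; 𝔼ₚ-const)
      open Fragments e js

      private
        isFragment? : ∀ W T → Dec (IsFragment W T)
        isFragment? W T = any? (λ j → fragment W j ≟ˢ T) js

      -- By spreadness, the members with fragment T have mass at most q^|T|. Passing from W to Z = W
      -- ∪ T replaces q by θ. For fixed Z all possible T lie in one member of size at most ℓ, hence
      -- at most 2^ℓ of them, each of weight at most θ^(ℓ′+1).
      large-fragments : ∀ {ℓ} → (∀ {j} → j ∈ js → ∣ e j ∣ ℕ.≤ ℓ) → ∀ ℓ′ →
        𝔼ₚ p p̄ (λ W → ∑ js (λ j → w j * [ ℓ′ ℕ.<? ∣ fragment W j ∣ ])) ≤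
        (2 ℕ.^ ℓ) · 1# * θ ^ suc ℓ′
      large-fragments {ℓ} e≤ℓ ℓ′ = begin
        𝔼ₚ p p̄ (λ W → ∑ js (λ j → w j * [ ℓ′ ℕ.<? ∣ fragment W j ∣ ]))
          ≤⟨ 𝔼ₚ-mono by-fragment ⟩
        𝔼ₚ p p̄ (λ W → ∑ (subsets n) (λ T → q ^ ∣ T ∣ * ([ T ⊆? ∁ W ] * κ W T)))
          ≈⟨ ≈-trans (𝔼ₚ-∑ (subsets n)) (∑-cong (subsets n) (λ T → 𝔼ₚ-*ˡ)) ⟩
        ∑ (subsets n) (λ T → q ^ ∣ T ∣ * 𝔼ₚ p p̄ (λ W → [ T ⊆? ∁ W ] * κ W T))
          ≤⟨ ∑-mono (subsets n) (λ T → shift p-bernoulli q≥0 θ≥0 q≤θp T (λ W → κ W T) (λ W → []-nonneg (κ? W T))) ⟩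
        ∑ (subsets n) (λ T → θ ^ ∣ T ∣ * 𝔼ₚ p p̄ (λ Z → [ T ⊆? Z ] * κ (Z ─ T) T))
          ≈⟨ ≈-trans (𝔼ₚ-∑ (subsets n)) (∑-cong (subsets n) (λ T → 𝔼ₚ-*ˡ)) ⟨
        𝔼ₚ p p̄ (λ Z → ∑ (subsets n) (λ T → θ ^ ∣ T ∣ * ([ T ⊆? Z ] * κ (Z ─ T) T)))
          ≤⟨ 𝔼ₚ-mono by-member ⟩
        𝔼ₚ p p̄ (λ Z → (2 ℕ.^ ℓ) · 1# * θ ^ suc ℓ′)
          ≈⟨ 𝔼ₚ-const _ ⟩
        (2 ℕ.^ ℓ) · 1# * θ ^ suc ℓ′ ∎
        where
        κ? : ∀ W T → Dec (IsFragment W T × ℓ′ ℕ.< ∣ T ∣)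
        κ? W T = isFragment? W T ×-dec (ℓ′ ℕ.<? ∣ T ∣)

        κ : Subset n → Subset n → R
        κ W T = [ κ? W T ]

        B≥0 : 0# ≤ (2 ℕ.^ ℓ) · 1# * θ ^ suc ℓ′
        B≥0 = *-nonneg (·-nonneg (2 ℕ.^ ℓ)) (^-nonneg θ≥0 (suc ℓ′))

        -- Makes explicit that a fragment avoids W, which is the form in which `shift` takes its
        -- left side.
        disjoint : ∀ W T → κ W T ≈ [ T ⊆? ∁ W ] * κ W T
        disjoint W T = ≈-trans
          ([]-cong (κ? W T) ((T ⊆? ∁ W) ×-dec κ? W T)
            (λ k → (λ x∈T → x∉p⇒x∈∁p (fragment-disjoint (proj₁ k) x∈T)) , k) proj₂)
          ([]-× (T ⊆? ∁ W) (κ? W T))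

        by-fragment : ∀ W → ∑ js (λ j → w j * [ ℓ′ ℕ.<? ∣ fragment W j ∣ ]) ≤
                      ∑ (subsets n) (λ T → q ^ ∣ T ∣ * ([ T ⊆? ∁ W ] * κ W T))
        by-fragment W = begin
          ∑ js (λ j → w j * [ ℓ′ ℕ.<? ∣ fragment W j ∣ ])
            ≤⟨ ∑-mono-∈ js (λ {j} j∈js → ≤-trans (*-monoˡ-≤ (w≥0 j)
                 (≤-trans ([]-mono (ℓ′ ℕ.<? ∣ fragment W j ∣) (κ? W (fragment W j) ×-dec (fragment W j ⊆? e j))
                   (λ lt → (lose j∈js ≡.refl , lt) , fragment⊆ W j∈js))
                 (≤-reflexive ([]-× (κ? W (fragment W j)) (fragment W j ⊆? e j)))))
                 (term≤∑ {f = λ T → w j * (κ W T * [ T ⊆? e j ])} (subsets n)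
                   (λ T → *-nonneg (w≥0 j) (*-nonneg ([]-nonneg (κ? W T)) ([]-nonneg (T ⊆? e j))))
                   (∈-subsets (fragment W j)))) ⟩
          ∑ js (λ j → ∑ (subsets n) (λ T → w j * (κ W T * [ T ⊆? e j ])))
            ≈⟨ ∑-swap _ js (subsets n) ⟩
          ∑ (subsets n) (λ T → ∑ js (λ j → w j * (κ W T * [ T ⊆? e j ])))
            ≈⟨ ∑-cong (subsets n) (λ T → ≈-trans
                 (∑-cong js (λ j → solve 3 (λ a b c → a :* (b :* c) := b :* (a :* c)) ≈-refl (w j)
                   (κ W T) [ T ⊆? e j ]))
                 (∑-*ˡ (κ W T) js)) ⟩
          ∑ (subsets n) (λ T → κ W T * ∑ js (λ j → w j * [ T ⊆? e j ]))
            ≤⟨ ∑-mono (subsets n) (λ T → *-monoˡ-≤ ([]-nonneg (κ? W T)) (spread T)) ⟩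
          ∑ (subsets n) (λ T → κ W T * q ^ ∣ T ∣)
            ≈⟨ ∑-cong (subsets n) (λ T → ≈-trans (*-comm (κ W T) (q ^ ∣ T ∣)) (*-congˡ (disjoint W T))) ⟩
          ∑ (subsets n) (λ T → q ^ ∣ T ∣ * ([ T ⊆? ∁ W ] * κ W T)) ∎

        by-member : ∀ Z → ∑ (subsets n) (λ T → θ ^ ∣ T ∣ * ([ T ⊆? Z ] * κ (Z ─ T) T)) ≤
                    (2 ℕ.^ ℓ) · 1# * θ ^ suc ℓ′
        by-member Z with covered? Z
        ... | no ¬cov = begin
          ∑ (subsets n) (λ T → θ ^ ∣ T ∣ * ([ T ⊆? Z ] * κ (Z ─ T) T))
            ≈⟨ ∑-cong (subsets n) (λ T → ≈-trans (*-congˡ (≈-trans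
                 (≈-sym ([]-× (T ⊆? Z) (κ? (Z ─ T) T)))
                 ([]-false ((T ⊆? Z) ×-dec κ? (Z ─ T) T)
                   (λ (T⊆Z , frag , _) → ¬cov (fragment⇒covered T⊆Z frag))))) (zeroʳ (θ ^ ∣ T ∣))) ⟩
          ∑ (subsets n) (λ T → 0#)
            ≈⟨ ∑-zero (subsets n) ⟩
          0#
            ≤⟨ B≥0 ⟩
          (2 ℕ.^ ℓ) · 1# * θ ^ suc ℓ′ ∎
        -- The member `d` depends on Z alone, so a single set `e d` contains every T that is
        -- counted.
        ... | yes cov with find cov
        ...   | d , d∈js , d⊆Z = begin
          ∑ (subsets n) (λ T → θ ^ ∣ T ∣ * ([ T ⊆? Z ] * κ (Z ─ T) T))
            ≤⟨ ∑-mono (subsets n) (λ T → ≤-trans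
                 (≤-reflexive (≈-trans (*-comm (θ ^ ∣ T ∣) _) (*-cong (≈-sym ([]-× (T ⊆? Z) (κ? (Z ─ T) T))) ≈-refl)))
                 ([]*≤-if ((T ⊆? Z) ×-dec κ? (Z ─ T) T) ([]*-nonneg (T ⊆? e d) (^-nonneg θ≥0 (suc ℓ′)))
                   (λ (T⊆Z , frag , ℓ′<∣T∣) → ≤-trans (^-antitone θ≥0 θ≤1 ℓ′<∣T∣)
                     (≤-reflexive (≈-sym (≈-trans (*-cong
                       ([]-true (T ⊆? e d) (fragment⊆member T⊆Z frag d∈js d⊆Z)) ≈-refl) (*-identityˡ _))))))) ⟩
          ∑ (subsets n) (λ T → [ T ⊆? e d ] * θ ^ suc ℓ′)
            ≈⟨ ∑-*ʳ (θ ^ suc ℓ′) (subsets n) ⟩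
          ∑ (subsets n) (λ T → [ T ⊆? e d ]) * θ ^ suc ℓ′
            ≈⟨ *-cong (∑-⊆ (e d)) ≈-refl ⟩
          (2 ℕ.^ ∣ e d ∣) · 1# * θ ^ suc ℓ′
            ≤⟨ *-monoʳ-≤ (^-nonneg θ≥0 (suc ℓ′)) (·-mono-≤ (ℕ.^-monoʳ-≤ 2 (e≤ℓ d∈js))) ⟩
          (2 ℕ.^ ℓ) · 1# * θ ^ suc ℓ′ ∎

    module _ {p₁ p₂ q θ θ₂ : R} (p₁≥0 : 0# ≤ p₁) (p₂≥0 : 0# ≤ p₂) (q≥0 : 0# ≤ q)
             (θ≥0 : 0# ≤ θ) (θ≤1 : θ ≤ 1#) (q≤θp₁ : q ≤ θ * p₁)
             (θ₂≥0 : 0# ≤ θ₂) (θ₂≤1 : θ₂ ≤ 1#) (q≤θ₂p₂ : q ≤ θ₂ * p₂) (s : ℕ) where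

      private
        total-density≥0 : ∀ k → 0# ≤ total-density p₁ p₂ k
        total-density≥0 zero    = p₂≥0
        total-density≥0 (suc k) = +-nonneg p₁≥0 (total-density≥0 k)

      -- Induction on the rounds. The factor `∑ js w` avoids renormalising: after a first exposure
      -- the mass splits into dropped members, controlled by `large-fragments`, and kept ones, whose
      -- fragments are half as large and to which the induction hypothesis applies. With no rounds
      -- left, an uncovered W leaves every fragment nonempty, so all the mass is counted.
      uncovered-probability : ∀ k {p̄} → 0# ≤ p̄ → total-density p₁ p₂ k + p̄ ≈ 1# →
        ∀ e js → (∀ {j} → j ∈ js → ∣ e j ∣ ℕ.≤ s ℕ.* 2 ℕ.^ k) → IsSpreadWeight q e js →
        ∑ js w * 𝔼ₚ (total-density p₁ p₂ k) p̄ (uncovered e js) ≤ loss θ θ₂ s k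
      uncovered-probability zero {p̄} p̄≥0 total e js e≤s spread = begin
        ∑ js w * 𝔼ₚ p₂ p̄ (uncovered e js)
          ≈⟨ 𝔼ₚ-*ˡ ⟨
        𝔼ₚ p₂ p̄ (λ W → ∑ js w * uncovered e js W)
          ≤⟨ 𝔼ₚ-mono (λ W → ≤-trans (≤-reflexive (≈-sym (∑-*ʳ (uncovered e js W) js)))
               (∑-mono-∈ js (λ {j} j∈js → *-monoˡ-≤ (w≥0 j)
                 ([]-mono (¬? (covered? W)) (0 ℕ.<? ∣ fragment W j ∣)
                   (λ ¬cov → ℕ.n≢0⇒n>0 (λ eq → ¬cov (fragment-empty W j∈js eq))))))) ⟩
        𝔼ₚ p₂ p̄ (λ W → ∑ js (λ j → w j * [ 0 ℕ.<? ∣ fragment W j ∣ ]))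
          ≤⟨ large-fragments p₂-bernoulli q≥0 θ₂≥0 θ₂≤1 q≤θ₂p₂ e js spread
               (λ j∈js → ℕ.≤-trans (e≤s j∈js) (ℕ.≤-reflexive (ℕ.*-identityʳ s))) 0 ⟩
        loss θ θ₂ s 0 ∎
        where
        open Fragments e js
        p₂-bernoulli : IsBernoulli p₂ p̄
        p₂-bernoulli = bern p₂≥0 p̄≥0 total
        open IsBernoulli p₂-bernoulli using (𝔼ₚ-mono)
      uncovered-probability (suc k) {p̄} p̄≥0 total e js e≤ spread = begin
        ∑ js w * 𝔼ₚ (p₁ + r) p̄ (uncovered e js)
          ≤⟨ *-monoˡ-≤ (∑-nonneg js w≥0)
               (two-exposures p₁≥0 r≥0 p̄≥0 total′ (uncovered e js) (uncovered-antitone e js)) ⟩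
        ∑ js w * 𝔼ₚ p₁ (r + p̄) (λ W → 𝔼ₚ r (p₁ + p̄) (λ W′ → uncovered e js (W ∪ W′)))
          ≈⟨ 𝔼ₚ-*ˡ ⟨
        𝔼ₚ p₁ (r + p̄) (λ W → ∑ js w * 𝔼ₚ r (p₁ + p̄) (λ W′ → uncovered e js (W ∪ W′)))
          ≤⟨ IsBernoulli.𝔼ₚ-mono p₁-bernoulli after-first-exposure ⟩
        𝔼ₚ p₁ (r + p̄) (λ W → loss θ θ₂ s k + dropped W)
          ≈⟨ ≈-trans 𝔼ₚ-+ (+-cong (IsBernoulli.𝔼ₚ-const p₁-bernoulli (loss θ θ₂ s k)) ≈-refl) ⟩
        loss θ θ₂ s k + 𝔼ₚ p₁ (r + p̄) dropped
          ≤⟨ +-mono-≤ ≤-refl (large-fragments p₁-bernoulli q≥0 θ≥0 θ≤1 q≤θp₁ e js spread e≤ ℓ′) ⟩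
        loss θ θ₂ s (suc k) ∎
        where
        open Fragments e js
        r = total-density p₁ p₂ k
        r≥0 = total-density≥0 k
        ℓ′ = s ℕ.* 2 ℕ.^ k
        total′ : p₁ + (r + p̄) ≈ 1#
        total′ = ≈-trans (≈-sym (+-assoc p₁ r p̄)) total
        total″ : r + (p₁ + p̄) ≈ 1#
        total″ = ≈-trans (solve 3 (λ p r r̄ → r :+ (p :+ r̄) := p :+ (r :+ r̄)) ≈-refl p₁ r p̄) total′
        p₁-bernoulli : IsBernoulli p₁ (r + p̄)
        p₁-bernoulli = bern p₁≥0 (+-nonneg r≥0 p̄≥0) total′
        r-bernoulli : IsBernoulli r (p₁ + p̄)
        r-bernoulli = bern r≥0 (+-nonneg p₁≥0 p̄≥0) total″
        open IsBernoulli r-bernoulli using (𝔼ₚ-mono; 𝔼ₚ-const)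

        large? : ∀ W j → Dec (ℓ′ ℕ.< ∣ fragment W j ∣)
        large? W j = ℓ′ ℕ.<? ∣ fragment W j ∣
        dropped : Subset n → R
        dropped W = ∑ js (λ j → w j * [ large? W j ])
        kept : Subset n → List J
        kept W = filter (¬? ∘ large? W) js
        kept⁻ : ∀ {W j} → j ∈ kept W → j ∈ js × ¬ (ℓ′ ℕ.< ∣ fragment W j ∣)
        kept⁻ {W} = ∈-filter⁻ (¬? ∘ large? W)

        -- Spreadness is inherited with the same q: fragments are subsets of their members, and
        -- dropping members only removes mass.
        spread′ : ∀ W → IsSpreadWeight q (fragment W) (kept W)
        spread′ W S = begin
          ∑ (kept W) (λ j → w j * [ S ⊆? fragment W j ])
            ≤⟨ ∑-mono-∈ (kept W) (λ {j} j∈ → *-monoˡ-≤ (w≥0 j) ([]-mono (S ⊆? fragment W j) (S ⊆? e j)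
                 (λ S⊆ → ⊆-trans S⊆ (fragment⊆ W (proj₁ (kept⁻ j∈)))))) ⟩
          ∑ (kept W) (λ j → w j * [ S ⊆? e j ])
            ≈⟨ ∑-filter (¬? ∘ large? W) js ⟩
          ∑ js (λ j → [ ¬? (large? W j) ] * (w j * [ S ⊆? e j ]))
            ≤⟨ ∑-mono js (λ j → []*≤ (¬? (large? W j)) (*-nonneg (w≥0 j) ([]-nonneg (S ⊆? e j)))) ⟩
          ∑ js (λ j → w j * [ S ⊆? e j ])
            ≤⟨ spread S ⟩
          q ^ ∣ S ∣ ∎

        mass-split : ∀ W → ∑ js w ≈ ∑ (kept W) w + dropped W
        mass-split W = begin-equality
          ∑ js w
            ≈⟨ ∑-cong js (λ j → ≈-trans (≈-sym (≈-trans (*-congˡ ([]-¬ (large? W j))) (*-identityʳ (w j))))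
                 (solve 3 (λ w a b → w :* (a :+ b) := b :* w :+ w :* a) ≈-refl (w j) [ large? W j ] [ ¬?
                   (large? W j) ])) ⟩
          ∑ js (λ j → [ ¬? (large? W j) ] * w j + w j * [ large? W j ])
            ≈⟨ ∑-+ js ⟩
          ∑ js (λ j → [ ¬? (large? W j) ] * w j) + dropped W
            ≈⟨ +-cong (∑-filter (¬? ∘ large? W) js) ≈-refl ⟨
          ∑ (kept W) w + dropped W ∎

        after-first-exposure : ∀ W →
          ∑ js w * 𝔼ₚ r (p₁ + p̄) (λ W′ → uncovered e js (W ∪ W′)) ≤ loss θ θ₂ s k + dropped W
        after-first-exposure W = begin
          ∑ js w * U
            ≈⟨ ≈-trans (*-cong (mass-split W) ≈-refl) (distribʳ U _ _) ⟩
          ∑ (kept W) w * U + dropped W * U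
            ≤⟨ +-mono-≤
                 (*-monoˡ-≤ (∑-nonneg (kept W) w≥0) (𝔼ₚ-mono (λ W′ →
                   []-mono (¬? (covered? (W ∪ W′))) (¬? (Fragments.covered? (fragment W) (kept W) W′))
                     (λ ¬cov cov → let j , j∈ , f⊆W′ = find cov in
                       ¬cov (covered-by-fragment W (proj₁ (kept⁻ j∈)) f⊆W′)))))
                 (≤-trans (*-monoˡ-≤ dropped≥0 (≤-trans (𝔼ₚ-mono (λ W′ → []≤1 (¬? (covered? (W ∪ W′)))))
                   (≤-reflexive (𝔼ₚ-const 1#)))) (≤-reflexive (*-identityʳ _))) ⟩
          ∑ (kept W) w * 𝔼ₚ r (p₁ + p̄) (uncovered (fragment W) (kept W)) + dropped W
            ≤⟨ +-mono-≤ (uncovered-probability k (+-nonneg p₁≥0 p̄≥0) total″ (fragment W) (kept W)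
                 (λ j∈ → ℕ.≮⇒≥ (proj₂ (kept⁻ j∈))) (spread′ W)) ≤-refl ⟩
          loss θ θ₂ s k + dropped W ∎
          where
          U = 𝔼ₚ r (p₁ + p̄) (λ W′ → uncovered e js (W ∪ W′))
          dropped≥0 : 0# ≤ dropped W
          dropped≥0 = ∑-nonneg js (λ j → *-nonneg (w≥0 j) ([]-nonneg (large? W j)))

-- Coloured sets and clutter percolation

module _ {T T′ : Subset l} where

  ++-⊆⁻ˡ : ∀ (S S′ : Subset k) → S ++ T ⊆ S′ ++ T′ → S ⊆ S′
  ++-⊆⁻ˡ (inside ∷ S) (_ ∷ S′) S⊆ here with here ← S⊆ here = here
  ++-⊆⁻ˡ (_ ∷ S)      (_ ∷ S′) S⊆ (there x∈) = there (++-⊆⁻ˡ S S′ (drop-∷-⊆ S⊆) x∈)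

  ++-⊆⁻ʳ : ∀ (S S′ : Subset k) → S ++ T ⊆ S′ ++ T′ → T ⊆ T′
  ++-⊆⁻ʳ []      []       S⊆ = S⊆
  ++-⊆⁻ʳ (_ ∷ S) (_ ∷ S′) S⊆ = ++-⊆⁻ʳ S S′ (drop-∷-⊆ S⊆)

  ++-⊆⁺ : ∀ {S S′ : Subset k} → S ⊆ S′ → T ⊆ T′ → S ++ T ⊆ S′ ++ T′
  ++-⊆⁺ {S = []}     {[]}     S⊆ T⊆ x∈ = T⊆ x∈
  ++-⊆⁺ {S = _ ∷ S} {_ ∷ S′} S⊆ T⊆ here with here ← S⊆ here = here
  ++-⊆⁺ {S = _ ∷ S} {_ ∷ S′} S⊆ T⊆ (there x∈) = there (++-⊆⁺ (drop-∷-⊆ S⊆) T⊆ x∈)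

⁅x⁆⊆p : ∀ {p : Subset h} {x} → x ∈ˢ p → ⁅ x ⁆ ⊆ p
⁅x⁆⊆p {x = x} x∈p y∈ with ≡.refl ← x∈⁅y⁆⇒x≡y x y∈ = x∈p

-- A partially coloured subset of Ω; flatten turns it into a subset of Ω × [h], one block of h
-- points per element of Ω.
PartialColouring : ℕ → ℕ → Set
PartialColouring m h = Vec (Maybe (Fin h)) m

block : Maybe (Fin h) → Subset h
block nothing  = ⊥
block (just c) = ⁅ c ⁆

flatten : PartialColouring m h → Subset (m ℕ.* h)
flatten []      = []
flatten (g ∷ G) = block g ++ flatten G

-- The graph of the colouring `cs` over the retained points, in the block layout of `flatten`.
marked : Vec (Fin h) m → Subset m → Subset (m ℕ.* h)
marked []       []            = []
marked (c ∷ cs) (inside  ∷ S) = ⁅ c ⁆ ++ marked cs S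
marked (c ∷ cs) (outside ∷ S) = ⊥ ++ marked cs S

module Clutter (K : OrderedSemiring) where

  open FiniteSums K
  open Percolation K
  open Sparsification K

  private
    colours : ∀ h → List (Fin h)
    colours = allFin

  -- Without subtraction, this says f(∅) - f(B) ≤ ∑ over c in B of f(∅) - f({c}): the gain from a
  -- block is subadditive in its points. It is required in each block, with the earlier blocks fixed
  -- and the later ones arbitrary.
  BlockSubadditive : ∀ m {h} → (Subset (m ℕ.* h) → R) → Set
  BlockSubadditive zero    f = Unit.⊤
  BlockSubadditive (suc m) {h} f =
    (∀ B V → f (⊥ ++ V) + ∑ (colours h) (λ c → [ c ∈? B ] * f (⁅ c ⁆ ++ V)) ≤
             f (B ++ V) + ∑ (colours h) (λ c → [ c ∈? B ] * f (⊥ ++ V))) ×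
    (∀ B → BlockSubadditive m (λ V → f (B ++ V)))

  BlockSubadditive-resp : ∀ m {h} {f g : Subset (m ℕ.* h) → R} → (∀ V → f V ≈ g V) →
                          BlockSubadditive m f → BlockSubadditive m g
  BlockSubadditive-resp zero    f≈g _ = Unit.tt
  BlockSubadditive-resp (suc m) {h} {f} {g} f≈g (sub , rest) =
    (λ B V → ≤-trans (≤-reflexive (+-cong (≈-sym (f≈g _)) (∑-cong (colours h) (λ c → *-congˡ (≈-sym (f≈g _))))))
      (≤-trans (sub B V) (≤-reflexive (+-cong (f≈g _) (∑-cong (colours h) (λ c → *-congˡ (f≈g _))))))) ,
    (λ B → BlockSubadditive-resp m (λ V → f≈g (B ++ V)) (rest B))

  module _ {J : Set} where

    -- A flattened member has at most one point in each block, so if B lets some member in, a single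
    -- colour c of B, or the empty block, already does. For the later blocks, fixing B leaves the
    -- same situation for the tails of the members whose first block fits into B.
    uncovered-subadditive : ∀ {m h} (G : J → PartialColouring m h) js →
                            BlockSubadditive m (uncovered (flatten ∘ G) js)
    uncovered-subadditive {zero}  G js = Unit.tt
    uncovered-subadditive {suc m} {h} G js = sub , λ B → BlockSubadditive-resp m
      (λ V → []-cong (¬? (Fragments.covered? (flatten ∘ Vec.tail ∘ G) (rest B) V)) (¬? (covered? (B ++ V)))
        (λ ¬cov cov → ¬cov (restrict cov)) (λ ¬cov cov → ¬cov (extend cov)))
      (uncovered-subadditive (Vec.tail ∘ G) (rest B))
      where
      open Fragments (flatten ∘ G) js
      head⊆? : ∀ B j → Dec (block (Vec.head (G j)) ⊆ B)
      head⊆? B j = block (Vec.head (G j)) ⊆? B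
      rest : Subset h → List J
      rest B = filter (head⊆? B) js

      split : ∀ {B V} j → flatten (G j) ⊆ B ++ V → block (Vec.head (G j)) ⊆ B × flatten (Vec.tail (G j)) ⊆ V
      split {B} j ⊆BV with g ∷ G′ ← G j = ++-⊆⁻ˡ (block g) B ⊆BV , ++-⊆⁻ʳ (block g) B ⊆BV

      join : ∀ {B V} j → block (Vec.head (G j)) ⊆ B → flatten (Vec.tail (G j)) ⊆ V → flatten (G j) ⊆ B ++ V
      join j ⊆B ⊆V with g ∷ G′ ← G j = ++-⊆⁺ ⊆B ⊆V

      restrict : ∀ {B V} → Covered (B ++ V) → Fragments.Covered (flatten ∘ Vec.tail ∘ G) (rest B) V
      restrict {B} cov = let j , j∈ , ⊆BV = find cov ; ⊆B , ⊆V = split j ⊆BV in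
        lose (∈-filter⁺ (head⊆? B) j∈ ⊆B) ⊆V

      extend : ∀ {B V} → Fragments.Covered (flatten ∘ Vec.tail ∘ G) (rest B) V → Covered (B ++ V)
      extend {B} cov = let j , j∈ , ⊆V = find cov ; j∈js , ⊆B = ∈-filter⁻ (head⊆? B) j∈ in
        lose j∈js (join j ⊆B ⊆V)

      module _ (B : Subset h) (V : Subset (m ℕ.* h)) where
        φ : Subset h → R
        φ B = uncovered (flatten ∘ G) js (B ++ V)

        φ-anti : ∀ {B B′} → B ⊆ B′ → φ B′ ≤ φ B
        φ-anti B⊆B′ = uncovered-antitone (flatten ∘ G) js (++-⊆⁺ B⊆B′ (λ x∈ → x∈))

        φ≥0 : ∀ B → 0# ≤ φ B
        φ≥0 B = []-nonneg (¬? (covered? (B ++ V)))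

        φ≈0 : ∀ {B} → Covered (B ++ V) → φ B ≈ 0#
        φ≈0 {B} cov = []-false (¬? (covered? (B ++ V))) (λ ¬cov → ¬cov cov)

        φ-head : ∀ c → [ c ∈? B ] * φ ⁅ c ⁆ ≤ [ c ∈? B ] * φ ⊥
        φ-head c = *-monoˡ-≤ ([]-nonneg (c ∈? B)) (φ-anti ⊥⊆)

        easy : φ ⊥ ≤ φ B → φ ⊥ + ∑ (colours h) (λ c → [ c ∈? B ] * φ ⁅ c ⁆) ≤
                           φ B + ∑ (colours h) (λ c → [ c ∈? B ] * φ ⊥)
        easy φ⊥≤φB = +-mono-≤ φ⊥≤φB (∑-mono (colours h) φ-head)

        hit : ∀ j → j ∈ js → flatten (G j) ⊆ B ++ V →
              φ ⊥ + ∑ (colours h) (λ c → [ c ∈? B ] * φ ⁅ c ⁆) ≤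
              φ B + ∑ (colours h) (λ c → [ c ∈? B ] * φ ⊥)
        hit j j∈js ⊆BV with Vec.head (G j) in eq | split j ⊆BV
        ... | nothing | _ , ⊆V = easy (≤-trans (≤-reflexive (φ≈0
                (lose j∈js (join j (≡.subst (λ g → block g ⊆ ⊥) (≡.sym eq) (λ x∈ → x∈)) ⊆V)))) (φ≥0 B))
        -- The summand of `c` on the left vanishes because ⁅ c ⁆ already admits the member; the lone
        -- `φ ⊥` takes its place.
        ... | just c | ⊆B , ⊆V = begin
          φ ⊥ + ∑ (colours h) (λ c′ → [ c′ ∈? B ] * φ ⁅ c′ ⁆)
            ≤⟨ +-mono-≤ (≤-trans (≤-reflexive
              (≈-sym (≈-trans (*-cong ([]-true (c Fin.≟ c) ≡.refl) ≈-refl) (*-identityˡ _))))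
                 (term≤∑ {f = λ c′ → [ c′ Fin.≟ c ] * φ ⊥} (colours h)
                   (λ c′ → []*-nonneg (c′ Fin.≟ c) (φ≥0 ⊥)) (∈-allFin c))) ≤-refl ⟩
          ∑ (colours h) (λ c′ → [ c′ Fin.≟ c ] * φ ⊥) + ∑ (colours h) (λ c′ → [ c′ ∈? B ] * φ ⁅ c′ ⁆)
            ≈⟨ ∑-+ (colours h) ⟨
          ∑ (colours h) (λ c′ → [ c′ Fin.≟ c ] * φ ⊥ + [ c′ ∈? B ] * φ ⁅ c′ ⁆)
            ≤⟨ ∑-mono (colours h) termwise ⟩
          ∑ (colours h) (λ c′ → [ c′ ∈? B ] * φ ⊥)
            ≤⟨ y≤x+y (φ≥0 B) ⟩
          φ B + ∑ (colours h) (λ c′ → [ c′ ∈? B ] * φ ⊥) ∎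
          where
          cov : Covered (⁅ c ⁆ ++ V)
          cov = lose j∈js (join j (≡.subst (λ g → block g ⊆ ⁅ c ⁆) (≡.sym eq) (λ x∈ → x∈)) ⊆V)
          termwise : ∀ c′ → [ c′ Fin.≟ c ] * φ ⊥ + [ c′ ∈? B ] * φ ⁅ c′ ⁆ ≤ [ c′ ∈? B ] * φ ⊥
          termwise c′ with c′ Fin.≟ c
          ... | no _ = ≤-trans (≤-reflexive (≈-trans (+-cong (zeroˡ _) ≈-refl) (+-identityˡ _))) (φ-head c′)
          ... | yes ≡.refl = ≤-reflexive (≈-trans (+-cong (*-identityˡ _)
                (≈-trans (*-congˡ (φ≈0 cov)) (zeroʳ _))) (≈-trans (+-identityʳ _)
                (≈-sym (≈-trans (*-cong ([]-true (c ∈? B) (⊆B (x∈⁅x⁆ c))) ≈-refl) (*-identityˡ _)))))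

        sub : φ ⊥ + ∑ (colours h) (λ c → [ c ∈? B ] * φ ⁅ c ⁆) ≤
              φ B + ∑ (colours h) (λ c → [ c ∈? B ] * φ ⊥)
        sub with covered? (B ++ V)
        ... | no ¬cov = easy′
          where
          easy′ : φ ⊥ + ∑ (colours h) (λ c → [ c ∈? B ] * φ ⁅ c ⁆) ≤
                  1# + ∑ (colours h) (λ c → [ c ∈? B ] * φ ⊥)
          easy′ = +-mono-≤ ([]≤1 (¬? (covered? (⊥ ++ V)))) (∑-mono (colours h) φ-head)
        ... | yes cov = ≤-trans (let j , j∈ , ⊆BV = find cov in hit j j∈ ⊆BV)
                          (≤-reflexive (+-cong (φ≈0 cov) ≈-refl))

  𝔼ₚ-∈ : ∀ {p p̄} → IsBernoulli p p̄ → ∀ {h} (c : Fin h) → 𝔼ₚ p p̄ (λ B → [ c ∈? B ]) ≈ p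
  𝔼ₚ-∈ {p} {p̄} p-bernoulli zero = ≈-trans (𝔼ₚ-suc _) (≈-trans
    (+-cong (*-congˡ (≈-trans (𝔼ₚ-cong (λ B → []-true (zero ∈? inside ∷ B) here))
      (IsBernoulli.𝔼ₚ-const p-bernoulli 1#)))
            (*-congˡ (≈-trans (𝔼ₚ-cong (λ B → []-false
              (zero ∈? outside ∷ B) λ ())) (IsBernoulli.𝔼ₚ-const p-bernoulli 0#))))
    (solve 2 (λ p p̄ → p :* con 1 :+ p̄ :* con 0 := p) ≈-refl p p̄))
  𝔼ₚ-∈ {p} {p̄} p-bernoulli (suc c) = ≈-trans (𝔼ₚ-suc _) (≈-trans
    (+-cong (*-congˡ (≈-trans (𝔼ₚ-cong (shrink inside)) (𝔼ₚ-∈ p-bernoulli c)))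
            (*-congˡ (≈-trans (𝔼ₚ-cong (shrink outside)) (𝔼ₚ-∈ p-bernoulli c))))
    (≈-trans (≈-sym (distribʳ p p p̄)) (≈-trans (*-cong (IsBernoulli.total p-bernoulli) ≈-refl) (*-identityˡ p))))
    where
    shrink : ∀ s B → [ suc c ∈? s ∷ B ] ≈ [ c ∈? B ]
    shrink s B = []-cong (suc c ∈? s ∷ B) (c ∈? B) (λ { (there c∈) → c∈ }) there

  module _ {ρ ρ̄ u π π̄ : R} {h : ℕ} (ρ-bernoulli : IsBernoulli ρ ρ̄) (π-bernoulli : IsBernoulli π π̄)
           (u≥0 : 0# ≤ u) (∑u≈1 : ∑ (colours h) (λ _ → u) ≈ 1#) (π≈ρu : π ≈ ρ * u) where

    open IsBernoulli ρ-bernoulli using () renaming (p≥0 to ρ≥0; p̄≥0 to ρ̄≥0; total to ρ+ρ̄≈1)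
    open IsBernoulli π-bernoulli using (𝔼ₚ-mono; 𝔼ₚ-const) renaming (p≥0 to π≥0)

    𝔼ᶜ : ∀ {m} → (Vec (Fin h) m → R) → R
    𝔼ᶜ {m} = 𝔼ⁿ (colours h) (λ _ → u) m

    coloured-exposure : ∀ m → (Subset (m ℕ.* h) → R) → R
    coloured-exposure m f = 𝔼ᶜ (λ cs → 𝔼ₚ ρ ρ̄ {m} (λ S → f (marked cs S)))

    private
      coloured-exposure-suc : ∀ {m} (f : Subset (h ℕ.+ m ℕ.* h) → R) →
        coloured-exposure (suc m) f ≈
        𝔼 (colours h) (λ _ → u) (λ c → ρ * coloured-exposure m (λ V → f (⁅ c ⁆ ++ V)) + ρ̄ * coloured-exposure m
          (λ V → f (⊥ ++ V)))
      coloured-exposure-suc {m} f = ≈-trans (𝔼ⁿ-suc (colours h) _ m _)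
        (𝔼-cong (colours h) _ (λ c → ≈-trans (𝔼ⁿ-cong (colours h) _ (λ cs → 𝔼ₚ-suc _))
          (≈-trans (𝔼ⁿ-+ (colours h) _) (+-cong (𝔼ⁿ-*ˡ (colours h) _) (𝔼ⁿ-*ˡ (colours h) _)))))

      -- The hypothesis averaged over B: each colour lies in B with probability π = ρu, and u sums
      -- to 1, so the right side becomes `𝔼ₚ π π̄ φ` plus `ρ * φ ⊥`. Adding `ρ * φ ⊥` to the
      -- expectation over an exclusive block gives exactly the averaged left side.
      one-block : (φ : Subset h → R) →
        (∀ B → φ ⊥ + ∑ (colours h) (λ c → [ c ∈? B ] * φ ⁅ c ⁆) ≤ φ B + ∑ (colours h) (λ c → [ c ∈? B ] * φ ⊥)) →
        𝔼 (colours h) (λ _ → u) (λ c → ρ * φ ⁅ c ⁆ + ρ̄ * φ ⊥) ≤ 𝔼ₚ π π̄ φ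
      one-block φ sub = +-cancelʳ-≤ (ρ * φ ⊥) (begin
        𝔼 (colours h) (λ _ → u) (λ c → ρ * φ ⁅ c ⁆ + ρ̄ * φ ⊥) + ρ * φ ⊥
          ≈⟨ +-cong (≈-trans (𝔼-+ (colours h) _ _ _)
            (+-cong (≈-trans (𝔼-as-∑ _) (≈-trans (*-congˡ (∑-*ˡ ρ (colours h))) (≈-sym πΣ)))
               (≈-trans (𝔼-const (colours h) _ _) (≈-trans (*-cong ∑u≈1 ≈-refl) (*-identityˡ _))))) ≈-refl ⟩
        π * Σ₁ + ρ̄ * φ ⊥ + ρ * φ ⊥
          ≈⟨ solve 4 (λ a ρ ρ̄ x → a :+ ρ̄ :* x :+ ρ :* x := (ρ :+ ρ̄) :* x :+ a) ≈-refl (π * Σ₁) ρ ρ̄ (φ ⊥) ⟩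
        (ρ + ρ̄) * φ ⊥ + π * Σ₁
          ≈⟨ +-cong (≈-trans (*-cong ρ+ρ̄≈1 ≈-refl) (*-identityˡ _)) ≈-refl ⟩
        φ ⊥ + π * Σ₁
          ≈⟨ ≈-trans 𝔼ₚ-+ (+-cong (𝔼ₚ-const (φ ⊥)) (𝔼ₚ-weighted (φ ∘ ⁅_⁆))) ⟨
        𝔼ₚ π π̄ (λ B → φ ⊥ + ∑ (colours h) (λ c → [ c ∈? B ] * φ ⁅ c ⁆))
          ≤⟨ 𝔼ₚ-mono sub ⟩
        𝔼ₚ π π̄ (λ B → φ B + ∑ (colours h) (λ c → [ c ∈? B ] * φ ⊥))
          ≈⟨ ≈-trans 𝔼ₚ-+ (+-congˡ (𝔼ₚ-weighted (λ _ → φ ⊥))) ⟩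
        𝔼ₚ π π̄ φ + π * ∑ (colours h) (λ _ → φ ⊥)
          ≈⟨ +-congˡ (≈-trans (*-cong π≈ρu ≈-refl) (≈-trans (*-assoc ρ u _) (*-cong ≈-refl
               (≈-trans (≈-sym (𝔼-as-∑ _)) (≈-trans (𝔼-const (colours h) _ _)
                 (≈-trans (*-cong ∑u≈1 ≈-refl) (*-identityˡ _))))))) ⟩
        𝔼ₚ π π̄ φ + ρ * φ ⊥ ∎)
        where
        Σ₁ = ∑ (colours h) (λ c → φ ⁅ c ⁆)
        𝔼-as-∑ : ∀ g → 𝔼 (colours h) (λ _ → u) g ≈ u * ∑ (colours h) g
        𝔼-as-∑ g = 𝔼-uniform (colours h) u g
        πΣ : π * Σ₁ ≈ u * (ρ * Σ₁)
        πΣ = ≈-trans (*-cong π≈ρu ≈-refl) (solve 3 (λ ρ u s → ρ :* u :* s := u :* (ρ :* s)) ≈-refl ρ u Σ₁)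
        𝔼ₚ-weighted : ∀ (g : Fin h → R) → 𝔼ₚ π π̄ (λ B → ∑ (colours h) (λ c → [ c ∈? B ] * g c)) ≈ π * ∑ (colours h) g
        𝔼ₚ-weighted g = ≈-trans (𝔼ₚ-∑ (colours h)) (≈-trans (∑-cong (colours h) (λ c →
          ≈-trans (𝔼ₚ-cong (λ B → *-comm [ c ∈? B ] (g c))) (≈-trans 𝔼ₚ-*ˡ
            (≈-trans (*-congˡ (𝔼ₚ-∈ π-bernoulli c)) (*-comm (g c) π))))) (∑-*ˡ π (colours h)))

    -- McDiarmid's clutter percolation: making the h copies of a point mutually exclusive can only
    -- help to contain a member when every member uses at most one copy.
    clutter-percolation : ∀ m (f : Subset (m ℕ.* h) → R) → BlockSubadditive m f →
                          coloured-exposure m f ≤ 𝔼ₚ π π̄ f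
    clutter-percolation zero f _ = ≤-reflexive (≈-trans (𝔼ⁿ-zero (colours h) _ _)
      (≈-trans (𝔼ₚ-zero _) (≈-sym (𝔼ₚ-zero f))))
    clutter-percolation (suc m) f (sub , rest) = begin
      coloured-exposure (suc m) f
        ≈⟨ coloured-exposure-suc {m} f ⟩
      𝔼 (colours h) (λ _ → u) (λ c → ρ * coloured-exposure m (λ V → f (⁅ c ⁆ ++ V)) + ρ̄ * coloured-exposure m
        (λ V → f (⊥ ++ V)))
        ≤⟨ 𝔼-mono (colours h) _ (λ _ → u≥0) (λ c → +-mono-≤
             (*-monoˡ-≤ ρ≥0 (clutter-percolation m _ (rest ⁅ c ⁆)))
             (*-monoˡ-≤ ρ̄≥0 (clutter-percolation m _ (rest ⊥)))) ⟩
      𝔼 (colours h) (λ _ → u) (λ c → ρ * φ ⁅ c ⁆ + ρ̄ * φ ⊥)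
        -- The condition `sub` is linear in f, so it survives averaging over the later blocks V.
        ≤⟨ one-block φ (λ B → ≤-trans (≤-reflexive (≈-sym (average ⊥ ⁅_⁆ B)))
          (≤-trans (𝔼ₚ-mono (sub B)) (≤-reflexive (average B (λ _ → ⊥) B)))) ⟩
      𝔼ₚ π π̄ φ
        ≈⟨ 𝔼ₚ-++ h (m ℕ.* h) f ⟨
      𝔼ₚ π π̄ f ∎
      where
      φ : Subset h → R
      φ B = 𝔼ₚ π π̄ (λ V → f (B ++ V))
      average : ∀ B₀ (B₁ : Fin h → Subset h) B →
        𝔼ₚ π π̄ (λ V → f (B₀ ++ V) + ∑ (colours h) (λ c → [ c ∈? B ] * f (B₁ c ++ V))) ≈
        φ B₀ + ∑ (colours h) (λ c → [ c ∈? B ] * φ (B₁ c))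
      average B₀ B₁ B = ≈-trans 𝔼ₚ-+ (+-congˡ (≈-trans (𝔼ₚ-∑ (colours h)) (∑-cong (colours h) (λ c → 𝔼ₚ-*ˡ))))

-- Uniformly random bijective colourings

∣++∣ : ∀ (S : Subset k) (T : Subset l) → ∣ S ++ T ∣ ≡ ∣ S ∣ ℕ.+ ∣ T ∣
∣++∣ []            T = refl
∣++∣ (inside  ∷ S) T = cong suc (∣++∣ S T)
∣++∣ (outside ∷ S) T = ∣++∣ S T

disjoint⇒∣∣+∣∣≤∣∪∣ : ∀ (p q : Subset k) → (∀ {x} → x ∈ˢ p → x ∉ˢ q) → ∣ p ∣ ℕ.+ ∣ q ∣ ℕ.≤ ∣ p ∪ q ∣
disjoint⇒∣∣+∣∣≤∣∪∣ [] [] _ = ℕ.z≤n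
disjoint⇒∣∣+∣∣≤∣∪∣ (inside ∷ p) (inside ∷ q) disj = contradiction here (disj here)
disjoint⇒∣∣+∣∣≤∣∪∣ (inside ∷ p) (outside ∷ q) disj =
  ℕ.s≤s (disjoint⇒∣∣+∣∣≤∣∪∣ p q (λ x∈p x∈q → disj (there x∈p) (there x∈q)))
disjoint⇒∣∣+∣∣≤∣∪∣ (outside ∷ p) (inside ∷ q) disj = subst (ℕ._≤ suc ∣ p ∪ q ∣) (sym (ℕ.+-suc ∣ p ∣ ∣ q ∣))
  (ℕ.s≤s (disjoint⇒∣∣+∣∣≤∣∪∣ p q (λ x∈p x∈q → disj (there x∈p) (there x∈q))))
disjoint⇒∣∣+∣∣≤∣∪∣ (outside ∷ p) (outside ∷ q) disj =
  disjoint⇒∣∣+∣∣≤∣∪∣ p q (λ x∈p x∈q → disj (there x∈p) (there x∈q))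

x∈p⇒1+∣p-x∣≡∣p∣ : ∀ {p : Subset k} {x} → x ∈ˢ p → suc ∣ p -ˢ x ∣ ≡ ∣ p ∣
x∈p⇒1+∣p-x∣≡∣p∣ {p = inside ∷ p} here = cong (suc ∘ ∣_∣) (p─⊥≡p p)
x∈p⇒1+∣p-x∣≡∣p∣ {p = inside ∷ p} (there x∈p) = cong suc (x∈p⇒1+∣p-x∣≡∣p∣ x∈p)
x∈p⇒1+∣p-x∣≡∣p∣ {p = outside ∷ p} (there x∈p) = x∈p⇒1+∣p-x∣≡∣p∣ x∈p

Empty⇒∣p∣≡0 : ∀ {p : Subset k} → Empty p → ∣ p ∣ ≡ 0
Empty⇒∣p∣≡0 {k} empty = trans (cong ∣_∣ (Empty-unique empty)) (∣⊥∣≡0 k)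

Nonempty∧⊆⁅⁆ : ∀ {p : Subset k} {c x} → x ∈ˢ p → p ⊆ ⁅ c ⁆ → x ≡ c × ∣ p ∣ ≡ 1
Nonempty∧⊆⁅⁆ {p = p} {c} {x} x∈p p⊆c with refl ← x∈⁅y⁆⇒x≡y c (p⊆c x∈p) = refl ,
  ℕ.≤-antisym (subst (∣ p ∣ ℕ.≤_) (∣⁅x⁆∣≡1 c) (p⊆q⇒∣p∣≤∣q∣ p⊆c))
    (subst (ℕ._≤ ∣ p ∣) (∣⁅x⁆∣≡1 c) (p⊆q⇒∣p∣≤∣q∣ (⁅x⁆⊆p x∈p)))

-- Injective colourings of A by colours of U. Removing each used colour from U builds in
-- injectivity; when |A| = |U| these are the bijections.
data Filling {h} : ∀ {m} → Subset m → Subset h → PartialColouring m h → Set where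
  []       : ∀ {U} → Filling [] U []
  outside∷ : ∀ {m} {A : Subset m} {U G} → Filling A U G → Filling (outside ∷ A) U (nothing ∷ G)
  inside∷  : ∀ {m} {A : Subset m} {U G c} → c ∈ˢ U → Filling A (U -ˢ c) G → Filling (inside ∷ A) U (just c ∷ G)

fillings : Subset m → Subset h → List (PartialColouring m h)
fillings []            U = [] ∷ []
fillings (outside ∷ A) U = map (nothing ∷_) (fillings A U)
fillings {h = h} (inside ∷ A) U =
  concatMap (λ c → map (just c ∷_) (fillings A (U -ˢ c))) (filter (_∈? U) (allFin h))

∈-fillings⁻ : ∀ (A : Subset m) {U : Subset h} {G} → G ∈ fillings A U → Filling A U G
∈-fillings⁻ [] (here refl) = []
∈-fillings⁻ (outside ∷ A) G∈ with _ , G∈ , refl ← ∈-map⁻ (nothing ∷_) G∈ = outside∷ (∈-fillings⁻ A G∈)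
∈-fillings⁻ {h = h} (inside ∷ A) {U} G∈
  with c , c∈ , G∈ ← find (∈-concatMap⁻ (λ c → map (just c ∷_) (fillings A (U -ˢ c)))
    {xs = filter (_∈? U) (allFin h)} G∈)
  with _ , G∈ , refl ← ∈-map⁻ (just c ∷_) G∈ =
  inside∷ (proj₂ (∈-filter⁻ (_∈? U) {xs = allFin h} c∈)) (∈-fillings⁻ A G∈)

∣flatten∣ : ∀ {A : Subset m} {U : Subset h} {G} → Filling A U G → ∣ flatten G ∣ ≡ ∣ A ∣
∣flatten∣ [] = refl
∣flatten∣ {h = h} (outside∷ {G = G} F) = trans (∣++∣ (⊥ {n = h}) (flatten G))
  (trans (cong (ℕ._+ ∣ flatten G ∣) (∣⊥∣≡0 h)) (∣flatten∣ F))
∣flatten∣ (inside∷ {G = G} {c = c} _ F) = trans (∣++∣ ⁅ c ⁆ (flatten G))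
  (trans (cong (ℕ._+ ∣ flatten G ∣) (∣⁅x⁆∣≡1 c)) (cong suc (∣flatten∣ F)))

x∉p-x : ∀ {p : Subset k} {x} → x ∉ˢ p -ˢ x
x∉p-x {p = p} {x} x∈ = x∈p─q⇒x∉q p ⁅ x ⁆ x∈ (x∈⁅x⁆ x)

++-⊆-marked⁻ʳ : ∀ {B : Subset h} {T} (cs : Vec (Fin h) m) S s c → B ++ T ⊆ marked (c ∷ cs) (s ∷ S) → T ⊆ marked cs S
++-⊆-marked⁻ʳ {B = B} cs S inside  c = ++-⊆⁻ʳ B ⁅ c ⁆
++-⊆-marked⁻ʳ {B = B} cs S outside c = ++-⊆⁻ʳ B ⊥

-- The statement on the range strengthens the induction: the colours of later points lie in
-- `U -ˢ c`, hence differ from the `c` just used.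
marked-sound : ∀ {A : Subset m} {U : Subset h} {G} cs S → Filling A U G → flatten G ⊆ marked cs S →
               (A ⊆ S × Rainbow cs A) × (∀ {i} → i ∈ˢ A → Vec.lookup cs i ∈ˢ U)
marked-sound [] [] [] _ = ((λ ()) , (λ _ ())) , λ ()
marked-sound {h = h} (c ∷ cs) (s ∷ S) (outside∷ {A = A} {G = G} F) G⊆
  with (A⊆S , rain) , range ← marked-sound cs S F (++-⊆-marked⁻ʳ cs S s c G⊆) =
  (out⊆ A⊆S , λ { (suc i) (there i∈) (suc j) (there j∈) eq → cong suc (rain i i∈ j j∈ eq) }) , λ { (there i∈) →
    range i∈ }
marked-sound {h = h} (c′ ∷ cs) (outside ∷ S) (inside∷ {c = c} c∈U F) G⊆ =
  contradiction (++-⊆⁻ˡ ⁅ c ⁆ ⊥ G⊆ (x∈⁅x⁆ c)) ∉⊥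
marked-sound {h = h} (c′ ∷ cs) (inside ∷ S) (inside∷ {A = A} {U = U} {c = c} c∈U F) G⊆
  with refl ← x∈⁅y⁆⇒x≡y c′ (++-⊆⁻ˡ ⁅ c ⁆ ⁅ c′ ⁆ G⊆ (x∈⁅x⁆ c))
  with (A⊆S , rain) , range ← marked-sound cs S F (++-⊆⁻ʳ ⁅ c ⁆ ⁅ c ⁆ G⊆) =
  (s⊆s A⊆S , rain′) , range′
  where
  fresh : ∀ {j} → j ∈ˢ A → c ≡ Vec.lookup cs j → ∀ {X : Set} → X
  fresh j∈ eq = contradiction (subst (_∈ˢ U -ˢ c) (sym eq) (range j∈)) x∉p-x
  rain′ : Rainbow (c ∷ cs) (inside ∷ A)
  rain′ zero    _          zero    _          _  = refl
  rain′ zero    _          (suc j) (there j∈) eq = fresh j∈ eq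
  rain′ (suc i) (there i∈) zero    _          eq = fresh i∈ (sym eq)
  rain′ (suc i) (there i∈) (suc j) (there j∈) eq = cong suc (rain i i∈ j j∈ eq)
  range′ : ∀ {i} → i ∈ˢ inside ∷ A → Vec.lookup (c ∷ cs) i ∈ˢ U
  range′ here       = c∈U
  range′ (there i∈) = p─q⊆p U ⁅ c ⁆ (range i∈)

-- For a subset of Ω × [h] given by its blocks, `base` is the projection to Ω and `hues` the
-- projection to [h].
base : Vec (Subset h) m → Subset m
base []       = []
base (B ∷ Bs) = does (nonempty? B) ∷ base Bs

hues : Vec (Subset h) m → Subset h
hues []       = ⊥
hues (B ∷ Bs) = B ∪ hues Bs

base-empty : ∀ {B : Subset h} (Bs : Vec (Subset h) m) → Empty B → base (B ∷ Bs) ≡ outside ∷ base Bs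
base-empty {B = B} Bs empty with nonempty? B
... | yes nonempty = contradiction nonempty empty
... | no _         = refl

base-nonempty : ∀ {B : Subset h} (Bs : Vec (Subset h) m) → Nonempty B → base (B ∷ Bs) ≡ inside ∷ base Bs
base-nonempty {B = B} Bs nonempty with nonempty? B
... | yes _    = refl
... | no empty = contradiction nonempty empty

-- Necessary conditions for a filling to contain `Bs`: it is a partial matching between A and U. The
-- two cardinality fields express that both projections are injective on it.
record Extends (A : Subset m) (U : Subset h) (Bs : Vec (Subset h) m) : Set where
  field
    base⊆ : base Bs ⊆ A
    ∣base∣ : ∣ base Bs ∣ ≡ ∣ concat Bs ∣
    hues⊆ : hues Bs ⊆ U
    ∣hues∣ : ∣ concat Bs ∣ ℕ.≤ ∣ hues Bs ∣

extends : ∀ {A : Subset m} {U : Subset h} {G} (Bs : Vec (Subset h) m) → Filling A U G →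
          concat Bs ⊆ flatten G → Extends A U Bs
extends {h = h} [] [] _ = record { base⊆ = λ () ; ∣base∣ = refl ; hues⊆ = ⊥⊆ ; ∣hues∣ = ℕ.z≤n }
extends {h = h} (B ∷ Bs) (outside∷ {A = A} {U = U} F) B⊆ with nonempty? B
... | yes (x , x∈B) = contradiction (++-⊆⁻ˡ B ⊥ B⊆ x∈B) ∉⊥
... | no empty = record
  { base⊆  = subst (_⊆ outside ∷ A) (sym (base-empty Bs empty)) (s⊆s E.base⊆)
  ; ∣base∣ = trans (cong ∣_∣ (base-empty Bs empty)) (trans E.∣base∣ (sym ∣B++∣))
  ; hues⊆  = ∪-lub {p = B} (λ x∈B → contradiction (_ , x∈B) empty) E.hues⊆
  ; ∣hues∣ = subst (ℕ._≤ ∣ B ∪ hues Bs ∣) (sym ∣B++∣) (ℕ.≤-trans E.∣hues∣ (∣q∣≤∣p∪q∣ B (hues Bs)))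
  }
  where
  module E = Extends (extends Bs F (++-⊆⁻ʳ B ⊥ B⊆))
  ∣B++∣ : ∣ B ++ concat Bs ∣ ≡ ∣ concat Bs ∣
  ∣B++∣ = trans (∣++∣ B (concat Bs)) (cong (ℕ._+ ∣ concat Bs ∣) (Empty⇒∣p∣≡0 empty))
extends {h = h} (B ∷ Bs) (inside∷ {A = A} {U = U} {c = c} c∈U F) B⊆ = record
  { base⊆  = base⊆′
  ; ∣base∣ = trans ∣base∣′ (sym (∣++∣ B (concat Bs)))
  ; hues⊆  = ∪-lub {p = B} (λ x∈B → subst (_∈ˢ U) (sym (x∈⁅y⁆⇒x≡y c (B⊆c x∈B))) c∈U) (λ x∈ → p─q⊆p U ⁅ c ⁆ (E.hues⊆ x∈))
  ; ∣hues∣ = ℕ.≤-trans (ℕ.≤-reflexive (∣++∣ B (concat Bs))) (ℕ.≤-trans (ℕ.+-monoʳ-≤ ∣ B ∣ E.∣hues∣)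
      (disjoint⇒∣∣+∣∣≤∣∪∣ B (hues Bs) (λ x∈B x∈ → x∈p─q⇒x∉q U ⁅ c ⁆ (E.hues⊆ x∈) (B⊆c x∈B))))
  }
  where
  module E = Extends (extends Bs F (++-⊆⁻ʳ B ⁅ c ⁆ B⊆))
  B⊆c : B ⊆ ⁅ c ⁆
  B⊆c = ++-⊆⁻ˡ B ⁅ c ⁆ B⊆
  base⊆′ : base (B ∷ Bs) ⊆ inside ∷ A
  base⊆′ {zero} _ = here
  base⊆′ {suc x} (there x∈) = there (E.base⊆ x∈)
  ∣base∣′ : ∣ base (B ∷ Bs) ∣ ≡ ∣ B ∣ ℕ.+ ∣ concat Bs ∣
  ∣base∣′ with nonempty? B
  ... | yes (x , x∈B) = trans (cong suc E.∣base∣) (cong (ℕ._+ ∣ concat Bs ∣) (sym (proj₂ (Nonempty∧⊆⁅⁆ x∈B B⊆c))))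
  ... | no empty = trans E.∣base∣ (cong (ℕ._+ ∣ concat Bs ∣) (sym (Empty⇒∣p∣≡0 empty)))

-- An equality for s ≤ u; beyond that, truncated subtraction makes the left side 0.
suc-∸-! : ∀ u s → (suc u ℕ.∸ s) ℕ.* ((u ℕ.∸ s) !) ℕ.≤ (suc u ℕ.∸ s) !
suc-∸-! u       zero    = ℕ.≤-refl
suc-∸-! zero    (suc s) = subst (ℕ._≤ (0 ℕ.∸ s) !) (sym (cong (ℕ._* 1) (ℕ.0∸n≡0 s))) ℕ.z≤n
suc-∸-! (suc u) (suc s) = suc-∸-! u s

module Colourings (K : OrderedSemiring) where

  open FiniteSums K
  open Percolation K
  open Sparsification K
  open Clutter K

  ∑-allFin-suc : (f : Fin (suc h) → R) → ∑ (allFin (suc h)) f ≈ f zero + ∑ (allFin h) (f ∘ suc)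
  ∑-allFin-suc {h} f = ≈-trans (∑-∷ zero _)
    (+-congˡ (≈-trans (≡⇒≈ (cong (λ xs → ∑ xs f) (sym (map-tabulate id suc)))) (∑-map f suc (allFin h))))

  ∑-∈ : (p : Subset h) → ∑ (allFin h) (λ c → [ c ∈? p ]) ≈ ∣ p ∣ · 1#
  ∑-∈ [] = ∑-[] _
  ∑-∈ (s ∷ p) = ≈-trans (∑-allFin-suc (λ c → [ c ∈? s ∷ p ]))
    (≈-trans (+-congˡ (≈-trans (∑-cong (allFin _)
      (λ c → []-cong (suc c ∈? s ∷ p) (c ∈? p) (λ { (there c∈) → c∈ }) there)) (∑-∈ p)))
      (first s))
    where
    first : ∀ s → [ zero ∈? s ∷ p ] + ∣ p ∣ · 1# ≈ ∣ s ∷ p ∣ · 1#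
    first inside  = ≈-refl
    first outside = +-identityˡ _

  ∑-fillings-inside : (f : PartialColouring (suc m) h → R) → ∀ (A : Subset m) U →
    ∑ (fillings (inside ∷ A) U) f ≈
    ∑ (allFin h) (λ c → [ c ∈? U ] * ∑ (fillings A (U -ˢ c)) (λ G → f (just c ∷ G)))
  ∑-fillings-inside {h = h} f A U = ≈-trans (∑-concatMap f _ (filter (_∈? U) (allFin h)))
    (≈-trans (∑-filter (_∈? U) (allFin h))
      (∑-cong (allFin h) (λ c → *-congˡ (∑-map f (just c ∷_) (fillings A (U -ˢ c))))))

  ∑-fillings-const : ∀ (A : Subset m) (U : Subset h) → ∣ A ∣ ≡ ∣ U ∣ → ∑ (fillings A U) (λ _ → 1#) ≈ (∣ U ∣ !) · 1#
  ∑-fillings-const [] U eq = ≈-trans (∑-∷ [] []) (≈-trans (+-congˡ (∑-[] _)) (·-cong (cong _! eq)))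
  ∑-fillings-const (outside ∷ A) U eq = ≈-trans (∑-map _ (nothing ∷_) (fillings A U)) (∑-fillings-const A U eq)
  ∑-fillings-const {h = h} (inside ∷ A) U eq = begin-equality
    ∑ (fillings (inside ∷ A) U) (λ _ → 1#)
      ≈⟨ ∑-fillings-inside (λ _ → 1#) A U ⟩
    ∑ (allFin h) (λ c → [ c ∈? U ] * ∑ (fillings A (U -ˢ c)) (λ _ → 1#))
      ≈⟨ ∑-cong (allFin h) (λ c → []*-cong (c ∈? U) (λ c∈U → ≈-trans (∑-fillings-const A (U -ˢ c) (shrink c∈U))
           (·-cong (cong _! (sym (shrink c∈U)))))) ⟩
    ∑ (allFin h) (λ c → [ c ∈? U ] * ((∣ A ∣ !) · 1#))
      ≈⟨ ≈-trans (∑-*ʳ _ (allFin h)) (*-cong (∑-∈ U) ≈-refl) ⟩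
    ∣ U ∣ · 1# * ((∣ A ∣ !) · 1#)
      ≈⟨ *-cong (·-cong (sym eq)) ≈-refl ⟩
    suc ∣ A ∣ · 1# * ((∣ A ∣ !) · 1#)
      ≈⟨ ×1-homo-* (suc ∣ A ∣) (∣ A ∣ !) ⟨
    (suc ∣ A ∣ !) · 1#
      ≈⟨ ·-cong (cong _! eq) ⟩
    (∣ U ∣ !) · 1# ∎
    where
    shrink : ∀ {c} → c ∈ˢ U → ∣ A ∣ ≡ ∣ U -ˢ c ∣
    shrink c∈U = ℕ.suc-injective (trans eq (sym (x∈p⇒1+∣p-x∣≡∣p∣ c∈U)))

  count : Subset m → Subset h → Vec (Subset h) m → R
  count A U Bs = ∑ (fillings A U) (λ G → [ concat Bs ⊆? flatten G ])

  count-zero : ∀ (A : Subset m) (U : Subset h) Bs → ¬ Extends A U Bs → count A U Bs ≈ 0#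
  count-zero A U Bs ¬ext = ≈-trans
    (∑-cong-∈ (fillings A U) (λ {G} G∈ → []-false (concat Bs ⊆? flatten G)
      (λ Bs⊆ → ¬ext (extends Bs (∈-fillings⁻ A G∈) Bs⊆))))
    (∑-zero (fillings A U))

  -- A bijection containing `Bs` is free only on the |U| - |Bs| unprescribed points. The induction
  -- fixes the colour of the first point: one choice if it is prescribed, otherwise any colour not
  -- reserved for later prescribed points.
  count-bound : ∀ (A : Subset m) (U : Subset h) Bs → ∣ A ∣ ≡ ∣ U ∣ →
                count A U Bs ≤ ((∣ U ∣ ℕ.∸ ∣ concat Bs ∣) !) · 1#
  count-bound [] U [] eq = ≤-trans (≤-reflexive (≈-trans (∑-∷ [] []) (≈-trans (+-congˡ (∑-[] _)) (+-identityʳ 1#))))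
    (≤-trans (≤-reflexive (≈-sym (+-identityʳ 1#))) (·-mono-≤ (ℕ.1≤n! (∣ U ∣))))
  count-bound {h = h} (outside ∷ A) U (B ∷ Bs) eq with nonempty? B
  ... | yes (x , x∈B) = ≤-trans (≤-reflexive (count-zero (outside ∷ A) U (B ∷ Bs) λ ext →
          in⊈out (subst (_⊆ outside ∷ A) (base-nonempty Bs (x , x∈B)) (Extends.base⊆ ext))))
            (·-nonneg ((∣ U ∣ ℕ.∸ ∣ B ++ concat Bs ∣) !))
  ... | no empty = begin
    count (outside ∷ A) U (B ∷ Bs)
      ≈⟨ ∑-map _ (nothing ∷_) (fillings A U) ⟩
    ∑ (fillings A U) (λ G → [ B ++ concat Bs ⊆? ⊥ ++ flatten G ])
      ≤⟨ ∑-mono (fillings A U) (λ G → []-mono (B ++ concat Bs ⊆? ⊥ ++ flatten G) (concat Bs ⊆? flatten G)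
        (++-⊆⁻ʳ B ⊥)) ⟩
    count A U Bs
      ≤⟨ count-bound A U Bs eq ⟩
    ((∣ U ∣ ℕ.∸ ∣ concat Bs ∣) !) · 1#
      ≈⟨ ·-cong (cong (λ s → (∣ U ∣ ℕ.∸ s) !)
        (trans (∣++∣ B (concat Bs)) (cong (ℕ._+ ∣ concat Bs ∣) (Empty⇒∣p∣≡0 empty)))) ⟨
    ((∣ U ∣ ℕ.∸ ∣ B ++ concat Bs ∣) !) · 1# ∎
  count-bound {suc m} {h} (inside ∷ A) U (B ∷ Bs) eq = by-head (nonempty? B)
    where
    s = ∣ concat Bs ∣
    D = hues Bs

    inner : Fin h → R
    inner c = ∑ (fillings A (U -ˢ c)) (λ G → [ B ++ concat Bs ⊆? ⁅ c ⁆ ++ flatten G ])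

    ∣A∣≡ : ∀ {c} → c ∈ˢ U → ∣ A ∣ ≡ ∣ U -ˢ c ∣
    ∣A∣≡ c∈U = ℕ.suc-injective (trans eq (sym (x∈p⇒1+∣p-x∣≡∣p∣ c∈U)))

    inner≤count : ∀ c → inner c ≤ count A (U -ˢ c) Bs
    inner≤count c = ∑-mono (fillings A (U -ˢ c)) (λ G →
      []-mono (B ++ concat Bs ⊆? ⁅ c ⁆ ++ flatten G) (concat Bs ⊆? flatten G) (++-⊆⁻ʳ B ⁅ c ⁆))

    inner≤! : ∀ {c} → c ∈ˢ U → inner c ≤ ((∣ A ∣ ℕ.∸ s) !) · 1#
    inner≤! {c} c∈U = ≤-trans (inner≤count c) (≤-trans (count-bound A (U -ˢ c) Bs (∣A∣≡ c∈U))
      (≤-reflexive (·-cong (cong (λ u → (u ℕ.∸ s) !) (sym (∣A∣≡ c∈U))))))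

    inner-zero : ∀ c → (∀ (G : PartialColouring m h) → ¬ (B ++ concat Bs ⊆ ⁅ c ⁆ ++ flatten G)) → inner c ≈ 0#
    inner-zero c ¬⊆ = ≈-trans (∑-cong (fillings A (U -ˢ c))
      (λ G → []-false (B ++ concat Bs ⊆? ⁅ c ⁆ ++ flatten G) (¬⊆ G)))
      (∑-zero (fillings A (U -ˢ c)))

    summed : ∀ P → (∀ c → [ c ∈? U ] * inner c ≤ [ c ∈? P ] * (((∣ A ∣ ℕ.∸ s) !) · 1#)) →
             count (inside ∷ A) U (B ∷ Bs) ≤ (∣ P ∣ ℕ.* ((∣ A ∣ ℕ.∸ s) !)) · 1#
    summed P termwise = begin
      count (inside ∷ A) U (B ∷ Bs)
        ≈⟨ ∑-fillings-inside (λ G → [ B ++ concat Bs ⊆? flatten G ]) A U ⟩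
      ∑ (allFin h) (λ c → [ c ∈? U ] * inner c)
        ≤⟨ ∑-mono (allFin h) termwise ⟩
      ∑ (allFin h) (λ c → [ c ∈? P ] * (((∣ A ∣ ℕ.∸ s) !) · 1#))
        ≈⟨ ≈-trans (∑-*ʳ _ (allFin h)) (*-cong (∑-∈ P) ≈-refl) ⟩
      ∣ P ∣ · 1# * (((∣ A ∣ ℕ.∸ s) !) · 1#)
        ≈⟨ ×1-homo-* ∣ P ∣ ((∣ A ∣ ℕ.∸ s) !) ⟨
      (∣ P ∣ ℕ.* ((∣ A ∣ ℕ.∸ s) !)) · 1# ∎

    vanishing : (∀ c → [ c ∈? U ] * inner c ≈ 0#) →
                count (inside ∷ A) U (B ∷ Bs) ≤ ((∣ U ∣ ℕ.∸ ∣ B ++ concat Bs ∣) !) · 1#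
    vanishing zeros = ≤-trans (≤-reflexive (≈-trans
      (∑-fillings-inside (λ G → [ B ++ concat Bs ⊆? flatten G ]) A U)
      (≈-trans (∑-cong (allFin h) zeros) (∑-zero (allFin h))))) (·-nonneg ((∣ U ∣ ℕ.∸ ∣ B ++ concat Bs ∣) !))

    by-head : Dec (Nonempty B) → count (inside ∷ A) U (B ∷ Bs) ≤ ((∣ U ∣ ℕ.∸ ∣ B ++ concat Bs ∣) !) · 1#
    by-head (yes (x , x∈B)) with ∣ B ∣ ℕ.≟ 1
    ... | no ∣B∣≢1 = vanishing λ c → ≈-trans (*-congˡ (inner-zero c (λ G ⊆G →
            ∣B∣≢1 (proj₂ (Nonempty∧⊆⁅⁆ x∈B (++-⊆⁻ˡ B ⁅ c ⁆ ⊆G)))))) (zeroʳ _)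
    ... | yes ∣B∣≡1 = ≤-trans (summed ⁅ x ⁆ termwise) (≤-reflexive (·-cong (trans
            (trans (cong (ℕ._* ((∣ A ∣ ℕ.∸ s) !)) (∣⁅x⁆∣≡1 x)) (ℕ.*-identityˡ _))
            (cong _! (trans (cong (suc ∣ A ∣ ℕ.∸_) (sym ∣B++∣)) (cong (ℕ._∸ ∣ B ++ concat Bs ∣) eq))))))
      where
      ∣B++∣ : ∣ B ++ concat Bs ∣ ≡ suc s
      ∣B++∣ = trans (∣++∣ B (concat Bs)) (cong (ℕ._+ s) ∣B∣≡1)
      termwise : ∀ c → [ c ∈? U ] * inner c ≤ [ c ∈? ⁅ x ⁆ ] * (((∣ A ∣ ℕ.∸ s) !) · 1#)
      termwise c with c ∈? ⁅ x ⁆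
      ... | yes _ = ≤-trans ([]*≤-if (c ∈? U) (·-nonneg ((∣ A ∣ ℕ.∸ s) !)) inner≤!)
        (≤-reflexive (≈-sym (*-identityˡ _)))
      ... | no c∉ = ≤-reflexive (≈-trans (*-congˡ (inner-zero c (λ G ⊆G →
              c∉ (subst (_∈ˢ ⁅ x ⁆) (proj₁ (Nonempty∧⊆⁅⁆ x∈B (++-⊆⁻ˡ B ⁅ c ⁆ ⊆G))) (x∈⁅x⁆ x)))))
              (≈-trans (zeroʳ _) (≈-sym (zeroˡ _))))
    by-head (no empty) with (D ⊆? U) ×-dec (s ℕ.≤? ∣ D ∣)
    ... | no ¬ext = vanishing λ c → ≈-trans
      ([]*-cong (c ∈? U) (λ c∈U → antisym-0
      (∑-nonneg (fillings A (U -ˢ c)) (λ G → []-nonneg (B ++ concat Bs ⊆? ⁅ c ⁆ ++ flatten G)))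
            (≤-trans (inner≤count c) (≤-reflexive (count-zero A (U -ˢ c) Bs
              (λ ext → ¬ext ((λ x∈ → p─q⊆p U ⁅ c ⁆ (Extends.hues⊆ ext x∈)) , Extends.∣hues∣ ext))))))) (zeroʳ _)
    -- The s prescribed pairs to come use distinct colours, all in `D`, so at most |U| - s colours
    -- are left for this free point.
    ... | yes (D⊆U , s≤∣D∣) = ≤-trans (summed (U ─ D) termwise) (·-mono-≤ (ℕ.≤-trans
            (ℕ.*-monoˡ-≤ ((∣ A ∣ ℕ.∸ s) !) ∣U─D∣≤)
            (subst (λ s′ → (suc ∣ A ∣ ℕ.∸ s) ℕ.* ((∣ A ∣ ℕ.∸ s) !) ℕ.≤ (∣ U ∣ ℕ.∸ s′) !) (sym ∣B++∣)
              (subst (λ u → (suc ∣ A ∣ ℕ.∸ s) ℕ.* ((∣ A ∣ ℕ.∸ s) !) ℕ.≤ (u ℕ.∸ s) !) eq (suc-∸-! ∣ A ∣ s)))))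
      where
      ∣B++∣ : ∣ B ++ concat Bs ∣ ≡ s
      ∣B++∣ = trans (∣++∣ B (concat Bs)) (cong (ℕ._+ s) (Empty⇒∣p∣≡0 empty))
      ∣U─D∣≤ : ∣ U ─ D ∣ ℕ.≤ suc ∣ A ∣ ℕ.∸ s
      ∣U─D∣≤ = subst (λ u → ∣ U ─ D ∣ ℕ.≤ u ℕ.∸ s) (sym eq) (ℕ.m+n≤o⇒m≤o∸n ∣ U ─ D ∣
        (ℕ.≤-trans (ℕ.+-monoʳ-≤ ∣ U ─ D ∣ s≤∣D∣) (ℕ.≤-trans (disjoint⇒∣∣+∣∣≤∣∪∣ (U ─ D) D (x∈p─q⇒x∉q U D))
          (p⊆q⇒∣p∣≤∣q∣ (∪-lub {p = U ─ D} (p─q⊆p U D) D⊆U)))))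
      termwise : ∀ c → [ c ∈? U ] * inner c ≤ [ c ∈? U ─ D ] * (((∣ A ∣ ℕ.∸ s) !) · 1#)
      termwise c with c ∈? D
      ... | no c∉D = ≤-trans ([]*-mono (c ∈? U) inner≤!) (*-monoʳ-≤ (·-nonneg ((∣ A ∣ ℕ.∸ s) !))
              ([]-mono (c ∈? U) (c ∈? U ─ D) (λ c∈U → x∈p∧x∉q⇒x∈p─q c∈U c∉D)))
      ... | yes c∈D = ≤-trans ([]*≤-if (c ∈? U) ≤-refl
        (λ _ → ≤-trans (inner≤count c) (≤-reflexive (count-zero A (U -ˢ c) Bs
              (λ ext → x∉p-x {p = U} (Extends.hues⊆ ext c∈D)))))) ([]*-nonneg (c ∈? U ─ D) (·-nonneg ((∣ A ∣ ℕ.∸ s) !)))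

-- Elementary estimates for powers and factorials

module _ where
  open import Data.Nat.Base using (_+_; _*_; _^_; _∸_; _≤_)
  open ℕ.≤-Reasoning
  open ℕ.+-*-Solver

  -- Bernoulli's inequality (1 - 1/(n+1))^j ≥ 1 - j/(n+1), cleared of denominators.
  bernoulli-inequality : ∀ n j → (suc n ∸ j) * suc n ^ j ≤ suc n * n ^ j
  bernoulli-inequality n zero    = ℕ.≤-refl
  bernoulli-inequality n (suc j) = begin
    (n ∸ j) * (suc n * suc n ^ j)
      ≡⟨ ℕ.*-assoc (n ∸ j) (suc n) _ ⟨
    (n ∸ j) * suc n * suc n ^ j
      ≤⟨ ℕ.*-monoˡ-≤ (suc n ^ j) step ⟩
    n * (suc n ∸ j) * suc n ^ j
      ≡⟨ ℕ.*-assoc n (suc n ∸ j) _ ⟩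
    n * ((suc n ∸ j) * suc n ^ j)
      ≤⟨ ℕ.*-monoʳ-≤ n (bernoulli-inequality n j) ⟩
    n * (suc n * n ^ j)
      ≡⟨ solve 3 (λ n m x → n :* (m :* x) := m :* (n :* x)) refl n (suc n) (n ^ j) ⟩
    suc n * (n * n ^ j) ∎
    where
    step : (n ∸ j) * suc n ≤ n * (suc n ∸ j)
    step with j ℕ.≤? n
    ... | no j≰n = subst (λ d → d * suc n ≤ n * (suc n ∸ j)) (sym (ℕ.m≤n⇒m∸n≡0 (ℕ.≰⇒≥ j≰n))) ℕ.z≤n
    ... | yes j≤n = begin
      (n ∸ j) * suc n ≡⟨ ℕ.*-suc (n ∸ j) n ⟩
      n ∸ j + (n ∸ j) * n ≤⟨ ℕ.+-monoˡ-≤ _ (ℕ.m∸n≤m n j) ⟩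
      n + (n ∸ j) * n ≡⟨ cong (n +_) (ℕ.*-comm (n ∸ j) n) ⟩
      n + n * (n ∸ j) ≡⟨ ℕ.*-suc n (n ∸ j) ⟨
      n * suc (n ∸ j) ≡⟨ cong (n *_) (ℕ.+-∸-assoc 1 j≤n) ⟨
      n * (suc n ∸ j) ∎

  [1+n]^j≤2n^j : ∀ n j → 2 * j ≤ suc n → suc n ^ j ≤ 2 * n ^ j
  [1+n]^j≤2n^j n j 2j≤ = ℕ.*-cancelˡ-≤ (suc n) (begin
    suc n * suc n ^ j
      ≤⟨ ℕ.*-monoˡ-≤ (suc n ^ j) half ⟩
    2 * (suc n ∸ j) * suc n ^ j
      ≡⟨ ℕ.*-assoc 2 (suc n ∸ j) _ ⟩
    2 * ((suc n ∸ j) * suc n ^ j)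
      ≤⟨ ℕ.*-monoʳ-≤ 2 (bernoulli-inequality n j) ⟩
    2 * (suc n * n ^ j)
      ≡⟨ solve 2 (λ m x → con 2 :* (m :* x) := m :* (con 2 :* x)) refl (suc n) (n ^ j) ⟩
    suc n * (2 * n ^ j) ∎)
    where
    half : suc n ≤ 2 * (suc n ∸ j)
    half = ℕ.+-cancelʳ-≤ (2 * j) _ _ (begin
      suc n + 2 * j ≤⟨ ℕ.+-monoʳ-≤ (suc n) 2j≤ ⟩
      suc n + suc n ≡⟨ solve 1 (λ m → m :+ m := con 2 :* m) refl (suc n) ⟩
      2 * suc n ≡⟨ cong (2 *_) (ℕ.m∸n+n≡m (ℕ.≤-trans (ℕ.m≤m+n j (j + 0)) 2j≤)) ⟨
      2 * (suc n ∸ j + j) ≡⟨ ℕ.*-distribˡ-+ 2 (suc n ∸ j) j ⟩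
      2 * (suc n ∸ j) + 2 * j ∎)

  2⌊n/2⌋≤n : ∀ n → 2 * ⌊ n /2⌋ ≤ n
  2⌊n/2⌋≤n n = begin
    2 * ⌊ n /2⌋ ≡⟨ solve 1 (λ m → con 2 :* m := m :+ m) refl ⌊ n /2⌋ ⟩
    ⌊ n /2⌋ + ⌊ n /2⌋ ≤⟨ ℕ.+-monoʳ-≤ ⌊ n /2⌋ (ℕ.⌊n/2⌋≤⌈n/2⌉ n) ⟩
    ⌊ n /2⌋ + ⌈ n /2⌉ ≡⟨ ℕ.⌊n/2⌋+⌈n/2⌉≡n n ⟩
    n ∎

  -- An integral substitute for (1 + 1/n)^n ≤ e: Bernoulli's inequality loses a factor 2 on each
  -- half of the exponent.
  [1+n]^t≤4n^t : ∀ n t → t ≤ n → suc n ^ t ≤ 4 * n ^ t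
  [1+n]^t≤4n^t n t t≤n = begin
    suc n ^ t
      ≡⟨ cong (suc n ^_) (ℕ.⌊n/2⌋+⌈n/2⌉≡n t) ⟨
    suc n ^ (⌊ t /2⌋ + ⌈ t /2⌉)
      ≡⟨ ℕ.^-distribˡ-+-* (suc n) ⌊ t /2⌋ ⌈ t /2⌉ ⟩
    suc n ^ ⌊ t /2⌋ * suc n ^ ⌈ t /2⌉
      ≤⟨ ℕ.*-mono-≤ ([1+n]^j≤2n^j n ⌊ t /2⌋ (ℕ.≤-trans (2⌊n/2⌋≤n t) (ℕ.m≤n⇒m≤1+n t≤n)))
                    ([1+n]^j≤2n^j n ⌈ t /2⌉ (ℕ.≤-trans (2⌊n/2⌋≤n (suc t)) (ℕ.s≤s t≤n))) ⟩
    (2 * n ^ ⌊ t /2⌋) * (2 * n ^ ⌈ t /2⌉)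
      ≡⟨ solve 2 (λ a b → (con 2 :* a) :* (con 2 :* b) := con 4 :* (a :* b)) refl (n ^ ⌊ t /2⌋) (n ^ ⌈ t /2⌉) ⟩
    4 * (n ^ ⌊ t /2⌋ * n ^ ⌈ t /2⌉)
      ≡⟨ cong (4 *_) (ℕ.^-distribˡ-+-* n ⌊ t /2⌋ ⌈ t /2⌉) ⟨
    4 * n ^ (⌊ t /2⌋ + ⌈ t /2⌉)
      ≡⟨ cong (λ k → 4 * n ^ k) (ℕ.⌊n/2⌋+⌈n/2⌉≡n t) ⟩
    4 * n ^ t ∎

  -- Induction lowering h and s together; replacing the base h by h - 1 in the remaining power costs
  -- one factor 4.
  h^s[h-s]!≤4^sh! : ∀ h s → s ≤ h → h ^ s * (h ∸ s) ! ≤ 4 ^ s * h !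
  h^s[h-s]!≤4^sh! h       zero    _ = ℕ.≤-refl
  h^s[h-s]!≤4^sh! (suc n) (suc t) (ℕ.s≤s t≤n) = begin
    suc n * suc n ^ t * (n ∸ t) !
      ≡⟨ ℕ.*-assoc (suc n) (suc n ^ t) _ ⟩
    suc n * (suc n ^ t * (n ∸ t) !)
      ≤⟨ ℕ.*-monoʳ-≤ (suc n) (ℕ.*-monoˡ-≤ ((n ∸ t) !) ([1+n]^t≤4n^t n t t≤n)) ⟩
    suc n * (4 * n ^ t * (n ∸ t) !)
      ≡⟨ cong (suc n *_) (ℕ.*-assoc 4 (n ^ t) _) ⟩
    suc n * (4 * (n ^ t * (n ∸ t) !))
      ≤⟨ ℕ.*-monoʳ-≤ (suc n) (ℕ.*-monoʳ-≤ 4 (h^s[h-s]!≤4^sh! n t t≤n)) ⟩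
    suc n * (4 * (4 ^ t * n !))
      ≡⟨ solve 3 (λ m x y → m :* (con 4 :* (x :* y)) := con 4 :* x :* (m :* y)) refl (suc n) (4 ^ t) (n !) ⟩
    4 * 4 ^ t * (suc n * n !) ∎

  -- Dominates the doubly exponentially small losses of the rounds by a geometric series.
  s+1+k≤s*2^[1+k] : ∀ s k → 1 ≤ s → s + suc k ≤ s * 2 ^ suc k
  s+1+k≤s*2^[1+k] s@(suc s′) zero 1≤s = begin
    s + 1 ≤⟨ ℕ.+-monoʳ-≤ s 1≤s ⟩
    s + s ≡⟨ solve 1 (λ s → s :+ s := s :* con 2) refl s ⟩
    s * 2 ∎
  s+1+k≤s*2^[1+k] s@(suc s′) (suc k) 1≤s = begin
    s + suc (suc k) ≡⟨ ℕ.+-suc s (suc k) ⟩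
    suc (s + suc k) ≤⟨ ℕ.+-monoˡ-≤ (s + suc k) {1} (ℕ.s≤s ℕ.z≤n) ⟩
    (s + suc k) + (s + suc k) ≤⟨ ℕ.+-mono-≤ ih ih ⟩
    s * 2 ^ suc k + s * 2 ^ suc k ≡⟨ solve 2 (λ s x → s :* x :+ s :* x := s :* (con 2 :* x)) refl s (2 ^ suc k) ⟩
    s * 2 ^ suc (suc k) ∎
    where ih = s+1+k≤s*2^[1+k] s k 1≤s

-- The spread weight on bijectively coloured members

module ColouredFamily (K : OrderedSemiring) where

  open FiniteSums K
  open Percolation K
  open Sparsification K
  open Clutter K
  open Colourings K

  ·-homo-^ : ∀ n s → (n · 1#) ^ s ≈ (n ℕ.^ s) · 1#
  ·-homo-^ n zero    = ≈-sym (+-identityʳ 1#)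
  ·-homo-^ n (suc s) = ≈-trans (*-congˡ (·-homo-^ n s)) (≈-sym (×1-homo-* n (n ℕ.^ s)))

  1^ : ∀ s → 1# ^ s ≈ 1#
  1^ zero    = ≈-refl
  1^ (suc s) = ≈-trans (*-identityˡ _) (1^ s)

  module _ {m h : ℕ} (𝒜 : Family m) (uniform : 𝒜 IsUniform h)
           (μ : Subset m → R) (μ≥0 : ∀ A → 0# ≤ μ A) where

    members : List (Subset m)
    members = filter (λ A → T? (𝒜 A)) (subsets m)

    Coloured : Set
    Coloured = Subset m × PartialColouring m h

    coloured : List Coloured
    coloured = concatMap (λ A → map (A ,_) (fillings A ⊤)) members

    points : Coloured → Subset (m ℕ.* h)
    points (A , G) = flatten G

    member⁻ : ∀ {A} → A ∈ members → T (𝒜 A)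
    member⁻ A∈ = proj₂ (∈-filter⁻ (λ A → T? (𝒜 A)) {xs = subsets m} A∈)

    coloured⁻ : ∀ {A G} → (A , G) ∈ coloured → T (𝒜 A) × Filling A ⊤ G
    coloured⁻ j∈ with A , A∈ , j∈ ← find (∈-concatMap⁻ (λ A → map (A ,_) (fillings A ⊤)) {xs = members} j∈)
                 with G , G∈ , refl ← ∈-map⁻ (A ,_) j∈ = member⁻ A∈ , ∈-fillings⁻ A G∈

    ∣points∣ : ∀ {j} → j ∈ coloured → ∣ points j ∣ ≡ h
    ∣points∣ {A , G} j∈ = let A∈𝒜 , F = coloured⁻ j∈ in trans (∣flatten∣ F) (uniform A A∈𝒜)

    ∑-coloured : ∀ f → ∑ coloured f ≈ ∑ members (λ A → ∑ (fillings A ⊤) (λ G → f (A , G)))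
    ∑-coloured f = ≈-trans (∑-concatMap f _ members) (∑-cong members (λ A → ∑-map f (A ,_) (fillings A ⊤)))

    module _ {u v : R} (u≥0 : 0# ≤ u) (v≥0 : 0# ≤ v) (u-inverse : u * (h · 1#) ≈ 1#)
      (v-inverse : v * ((h !) · 1#) ≈ 1#) where

      -- Since v = 1/h!, the mass of a member is shared equally among its h! bijective colourings.
      weight : Coloured → R
      weight (A , G) = μ A * v

      weight≥0 : ∀ j → 0# ≤ weight j
      weight≥0 (A , G) = *-nonneg (μ≥0 A) v≥0

      ∑-weight : ∑ coloured weight ≈ ∑ members μ
      ∑-weight = ≈-trans (∑-coloured weight) (∑-cong-∈ members (λ {A} A∈ → begin-equality
        ∑ (fillings A ⊤) (λ _ → μ A * v)
          ≈⟨ ∑-cong (fillings A ⊤) (λ _ → *-identityʳ _) ⟨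
        ∑ (fillings A ⊤) (λ _ → μ A * v * 1#)
          ≈⟨ ∑-*ˡ (μ A * v) (fillings A ⊤) ⟩
        μ A * v * ∑ (fillings A ⊤) (λ _ → 1#)
          ≈⟨ *-congˡ (≈-trans (∑-fillings-const A ⊤ (trans (uniform A (member⁻ A∈)) (sym (∣⊤∣≡n h))))
            (·-cong (cong _! (∣⊤∣≡n h)))) ⟩
        μ A * v * ((h !) · 1#)
          ≈⟨ ≈-trans (*-assoc _ _ _) (≈-trans (*-congˡ v-inverse) (*-identityʳ (μ A))) ⟩
        μ A ∎))

      -- The left side bounds the chance (h - s)!/h! that a random bijection contains s prescribed
      -- pairs. Inserting (u h)^s = 1 reduces the claim to the integral inequality
      -- `h^s[h-s]!≤4^sh!`.
      permutation-spread : ∀ s → s ℕ.≤ h → v * (((h ℕ.∸ s) !) · 1#) ≤ (4 · 1# * u) ^ s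
      permutation-spread s s≤h = begin
        v * (((h ℕ.∸ s) !) · 1#)
          ≈⟨ ≈-trans (*-congˡ (≈-trans (^-congˡ s u-inverse) (1^ s))) (*-identityʳ _) ⟨
        v * (((h ℕ.∸ s) !) · 1#) * (u * (h · 1#)) ^ s
          ≈⟨ *-congˡ (≈-trans (^-distrib-* u (h · 1#) s) (*-congˡ (·-homo-^ h s))) ⟩
        v * (((h ℕ.∸ s) !) · 1#) * (u ^ s * ((h ℕ.^ s) · 1#))
          ≈⟨ solve 4 (λ v a b c → v :* a :* (b :* c) := v :* b :* (c :* a)) ≈-refl v (((h ℕ.∸ s) !) · 1#)
            (u ^ s) ((h ℕ.^ s) · 1#) ⟩
        v * u ^ s * ((h ℕ.^ s) · 1# * (((h ℕ.∸ s) !) · 1#))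
          ≈⟨ *-congˡ (×1-homo-* (h ℕ.^ s) ((h ℕ.∸ s) !)) ⟨
        v * u ^ s * ((h ℕ.^ s ℕ.* (h ℕ.∸ s) !) · 1#)
          ≤⟨ *-monoˡ-≤ (*-nonneg v≥0 (^-nonneg u≥0 s)) (·-mono-≤ (h^s[h-s]!≤4^sh! h s s≤h)) ⟩
        v * u ^ s * ((4 ℕ.^ s ℕ.* h !) · 1#)
          ≈⟨ *-congˡ (×1-homo-* (4 ℕ.^ s) (h !)) ⟩
        v * u ^ s * ((4 ℕ.^ s) · 1# * ((h !) · 1#))
          ≈⟨ solve 4 (λ v b c d → v :* b :* (c :* d) := (c :* b) :* (v :* d)) ≈-refl v (u ^ s) ((4 ℕ.^ s) · 1#)
            ((h !) · 1#) ⟩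
        (4 ℕ.^ s) · 1# * u ^ s * (v * ((h !) · 1#))
          ≈⟨ ≈-trans (*-congˡ v-inverse) (*-identityʳ _) ⟩
        (4 ℕ.^ s) · 1# * u ^ s
          ≈⟨ *-cong (·-homo-^ 4 s) ≈-refl ⟨
        (4 · 1#) ^ s * u ^ s
          ≈⟨ ^-distrib-* (4 · 1#) u s ⟨
        (4 · 1# * u) ^ s ∎

      module _ {q : R} (q≥0 : 0# ≤ q) (spread : ∀ S → ∑ members (λ A → μ A * [ S ⊆? A ]) ≤ q ^ ∣ S ∣) where

        -- The base of `Bs` costs q^s by the spread of μ, and its colours cost (4/h)^s by
        -- `permutation-spread`. If `Bs` is not a partial matching, nothing contains it; for a
        -- matching the base has exactly s points, so no power of q is lost.
        coloured-spread-concat : ∀ (Bs : Vec (Subset h) m) →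
          ∑ coloured (λ j → weight j * [ concat Bs ⊆? points j ]) ≤ (4 · 1# * u * q) ^ ∣ concat Bs ∣
        coloured-spread-concat Bs = begin
          ∑ coloured (λ j → weight j * [ concat Bs ⊆? points j ])
            ≈⟨ ≈-trans (∑-coloured _) (∑-cong members (λ A → ∑-*ˡ (μ A * v) (fillings A ⊤))) ⟩
          ∑ members (λ A → μ A * v * count A ⊤ Bs)
            ≤⟨ by-size (s ℕ.≤? h) (∣ base Bs ∣ ℕ.≟ s) ⟩
          (4 · 1# * u * q) ^ s ∎
          where
          s = ∣ concat Bs ∣
          B≥0 : 0# ≤ (4 · 1# * u * q) ^ s
          B≥0 = ^-nonneg (*-nonneg (*-nonneg (·-nonneg 4) u≥0) q≥0) s
          vanishing : (∀ A → ¬ Extends A ⊤ Bs) → ∑ members (λ A → μ A * v * count A ⊤ Bs) ≤ (4 · 1# * u * q) ^ s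
          vanishing ¬ext = ≤-trans (≤-reflexive (≈-trans (∑-cong members (λ A →
            ≈-trans (*-congˡ (count-zero A ⊤ Bs (¬ext A))) (zeroʳ _))) (∑-zero members))) B≥0
          by-size : Dec (s ℕ.≤ h) → Dec (∣ base Bs ∣ ≡ s) → ∑ members (λ A → μ A * v * count A ⊤ Bs) ≤
            (4 · 1# * u * q) ^ s
          by-size (no s≰h) _ = vanishing λ A ext → s≰h (ℕ.≤-trans (Extends.∣hues∣ ext)
            (subst (∣ hues Bs ∣ ℕ.≤_) (∣⊤∣≡n h) (p⊆q⇒∣p∣≤∣q∣ (Extends.hues⊆ ext))))
          by-size (yes _) (no ∣base∣≢s) = vanishing λ A ext → ∣base∣≢s (Extends.∣base∣ ext)
          by-size (yes s≤h) (yes ∣base∣≡s) = begin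
            ∑ members (λ A → μ A * v * count A ⊤ Bs)
              ≤⟨ ∑-mono-∈ members (λ {A} A∈ → *-monoˡ-≤ (*-nonneg (μ≥0 A) v≥0) (count≤ A (member⁻ A∈))) ⟩
            ∑ members (λ A → μ A * v * ([ base Bs ⊆? A ] * (((h ℕ.∸ s) !) · 1#)))
              ≈⟨ ∑-cong members (λ A → solve 4 (λ a v b c → a :* v :* (b :* c) := v :* c :* (a :* b)) ≈-refl
                   (μ A) v [ base Bs ⊆? A ] (((h ℕ.∸ s) !) · 1#)) ⟩
            ∑ members (λ A → v * (((h ℕ.∸ s) !) · 1#) * (μ A * [ base Bs ⊆? A ]))
              ≈⟨ ∑-*ˡ _ members ⟩
            v * (((h ℕ.∸ s) !) · 1#) * ∑ members (λ A → μ A * [ base Bs ⊆? A ])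
              ≤⟨ *-mono-≤ (∑-nonneg members (λ A → *-nonneg (μ≥0 A) ([]-nonneg (base Bs ⊆? A))))
                   (^-nonneg (*-nonneg (·-nonneg 4) u≥0) s) (permutation-spread s s≤h)
                   (≤-trans (spread (base Bs)) (≤-reflexive (≡⇒≈ (cong (q ^_) ∣base∣≡s)))) ⟩
            (4 · 1# * u) ^ s * q ^ s
              ≈⟨ ^-distrib-* (4 · 1# * u) q s ⟨
            (4 · 1# * u * q) ^ s ∎
            where
            count≤ : ∀ A → T (𝒜 A) → count A ⊤ Bs ≤ [ base Bs ⊆? A ] * (((h ℕ.∸ s) !) · 1#)
            count≤ A A∈𝒜 with base Bs ⊆? A
            ... | yes _ = ≤-trans (count-bound A ⊤ Bs (trans (uniform A A∈𝒜) (sym (∣⊤∣≡n h))))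
                            (≤-trans (≤-reflexive (·-cong (cong (λ k → (k ℕ.∸ s) !) (∣⊤∣≡n h))))
                              (≤-reflexive (≈-sym (*-identityˡ _))))
            ... | no base⊈ = ≤-reflexive (≈-trans (count-zero A ⊤ Bs (λ ext → base⊈ (Extends.base⊆ ext)))
              (≈-sym (zeroˡ _)))

        coloured-spread : IsSpreadWeight weight weight≥0 (4 · 1# * u * q) points coloured
        coloured-spread S with Bs , refl ← Vec.group m h S = coloured-spread-concat Bs

-- Choice of densities and summation of the losses

module Threshold (K : OrderedSemiring) where

  open FiniteSums K
  open Percolation K
  open Sparsification K
  open Clutter K
  open Colourings K
  open ColouredFamily K

  ½ : R
  ½ = 1/suc 1

  ½≥0 : 0# ≤ ½
  ½≥0 = 0≤1/suc 1

  1/suc≤1 : ∀ n → 1/suc n ≤ 1#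
  1/suc≤1 n = begin
    1/suc n ≈⟨ *-identityʳ _ ⟨
    1/suc n * 1# ≤⟨ *-monoˡ-≤ (0≤1/suc n) (x≤x+y (·-nonneg n)) ⟩
    1/suc n * (suc n · 1#)  ≈⟨ 1/suc-inverse n ⟩
    1# ∎

  ½+½ : ∀ {x} → ½ * x + ½ * x ≈ x
  ½+½ {x} = ≈-trans (solve 2 (λ H x → H :* x :+ H :* x := (H :* (con 1 :+ (con 1 :+ con 0))) :* x) ≈-refl ½ x)
    (≈-trans (*-cong (1/suc-inverse 1) ≈-refl) (*-identityˡ x))

  ½^-cancel : ∀ n → (2 ℕ.^ n) · 1# * ½ ^ n ≈ 1#
  ½^-cancel n = ≈-trans (*-cong (≈-sym (·-homo-^ 2 n)) ≈-refl)
    (≈-trans (≈-sym (^-distrib-* (2 · 1#) ½ n))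
      (≈-trans (^-congˡ n (≈-trans (*-comm _ _) (1/suc-inverse 1))) (1^ n)))

  2^*½^ : ∀ n k → (2 ℕ.^ n) · 1# * ½ ^ (n ℕ.+ k) ≈ ½ ^ k
  2^*½^ n k = ≈-trans (*-congˡ (^-homo-* ½ n k))
    (≈-trans (≈-sym (*-assoc _ _ _)) (≈-trans (*-cong (½^-cancel n) ≈-refl) (*-identityˡ _)))

  ^-^ : ∀ x m n → (x ^ m) ^ n ≈ x ^ (n ℕ.* m)
  ^-^ x m zero    = ≈-refl
  ^-^ x m (suc n) = ≈-trans (*-congˡ (^-^ x m n)) (≈-sym (^-homo-* x m (n ℕ.* m)))

  module _ {m h′ : ℕ} (𝒜 : Family m) (uniform : 𝒜 IsUniform suc h′)
           (μ : Subset m → R) (μ≥0 : ∀ A → 0# ≤ μ A)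
           {q : R} (q≥0 : 0# ≤ q)
           (mass : ∑ (members 𝒜 uniform μ μ≥0) μ ≈ 1#)
           (spread : ∀ S → ∑ (members 𝒜 uniform μ μ≥0) (λ A → μ A * [ S ⊆? A ]) ≤ q ^ ∣ S ∣)
           {ρ ρ̄ : R} (ρ-bernoulli : IsBernoulli ρ ρ̄)
           (s : ℕ) (1≤s : 1 ℕ.≤ s) (r : ℕ) (4^s≤1+r : 4 ℕ.^ s ℕ.≤ suc r) (h≤s2^[1+r] : suc h′ ℕ.≤ s ℕ.* 2 ℕ.^ suc r)
           (dense : (128 ℕ.* suc r) · 1# * q ≤ ρ) where

    private
      open IsBernoulli ρ-bernoulli renaming (p≥0 to ρ≥0; p̄≥0 to ρ̄≥0; total to ρ+ρ̄≈1)
      H = suc h′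
      u = 1/suc h′
      1/R = 1/suc r
      u≥0 = 0≤1/suc h′
      1/R≥0 = 0≤1/suc r

      v : R
      v = 1/suc (ℕ.pred (H !))

      v-inverse : v * ((H !) · 1#) ≈ 1#
      v-inverse = ≈-trans (*-congˡ (·-cong (sym (ℕ.suc-pred (H !) {{ℕ._!≢0 H}})))) (1/suc-inverse (ℕ.pred (H !)))

      -- With R = r + 1: R rounds of density ρ/(2hR) and one of density ρ/(2h) add up to ρ/h. Both
      -- products `θ * p₁` and `θ₂ * p₂` equal ρ/(32hR), and q′ = 4q/h is at most this because 128Rq
      -- ≤ ρ. The complement π̄ is 1 - ρ/h written without subtraction.
      p₁ p₂ θ θ₂ π̄ q′ : R
      p₁ = ρ * u * (½ * 1/R)
      p₂ = ρ * u * ½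
      θ  = ½ ^ 4
      θ₂ = ½ ^ 4 * 1/R
      π̄  = ρ̄ + ρ * (u * (h′ · 1#))
      q′ = 4 · 1# * u * q

      ρu≥0 : 0# ≤ ρ * u
      ρu≥0 = *-nonneg ρ≥0 u≥0
      p₁≥0 : 0# ≤ p₁
      p₁≥0 = *-nonneg ρu≥0 (*-nonneg ½≥0 1/R≥0)
      p₂≥0 : 0# ≤ p₂
      p₂≥0 = *-nonneg ρu≥0 ½≥0
      π̄≥0 : 0# ≤ π̄
      π̄≥0 = +-nonneg ρ̄≥0 (*-nonneg ρ≥0 (*-nonneg u≥0 (·-nonneg h′)))
      q′≥0 : 0# ≤ q′
      q′≥0 = *-nonneg (*-nonneg (·-nonneg 4) u≥0) q≥0
      θ≥0 : 0# ≤ θ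
      θ≥0 = ^-nonneg ½≥0 4
      θ≤1 : θ ≤ 1#
      θ≤1 = ^-antitone ½≥0 (1/suc≤1 1) {0} {4} ℕ.z≤n
      θ₂≥0 : 0# ≤ θ₂
      θ₂≥0 = *-nonneg θ≥0 1/R≥0
      θ₂≤1 : θ₂ ≤ 1#
      θ₂≤1 = ≤-trans (*-mono-≤ 1/R≥0 0≤1 θ≤1 (1/suc≤1 r)) (≤-reflexive (*-identityˡ 1#))

      q′≤ : q′ ≤ ½ ^ 5 * 1/R * (ρ * u)
      q′≤ = begin
        4 · 1# * u * q
          ≈⟨ ≈-trans (*-cong (2^*½^ 5 0) ≈-refl) (*-identityˡ _) ⟨
        (2 ℕ.^ 5) · 1# * ½ ^ 5 * (4 · 1# * u * q)
          ≈⟨ ≈-trans (*-congˡ (1/suc-inverse r)) (*-identityʳ _) ⟨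
        (2 ℕ.^ 5) · 1# * ½ ^ 5 * (4 · 1# * u * q) * (1/R * (suc r · 1#))
          ≈⟨ solve 7 (λ a b c u q d e → a :* b :* (c :* u :* q) :* (d :* e) := (a :* c :* e :* q) :*
            (b :* d :* u)) ≈-refl
               ((2 ℕ.^ 5) · 1#) (½ ^ 5) (4 · 1#) u q 1/R (suc r · 1#) ⟩
        (2 ℕ.^ 5) · 1# * (4 · 1#) * (suc r · 1#) * q * (½ ^ 5 * 1/R * u)
          ≈⟨ *-cong (*-cong (≈-sym (≈-trans (×1-homo-* 128 (suc r)) (*-cong (×1-homo-* 32 4) ≈-refl))) ≈-refl) ≈-refl ⟩
        (128 ℕ.* suc r) · 1# * q * (½ ^ 5 * 1/R * u)
          ≤⟨ *-monoʳ-≤ (*-nonneg (*-nonneg (^-nonneg ½≥0 5) 1/R≥0) u≥0) dense ⟩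
        ρ * (½ ^ 5 * 1/R * u)
          ≈⟨ solve 3 (λ ρ x u → ρ :* (x :* u) := x :* (ρ :* u)) ≈-refl ρ (½ ^ 5 * 1/R) u ⟩
        ½ ^ 5 * 1/R * (ρ * u) ∎

      q′≤θp₁ : q′ ≤ θ * p₁
      q′≤θp₁ = ≤-trans q′≤ (≤-reflexive
        (solve 4 (λ H t x r → H :* t :* r :* x := t :* (x :* (H :* r))) ≈-refl ½ θ (ρ * u) 1/R))

      q′≤θ₂p₂ : q′ ≤ θ₂ * p₂
      q′≤θ₂p₂ = ≤-trans q′≤ (≤-reflexive
        (solve 4 (λ H t x r → H :* t :* r :* x := t :* r :* (x :* H)) ≈-refl ½ θ (ρ * u) 1/R))

      density≈ : ∀ k → total-density p₁ p₂ k ≈ p₂ + k · 1# * p₁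
      density≈ zero    = ≈-sym (≈-trans (+-congˡ (zeroˡ p₁)) (+-identityʳ p₂))
      density≈ (suc k) = ≈-trans (+-congˡ (density≈ k))
        (solve 3 (λ p₁ p₂ k → p₁ :+ (p₂ :+ k :* p₁) := p₂ :+ (con 1 :+ k) :* p₁) ≈-refl p₁ p₂ (k · 1#))

      π : R
      π = total-density p₁ p₂ (suc r)

      π≈ρu : π ≈ ρ * u
      π≈ρu = begin-equality
        π ≈⟨ density≈ (suc r) ⟩
        p₂ + suc r · 1# * p₁
          ≈⟨ +-cong (*-comm _ _) (solve 4 (λ n x H d → n :* (x :* (H :* d)) := H :* x :* (d :* n)) ≈-refl
            (suc r · 1#) (ρ * u) ½ 1/R) ⟩
        ½ * (ρ * u) + ½ * (ρ * u) * (1/R * (suc r · 1#))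
          ≈⟨ +-congˡ (≈-trans (*-congˡ (1/suc-inverse r)) (*-identityʳ _)) ⟩
        ½ * (ρ * u) + ½ * (ρ * u) ≈⟨ ½+½ ⟩
        ρ * u ∎

      π+π̄≈1 : π + π̄ ≈ 1#
      π+π̄≈1 = begin-equality
        π + (ρ̄ + ρ * (u * (h′ · 1#)))
          ≈⟨ +-cong π≈ρu ≈-refl ⟩
        ρ * u + (ρ̄ + ρ * (u * (h′ · 1#)))
          ≈⟨ solve 4 (λ ρ ρ̄ u k → ρ :* u :+ (ρ̄ :+ ρ :* (u :* k)) := ρ :*
            (u :* (con 1 :+ k)) :+ ρ̄) ≈-refl ρ ρ̄ u (h′ · 1#) ⟩
        ρ * (u * (H · 1#)) + ρ̄
          ≈⟨ +-cong (≈-trans (*-congˡ (1/suc-inverse h′)) (*-identityʳ ρ)) ≈-refl ⟩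
        ρ + ρ̄
          ≈⟨ ρ+ρ̄≈1 ⟩
        1# ∎

      π-bernoulli : IsBernoulli π π̄
      π-bernoulli = bern (≤-trans ρu≥0 (≤-reflexive (≈-sym π≈ρu))) π̄≥0 π+π̄≈1

      ½^≥0 : ∀ n → 0# ≤ ½ ^ n
      ½^≥0 = ^-nonneg ½≥0

      ½^-anti : ∀ {a b} → a ℕ.≤ b → ½ ^ b ≤ ½ ^ a
      ½^-anti = ^-antitone ½≥0 (1/suc≤1 1)

      -- Here `4^s ≤ 1 + r` enters: the last round is denser by the factor 1 + r, so its ratio is at
      -- most 4^(-s), against 2^s subsets.
      loss-zero : loss θ θ₂ s 0 ≤ ½ ^ s
      loss-zero = begin
        (2 ℕ.^ s) · 1# * (θ * 1/R * 1#)
          ≤⟨ *-monoˡ-≤ (·-nonneg (2 ℕ.^ s))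
            (≤-trans (≤-reflexive (*-identityʳ _))
            (≤-trans (*-monoʳ-≤ 1/R≥0 θ≤1) (≤-trans (≤-reflexive (*-identityˡ 1/R)) 1/R≤))) ⟩
        (2 ℕ.^ s) · 1# * ½ ^ (s ℕ.+ s)
          ≈⟨ 2^*½^ s s ⟩
        ½ ^ s ∎
        where
        4^s≡ : 2 ℕ.^ (s ℕ.+ s) ≡ 4 ℕ.^ s
        4^s≡ = trans (cong (λ k → 2 ℕ.^ (s ℕ.+ k)) (sym (ℕ.+-identityʳ s))) (sym (ℕ.^-*-assoc 2 2 s))
        1/R≤ : 1/R ≤ ½ ^ (s ℕ.+ s)
        1/R≤ = begin
          1/R
            ≈⟨ ≈-trans (*-congˡ (½^-cancel (s ℕ.+ s))) (*-identityʳ 1/R) ⟨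
          1/R * ((2 ℕ.^ (s ℕ.+ s)) · 1# * ½ ^ (s ℕ.+ s))
            ≤⟨ *-monoˡ-≤ 1/R≥0 (*-monoʳ-≤ (½^≥0 (s ℕ.+ s)) (·-mono-≤ (subst (ℕ._≤ suc r) (sym 4^s≡) 4^s≤1+r))) ⟩
          1/R * (suc r · 1# * ½ ^ (s ℕ.+ s))
            ≈⟨ ≈-trans (≈-sym (*-assoc _ _ _)) (≈-trans (*-cong (1/suc-inverse r) ≈-refl) (*-identityˡ _)) ⟩
          ½ ^ (s ℕ.+ s) ∎

      -- With L = 2ℓ, the ratio 1/16 gives θ^ℓ = 4^(-L), which beats the 2^L subsets of a member.
      -- The surplus factor θ is discarded.
      loss-step : ∀ k → (2 ℕ.^ (s ℕ.* 2 ℕ.^ suc k)) · 1# * θ ^ suc (s ℕ.* 2 ℕ.^ k) ≤ ½ ^ (s ℕ.+ suc k)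
      loss-step k = begin
        (2 ℕ.^ L) · 1# * θ ^ suc ℓ
          ≤⟨ *-monoˡ-≤ (·-nonneg (2 ℕ.^ L)) (^-antitone θ≥0 θ≤1 (ℕ.n≤1+n ℓ)) ⟩
        (2 ℕ.^ L) · 1# * θ ^ ℓ
          ≈⟨ *-congˡ (≈-trans (^-^ ½ 4 ℓ) (≡⇒≈ (cong (½ ^_) 4ℓ≡L+L))) ⟩
        (2 ℕ.^ L) · 1# * ½ ^ (L ℕ.+ L)
          ≈⟨ 2^*½^ L L ⟩
        ½ ^ L
          ≤⟨ ½^-anti (s+1+k≤s*2^[1+k] s k 1≤s) ⟩
        ½ ^ (s ℕ.+ suc k) ∎
        where
        ℓ = s ℕ.* 2 ℕ.^ k
        L = s ℕ.* 2 ℕ.^ suc k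
        4ℓ≡L+L : ℓ ℕ.* 4 ≡ L ℕ.+ L
        4ℓ≡L+L = S.solve 2 (λ s x → (s S.:* x) S.:* S.con 4 S.:= s S.:* (S.con 2 S.:* x) S.:+ s S.:*
          (S.con 2 S.:* x)) refl s (2 ℕ.^ k)
          where module S = ℕ.+-*-Solver

      loss-bound : ∀ k → loss θ θ₂ s k + ½ ^ (s ℕ.+ k) ≤ ½ ^ s + ½ ^ s
      loss-bound zero = +-mono-≤ loss-zero (½^-anti (ℕ.m≤m+n s 0))
      loss-bound (suc k) = begin
        loss θ θ₂ s k + (2 ℕ.^ (s ℕ.* 2 ℕ.^ suc k)) · 1# * θ ^ suc (s ℕ.* 2 ℕ.^ k) + ½ ^ (s ℕ.+ suc k)
          ≤⟨ +-mono-≤ (+-mono-≤ ≤-refl (loss-step k)) ≤-refl ⟩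
        loss θ θ₂ s k + ½ ^ (s ℕ.+ suc k) + ½ ^ (s ℕ.+ suc k)
          ≈⟨ ≈-trans (+-assoc _ _ _) (+-congˡ (≈-trans (+-cong half half) ½+½)) ⟩
        loss θ θ₂ s k + ½ ^ (s ℕ.+ k)
          ≤⟨ loss-bound k ⟩
        ½ ^ s + ½ ^ s ∎
        where
        half : ½ ^ (s ℕ.+ suc k) ≈ ½ * ½ ^ (s ℕ.+ k)
        half = ≡⇒≈ (cong (½ ^_) (ℕ.+-suc s k))

      e : Coloured 𝒜 uniform μ μ≥0 → Subset (m ℕ.* H)
      e = points 𝒜 uniform μ μ≥0
      js = coloured 𝒜 uniform μ μ≥0

      uncovered-bound : 𝔼ₚ π π̄ (uncovered e js) ≤ ½ ^ s + ½ ^ s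
      uncovered-bound = begin
        𝔼ₚ π π̄ (uncovered e js)
          ≈⟨ ≈-trans (*-cong (≈-trans (∑-weight 𝒜 uniform μ μ≥0 u≥0 v≥0
            (1/suc-inverse h′) v-inverse) mass) ≈-refl) (*-identityˡ _) ⟨
        ∑ js w * 𝔼ₚ π π̄ (uncovered e js)
          ≤⟨ uncovered-probability w w≥0 p₁≥0 p₂≥0 q′≥0 θ≥0 θ≤1 q′≤θp₁ θ₂≥0 θ₂≤1 q′≤θ₂p₂ s (suc r) π̄≥0 π+π̄≈1 e js
               (λ {j} j∈ → subst (ℕ._≤ s ℕ.* 2 ℕ.^ suc r) (sym (∣points∣ 𝒜 uniform μ μ≥0 j∈)) h≤s2^[1+r])
               (coloured-spread 𝒜 uniform μ μ≥0 u≥0 v≥0 (1/suc-inverse h′) v-inverse q≥0 spread) ⟩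
        loss θ θ₂ s (suc r)
          ≤⟨ x≤x+y (½^≥0 (s ℕ.+ suc r)) ⟩
        loss θ θ₂ s (suc r) + ½ ^ (s ℕ.+ suc r)
          ≤⟨ loss-bound (suc r) ⟩
        ½ ^ s + ½ ^ s ∎
        where
        v≥0 = 0≤1/suc (ℕ.pred (H !))
        w = weight 𝒜 uniform μ μ≥0 u≥0 v≥0 (1/suc-inverse h′) v-inverse
        w≥0 = weight≥0 𝒜 uniform μ μ≥0 u≥0 v≥0 (1/suc-inverse h′) v-inverse

      ∑u≈1 : ∑ (allFin H) (λ _ → u) ≈ 1#
      ∑u≈1 = ≈-trans (∑-const (allFin H) u) (≈-trans (*-cong (·-cong (length-tabulate {n = H} id)) ≈-refl)
        (≈-trans (*-comm _ _) (1/suc-inverse h′)))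

    -- A coloured member inside the marked set is a rainbow member among the retained points, so
    -- failure implies being uncovered. Clutter percolation then compares with independent density
    -- ρ/h on Ω × [h].
    no-rainbow-bound :
      𝔼ⁿ (allFin (suc h′)) (λ _ → 1/suc h′) m (λ cs → 𝔼ₚ ρ ρ̄ (λ S → [ ¬? (containsRainbow? 𝒜 (cs , S)) ])) ≤
      ½ ^ s + ½ ^ s
    no-rainbow-bound = begin
      𝔼ⁿ (allFin H) (λ _ → u) m (λ cs → 𝔼ₚ ρ ρ̄ (λ S → [ ¬? (containsRainbow? 𝒜 (cs , S)) ]))
        ≤⟨ 𝔼ⁿ-mono (allFin H) (λ _ → u) (λ _ → u≥0) (λ cs → 𝔼ₚ-mono (λ S →
             []-mono (¬? (containsRainbow? 𝒜 (cs , S))) (¬? (Fragments.covered? e js (marked cs S)))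
               (λ none cov → none (rainbow-member cs S cov)))) ⟩
      coloured-exposure ρ-bernoulli π-bernoulli u≥0 ∑u≈1 π≈ρu m (uncovered e js)
        ≤⟨ clutter-percolation ρ-bernoulli π-bernoulli u≥0 ∑u≈1 π≈ρu m (uncovered e js)
          (uncovered-subadditive {m = m} proj₂ js) ⟩
      𝔼ₚ π π̄ (uncovered e js)
        ≤⟨ uncovered-bound ⟩
      ½ ^ s + ½ ^ s ∎
      where
      rainbow-member : ∀ cs S → Fragments.Covered e js (marked cs S) → ContainsRainbow 𝒜 (cs , S)
      rainbow-member cs S cov with (A , G) , j∈ , G⊆ ← find cov
                              with A∈𝒜 , F ← coloured⁻ 𝒜 uniform μ μ≥0 j∈
                              with (A⊆S , rain) , _ ← marked-sound cs S F G⊆ = A , A∈𝒜 , rain , A⊆S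

-- The spread measure of a percolation

module ConditionalMeasure (K : OrderedSemiring) where

  open FiniteSums K
  open Percolation K

  ∑-≟ : ∀ {n} (T : Subset n) (f : Subset n → R) → ∑ (subsets n) (λ A → [ T ≟ˢ A ] * f A) ≈ f T
  ∑-≟ [] f = ≈-trans (∑-subsets-zero _) (*-identityˡ (f []))
  ∑-≟ {suc n} (s ∷ T) f = ≈-trans (∑-subsets n _) (by-side s)
    where
    same : ∀ s → ∑ (subsets n) (λ A → [ (s ∷ T) ≟ˢ (s ∷ A) ] * f (s ∷ A)) ≈ f (s ∷ T)
    same s = ≈-trans (∑-cong (subsets n)
      (λ A → *-cong ([]-cong ((s ∷ T) ≟ˢ (s ∷ A)) (T ≟ˢ A) Vec.∷-injectiveʳ (cong (s ∷_))) ≈-refl))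
      (∑-≟ T (f ∘ (s ∷_)))
    different : ∀ {s t} → ¬ s ≡ t → ∑ (subsets n) (λ A → [ (s ∷ T) ≟ˢ (t ∷ A) ] * f (t ∷ A)) ≈ 0#
    different {s} {t} s≢t = ≈-trans (∑-cong (subsets n) (λ A → ≈-trans
      (*-cong ([]-false ((s ∷ T) ≟ˢ (t ∷ A)) (s≢t ∘ Vec.∷-injectiveˡ)) ≈-refl) (zeroˡ _))) (∑-zero (subsets n))
    by-side : ∀ s → ∑ (subsets n) (λ A → [ (s ∷ T) ≟ˢ (inside ∷ A) ] * f (inside ∷ A)) +
                    ∑ (subsets n) (λ A → [ (s ∷ T) ≟ˢ (outside ∷ A) ] * f (outside ∷ A)) ≈ f (s ∷ T)
    by-side inside  = ≈-trans (+-cong (same inside) (different {inside} {outside} λ ())) (+-identityʳ _)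
    by-side outside = ≈-trans (+-cong (different {outside} {inside} λ ()) (same outside)) (+-identityˡ _)

  module _ {p p̄ : R} (p-bernoulli : IsBernoulli p p̄) where

    open IsBernoulli p-bernoulli

    𝔼ₚ-⊇ : ∀ {n} (S : Subset n) → 𝔼ₚ p p̄ (λ W → [ S ⊆? W ]) ≈ p ^ ∣ S ∣
    𝔼ₚ-⊇ [] = 𝔼ₚ-zero _
    𝔼ₚ-⊇ (inside ∷ S) = ≈-trans (𝔼ₚ-suc _) (≈-trans (+-cong
      (*-congˡ (≈-trans (𝔼ₚ-cong (λ W → in⊆in-[] S W)) (𝔼ₚ-⊇ S)))
      (*-congˡ (≈-trans (𝔼ₚ-cong (λ W → in⊆out-[] S W)) (𝔼ₚ-const 0#))))
      (≈-trans (+-congˡ (zeroʳ p̄)) (+-identityʳ _)))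
    𝔼ₚ-⊇ (outside ∷ S) = ≈-trans (𝔼ₚ-suc _) (≈-trans (+-cong
      (*-congˡ (≈-trans (𝔼ₚ-cong (λ W → out⊆-[] S W inside)) (𝔼ₚ-⊇ S)))
      (*-congˡ (≈-trans (𝔼ₚ-cong (λ W → out⊆-[] S W outside)) (𝔼ₚ-⊇ S))))
      (≈-trans (≈-sym (distribʳ _ p p̄)) (≈-trans (*-cong total ≈-refl) (*-identityˡ _))))

    module _ {m : ℕ} (𝒜 : Family m) {b : R} (b≥0 : 0# ≤ b)
             (b-inverse : b * 𝔼ₚ p p̄ (λ S → [ contains? 𝒜 S ]) ≈ 1#) where

      -- The default value S is harmless: each use is weighted by the indicator of `Contains 𝒜 S`.
      contained : Subset m → Subset m
      contained S with contains? 𝒜 S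
      ... | yes (A , _) = A
      ... | no _        = S

      contained-spec : ∀ S → Contains 𝒜 S → contained S ∈ᶠ 𝒜 × contained S ⊆ S
      contained-spec S c with contains? 𝒜 S
      ... | yes (A , A∈𝒜 , A⊆S) = A∈𝒜 , A⊆S
      ... | no none            = contradiction c none

      conditional : Subset m → R
      conditional A = b * 𝔼ₚ p p̄ (λ S → [ contains? 𝒜 S ] * [ contained S ≟ˢ A ])

      conditional≥0 : ∀ A → 0# ≤ conditional A
      conditional≥0 A = *-nonneg b≥0 (𝔼ₚ-nonneg (λ S → []*-nonneg (contains? 𝒜 S) ([]-nonneg (contained S ≟ˢ A))))

      -- The transfer formula for the law of the chosen member; support, total mass and spread are
      -- the cases of three test functions f.
      ∑-conditional : ∀ (f : Subset m → R) → ∑ (subsets m) (λ A → conditional A * f A) ≈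
                            b * 𝔼ₚ p p̄ (λ S → [ contains? 𝒜 S ] * f (contained S))
      ∑-conditional f = begin-equality
        ∑ (subsets m) (λ A → b * 𝔼ₚ p p̄ (λ S → [ contains? 𝒜 S ] * [ contained S ≟ˢ A ]) * f A)
          ≈⟨ ∑-cong (subsets m) (λ A → ≈-trans (*-assoc _ _ _) (*-congˡ (≈-trans (*-comm _ (f A)) (≈-trans (≈-sym 𝔼ₚ-*ˡ)
               (𝔼ₚ-cong (λ S → solve 3 (λ f c d → f :* (c :* d) := c :* (d :* f)) ≈-refl
                 (f A) [ contains? 𝒜 S ] [ contained S ≟ˢ A ])))))) ⟩
        ∑ (subsets m) (λ A → b * 𝔼ₚ p p̄ (λ S → [ contains? 𝒜 S ] * ([ contained S ≟ˢ A ] * f A)))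
          ≈⟨ ≈-trans (∑-*ˡ b (subsets m)) (*-congˡ (≈-sym (𝔼ₚ-∑ (subsets m)))) ⟩
        b * 𝔼ₚ p p̄ (λ S → ∑ (subsets m) (λ A → [ contains? 𝒜 S ] * ([ contained S ≟ˢ A ] * f A)))
          ≈⟨ *-congˡ (𝔼ₚ-cong (λ S → ≈-trans (∑-*ˡ _ (subsets m)) (*-congˡ (∑-≟ (contained S) f)))) ⟩
        b * 𝔼ₚ p p̄ (λ S → [ contains? 𝒜 S ] * f (contained S)) ∎

      conditional-supported : ∑ (subsets m) (λ A → conditional A * [ T? (𝒜 A) ]) ≈ 1#
      conditional-supported = ≈-trans (∑-conditional _) (≈-trans (*-congˡ (𝔼ₚ-cong (λ S →
        ≈-trans ([]*-cong (contains? 𝒜 S) (λ c → []-true (T? (𝒜 (contained S))) (proj₁ (contained-spec S c))))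
          (*-identityʳ _)))) b-inverse)

      conditional-total : ∑ (subsets m) conditional ≈ 1#
      conditional-total = ≈-trans (∑-cong (subsets m) (λ A → ≈-sym (*-identityʳ _)))
        (≈-trans (∑-conditional (λ _ → 1#)) (≈-trans (*-congˡ (𝔼ₚ-cong (λ S → *-identityʳ _))) b-inverse))

      private
        1≤b : 1# ≤ b
        1≤b = begin
          1# ≈⟨ b-inverse ⟨
          b * 𝔼ₚ p p̄ (λ S → [ contains? 𝒜 S ]) ≤⟨ *-monoˡ-≤ b≥0 (𝔼ₚ-mono (λ S → []≤1 (contains? 𝒜 S))) ⟩
          b * 𝔼ₚ p p̄ {m} (λ S → 1#) ≈⟨ *-congˡ (𝔼ₚ-const 1#) ⟩
          b * 1# ≈⟨ *-identityʳ b ⟩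
          b ∎

        1≤b^ : ∀ k → 1# ≤ b ^ k
        1≤b^ zero    = ≤-refl
        1≤b^ (suc k) = ≤-trans (≤-reflexive (≈-sym (*-identityˡ 1#))) (*-mono-≤ 0≤1 b≥0 1≤b (1≤b^ k))

        -- For k ≥ 1 the single factor b may be raised to b^k since b ≥ 1. For k = 0 the bound x ≤ 1
        -- would only give b, so the total mass bound b x ≤ 1 is needed.
        at-size : ∀ k {x} → x ≤ p ^ k → b * x ≤ 1# → b * x ≤ (p * b) ^ k
        at-size zero    _ bx≤1 = bx≤1
        at-size (suc k) {x} x≤ _ = begin
          b * x ≤⟨ *-monoˡ-≤ b≥0 x≤ ⟩
          b * p ^ suc k ≈⟨ *-cong (*-identityʳ b) ≈-refl ⟨
          b * 1# * p ^ suc k ≤⟨ *-monoʳ-≤ (^-nonneg p≥0 (suc k)) (*-monoˡ-≤ b≥0 (1≤b^ k)) ⟩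
          b ^ suc k * p ^ suc k ≈⟨ *-comm _ _ ⟩
          p ^ suc k * b ^ suc k ≈⟨ ^-distrib-* p b (suc k) ⟨
          (p * b) ^ suc k ∎

      conditional-spread : ∀ S → ∑ (subsets m) (λ A → conditional A * [ S ⊆? A ]) ≤ (p * b) ^ ∣ S ∣
      conditional-spread S = ≤-trans (≤-reflexive (∑-conditional _)) (at-size ∣ S ∣
        (≤-trans (𝔼ₚ-mono (λ W → []*≤-if (contains? 𝒜 W) ([]-nonneg (S ⊆? W))
            (λ c → []-mono (S ⊆? contained W) (S ⊆? W) (λ S⊆ x∈ → proj₂ (contained-spec W c) (S⊆ x∈)))))
          (≤-reflexive (𝔼ₚ-⊇ S)))
        (≤-trans (*-monoˡ-≤ b≥0 (𝔼ₚ-mono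
          (λ W → ≤-trans (*-monoˡ-≤ ([]-nonneg (contains? 𝒜 W)) ([]≤1 (S ⊆? contained W)))
            (≤-reflexive (*-identityʳ _)))))
          (≤-reflexive b-inverse)))

-- The natural logarithm against the number of rounds

log₂-bracket : ∀ n → ∃[ r ] 2 ℕ.^ r ℕ.≤ suc n × suc n ℕ.< 2 ℕ.^ suc r
log₂-bracket zero = 0 , ℕ.≤-refl , ℕ.≤-refl
log₂-bracket (suc n) with r , lo , hi ← log₂-bracket n with suc (suc n) ℕ.<? 2 ℕ.^ suc r
... | yes hi′ = r , ℕ.m≤n⇒m≤1+n lo , hi′
... | no ≮    = suc r , ℕ.≮⇒≥ ≮ , ℕ.≤-<-trans hi (ℕ.^-monoʳ-< 2 ℕ.≤-refl (ℕ.n<1+n (suc r)))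

module Logarithm (K : OrderedSemiring) where

  open FiniteSums K
  open ColouredFamily K using (·-homo-^; 1^)

  1/suc-antitone : ∀ {a b} → a ℕ.≤ b → 1/suc b ≤ 1/suc a
  1/suc-antitone {a} {b} a≤b = begin
    1/suc b
      ≈⟨ ≈-trans (*-congˡ (1/suc-inverse a)) (*-identityʳ _) ⟨
    1/suc b * (1/suc a * (suc a · 1#))
      ≤⟨ *-monoˡ-≤ (0≤1/suc b) (*-monoˡ-≤ (0≤1/suc a) (·-mono-≤ (ℕ.s≤s a≤b))) ⟩
    1/suc b * (1/suc a * (suc b · 1#))
      ≈⟨ solve 3 (λ x y n → x :* (y :* n) := y :* (x :* n)) ≈-refl (1/suc b) (1/suc a) (suc b · 1#) ⟩
    1/suc a * (1/suc b * (suc b · 1#))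
      ≈⟨ ≈-trans (*-congˡ (1/suc-inverse b)) (*-identityʳ _) ⟩
    1/suc a ∎

  -- Partial sums of the series of -log (1 - x); at x = 1 - 1/h they approach log h from below.
  logSum : R → ℕ → R
  logSum x zero    = 0#
  logSum x (suc k) = logSum x k + x ^ suc k * 1/suc k

  module _ (h′ : ℕ) {x : R} (x≥0 : 0# ≤ x) (x+1/h≈1 : x + 1/suc h′ ≈ 1#) where

    private
      H = suc h′ · 1#
      u = 1/suc h′
      ½ = 1/suc 1

      uH≈1 : u * H ≈ 1#
      uH≈1 = 1/suc-inverse h′

      xH≈h′ : x * H ≈ h′ · 1#
      xH≈h′ = IsPartialOrder.antisym isPartialOrder (+-cancelʳ-≤ 1# (≤-reflexive eq))
        (+-cancelʳ-≤ 1# (≤-reflexive (≈-sym eq)))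
        where
        eq : x * H + 1# ≈ h′ · 1# + 1#
        eq = ≈-trans (+-congˡ (≈-sym uH≈1)) (≈-trans (≈-sym (distribʳ H x u))
          (≈-trans (*-cong x+1/h≈1 ≈-refl) (≈-trans (*-identityˡ H) (+-comm 1# _))))

    -- Bernoulli's inequality for x = 1 - 1/h. It confines the dyadic blocks to indices up to h/2.
    half≤x^ : ∀ i → 2 ℕ.* i ℕ.≤ suc h′ → ½ ≤ x ^ i
    half≤x^ i 2i≤h = begin
      ½
        ≈⟨ ≈-trans (*-congˡ (≈-trans (^-congˡ i uH≈1) (1^ i))) (*-identityʳ ½) ⟨
      ½ * (u * H) ^ i
        ≈⟨ *-congˡ (≈-trans (^-distrib-* u H i) (*-congˡ (·-homo-^ (suc h′) i))) ⟩
      ½ * (u ^ i * ((suc h′ ℕ.^ i) · 1#))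
        ≤⟨ *-monoˡ-≤ (0≤1/suc 1) (*-monoˡ-≤ (^-nonneg (0≤1/suc h′) i) (·-mono-≤ ([1+n]^j≤2n^j h′ i 2i≤h))) ⟩
      ½ * (u ^ i * ((2 ℕ.* h′ ℕ.^ i) · 1#))
        ≈⟨ *-congˡ (*-congˡ (≈-trans (×1-homo-* 2 (h′ ℕ.^ i)) (*-cong ≈-refl
             (≈-trans (≈-sym (·-homo-^ h′ i)) (≈-trans (^-congˡ i (≈-sym xH≈h′)) (^-distrib-* x H i)))))) ⟩
      ½ * (u ^ i * (2 · 1# * (x ^ i * H ^ i)))
        ≈⟨ solve 5 (λ h u t x H → h :* (u :* (t :* (x :* H))) := (h :* t) :* x :* (u :* H)) ≈-refl ½ (u ^ i)
          (2 · 1#) (x ^ i) (H ^ i) ⟩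
      (½ * (2 · 1#)) * x ^ i * (u ^ i * H ^ i)
        ≈⟨ *-cong (≈-trans (*-cong (1/suc-inverse 1) ≈-refl) (*-identityˡ _))
             (≈-trans (≈-sym (^-distrib-* u H i)) (≈-trans (^-congˡ i uH≈1) (1^ i))) ⟩
      x ^ i * 1#
        ≈⟨ *-identityʳ _ ⟩
      x ^ i ∎

    logSum-block : ∀ n d N → d ℕ.+ n ℕ.≤ suc N → 2 ℕ.* (d ℕ.+ n) ℕ.≤ suc h′ →
            logSum x n + d · 1# * (½ * 1/suc N) ≤ logSum x (d ℕ.+ n)
    logSum-block n zero N _ _ = ≤-reflexive (≈-trans (+-congˡ (zeroˡ _)) (+-identityʳ _))
    logSum-block n (suc d) N d+n≤N 2[d+n]≤h = begin
      logSum x n + (1# + d · 1#) * (½ * 1/suc N)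
        ≈⟨ solve 4 (λ l o d y → l :+ (o :+ d) :* y := (l :+ d :* y) :+ o :* y) ≈-refl (logSum x n) 1# (d · 1#)
          (½ * 1/suc N) ⟩
      logSum x n + d · 1# * (½ * 1/suc N) + 1# * (½ * 1/suc N)
        ≤⟨ +-mono-≤ (logSum-block n d N (ℕ.≤-trans (ℕ.n≤1+n _) d+n≤N)
          (ℕ.≤-trans (ℕ.*-monoʳ-≤ 2 (ℕ.n≤1+n (d ℕ.+ n))) 2[d+n]≤h))
             (≤-trans (≤-reflexive (*-identityˡ _)) (*-mono-≤ (0≤1/suc N) (^-nonneg x≥0 (suc d ℕ.+ n))
               (half≤x^ (suc d ℕ.+ n) 2[d+n]≤h) (1/suc-antitone (ℕ.s≤s⁻¹ d+n≤N)))) ⟩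
      logSum x (d ℕ.+ n) + x ^ suc (d ℕ.+ n) * 1/suc (d ℕ.+ n) ∎

    -- Each dyadic block 2^j < i ≤ 2^(j+1) contributes at least 1/4 to ∑ x^i / i, as x^i ≥ 1/2.
    logSum-dyadic : ∀ j → 2 ℕ.* 2 ℕ.^ j ℕ.≤ suc h′ → suc j · 1# ≤ 4 · 1# * logSum x (2 ℕ.^ j)
    logSum-dyadic zero 2≤h = begin
      1 · 1#
        ≈⟨ +-identityʳ 1# ⟩
      1#
        ≈⟨ 1/suc-inverse 1 ⟨
      ½ * (2 · 1#)
        ≤⟨ *-mono-≤ (·-nonneg 2) (^-nonneg x≥0 1) (half≤x^ 1 2≤h) (·-mono-≤ {2} {4} (ℕ.s≤s (ℕ.s≤s ℕ.z≤n))) ⟩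
      x ^ 1 * (4 · 1#)
        ≈⟨ ≈-trans (*-comm _ _) (*-congˡ
          (≈-sym (≈-trans (+-identityˡ _) (≈-trans (*-congˡ 1/suc0≈1) (*-identityʳ _))))) ⟩
      4 · 1# * (0# + x ^ 1 * 1/suc 0) ∎
      where
      1/suc0≈1 : 1/suc 0 ≈ 1#
      1/suc0≈1 = ≈-trans (≈-sym (≈-trans (*-congˡ (+-identityʳ 1#)) (*-identityʳ _))) (1/suc-inverse 0)
    logSum-dyadic (suc j) 4·2^j≤h = begin
      1# + suc j · 1#
        ≤⟨ +-mono-≤ (≤-reflexive (≈-sym quarter))
          (logSum-dyadic j (ℕ.≤-trans (ℕ.*-monoʳ-≤ 2 (ℕ.m≤m+n n (n ℕ.+ 0))) 4·2^j≤h)) ⟩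
      4 · 1# * (n · 1# * (½ * w)) + 4 · 1# * logSum x n
        ≈⟨ solve 3 (λ f a b → f :* a :+ f :* b := f :* (b :+ a)) ≈-refl (4 · 1#) (n · 1# * (½ * w)) (logSum x n) ⟩
      4 · 1# * (logSum x n + n · 1# * (½ * w))
        ≤⟨ *-monoˡ-≤ (·-nonneg 4) (logSum-block n n N (ℕ.≤-reflexive (trans n+n≡2n (sym 1+N≡2n)))
             (subst (λ k → 2 ℕ.* k ℕ.≤ suc h′) (sym n+n≡2n) 4·2^j≤h)) ⟩
      4 · 1# * logSum x (n ℕ.+ n)
        ≈⟨ *-congˡ (≡⇒≈ (cong (logSum x) n+n≡2n)) ⟩
      4 · 1# * logSum x (2 ℕ.* n) ∎
      where
      n = 2 ℕ.^ j
      N = ℕ.pred (2 ℕ.* n)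
      w = 1/suc N
      1+N≡2n : suc N ≡ 2 ℕ.* n
      1+N≡2n = ℕ.suc-pred (2 ℕ.* n) {{ℕ.m^n≢0 2 (suc j)}}
      n+n≡2n : n ℕ.+ n ≡ 2 ℕ.* n
      n+n≡2n = cong (n ℕ.+_) (sym (ℕ.+-identityʳ n))
      quarter : 4 · 1# * (n · 1# * (½ * w)) ≈ 1#
      quarter = begin-equality
        4 · 1# * (n · 1# * (½ * w))
          ≈⟨ *-cong (×1-homo-* 2 2) ≈-refl ⟩
        2 · 1# * (2 · 1#) * (n · 1# * (½ * w))
          ≈⟨ solve 4 (λ t n h w → t :* t :* (n :* (h :* w)) := (h :* t) :* (w :* (t :* n))) ≈-refl (2 · 1#)
            (n · 1#) ½ w ⟩
        ½ * (2 · 1#) * (w * (2 · 1# * (n · 1#)))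
          ≈⟨ *-cong (1/suc-inverse 1) (*-congˡ (≈-trans (≈-sym (×1-homo-* 2 n)) (·-cong (sym 1+N≡2n)))) ⟩
        1# * (w * (suc N · 1#))
          ≈⟨ ≈-trans (*-identityˡ _) (1/suc-inverse N) ⟩
        1# ∎

-- Rainbow members from a percolation threshold

module SpreadThreshold (K : OrderedSemiring) where

  open FiniteSums K
  open Percolation K
  open Threshold K
  open Logarithm K
  open ConditionalMeasure K

  module _ {m h′ : ℕ} (𝒜 : Family m) (uniform : 𝒜 IsUniform suc h′)
           {ϑ ϑ̄ b : R} (ϑ-bernoulli : IsBernoulli ϑ ϑ̄) (b≥0 : 0# ≤ b)
           (b-inverse : b * 𝔼ₚ ϑ ϑ̄ (λ S → [ contains? 𝒜 S ]) ≈ 1#)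
           {ρ ρ̄ : R} (ρ-bernoulli : IsBernoulli ρ ρ̄)
           {x L : R} (x≥0 : 0# ≤ x) (x+1/h≈1 : x + 1/suc h′ ≈ 1#) (log-lower : ∀ k → logSum x k ≤ L)
           (dense : 1024 · 1# * (ϑ * b) * L ≤ ρ)
           (s : ℕ) (1≤s : 1 ℕ.≤ s) (large : 2 ℕ.^ 4 ℕ.^ s ℕ.≤ suc h′) where

    private
      q = ϑ * b
      q≥0 : 0# ≤ q
      q≥0 = *-nonneg (IsBernoulli.p≥0 ϑ-bernoulli) b≥0
      μ = conditional ϑ-bernoulli 𝒜 b≥0 b-inverse
      μ≥0 = conditional≥0 ϑ-bernoulli 𝒜 b≥0 b-inverse

      𝔼ᶜ : ∀ {m} → (Vec (Fin (suc h′)) m → R) → R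
      𝔼ᶜ {m} = 𝔼ⁿ (allFin (suc h′)) (λ _ → 1/suc h′) m

      𝔼ᶜ-const : ∀ c → 𝔼ᶜ {m} (λ _ → c) ≈ c
      𝔼ᶜ-const c = 𝔼ⁿ-const (allFin (suc h′)) _ (≈-trans (∑-const (allFin (suc h′)) _)
        (≈-trans (*-cong (·-cong (length-tabulate {n = suc h′} id)) ≈-refl)
          (≈-trans (*-comm _ _) (1/suc-inverse h′)))) m c

      𝔼ᶜ-mono : ∀ {f g} → (∀ v → f v ≤ g v) → 𝔼ᶜ {m} f ≤ 𝔼ᶜ g
      𝔼ᶜ-mono = 𝔼ⁿ-mono (allFin (suc h′)) _ (λ _ → 0≤1/suc h′)

      no-rainbow : 𝔼ᶜ (λ cs → 𝔼ₚ ρ ρ̄ (λ S → [ ¬? (containsRainbow? 𝒜 (cs , S)) ])) ≤ ½ ^ s + ½ ^ s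
      no-rainbow with r , lo , hi ← log₂-bracket h′ = by-rounds r lo hi
        where
        4^s<1+r : ∀ r → suc h′ ℕ.< 2 ℕ.^ suc r → 4 ℕ.^ s ℕ.< suc r
        4^s<1+r r hi with suc r ℕ.≤? 4 ℕ.^ s
        ... | no r≮4^s = ℕ.≰⇒> r≮4^s
        ... | yes r<4^s = contradiction (ℕ.≤-trans hi (ℕ.≤-trans (ℕ.^-monoʳ-≤ 2 r<4^s) large)) (ℕ.<-irrefl refl)
        by-rounds : ∀ r → 2 ℕ.^ r ℕ.≤ suc h′ → suc h′ ℕ.< 2 ℕ.^ suc r →
                    𝔼ᶜ (λ cs → 𝔼ₚ ρ ρ̄ (λ S → [ ¬? (containsRainbow? 𝒜 (cs , S)) ])) ≤ ½ ^ s + ½ ^ s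
        -- For r = 0 one would have 4^s < 1.
        by-rounds zero lo hi = contradiction (4^s<1+r 0 hi) (ℕ.≤⇒≯ (ℕ.m^n>0 4 s))
        -- The constant 1024 = 128 · 2 · 4: r + 1 = j + 2 is at most 2 (j + 1), and j + 1 ≤ 4 log h
        -- by `logSum-dyadic`, whose condition 2 · 2^j ≤ h is `lo`.
        by-rounds r@(suc j) lo hi = no-rainbow-bound 𝒜 uniform μ μ≥0 q≥0 mass spread ρ-bernoulli s 1≤s r
          (ℕ.<⇒≤ (4^s<1+r r hi)) (ℕ.≤-trans (ℕ.<⇒≤ hi) (ℕ.m≤n*m (2 ℕ.^ suc r) s {{ℕ.>-nonZero 1≤s}})) (begin
            (128 ℕ.* suc r) · 1# * q
              ≤⟨ *-monoʳ-≤ q≥0 (·-mono-≤ 128R≤) ⟩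
            (256 ℕ.* suc j) · 1# * q
              ≈⟨ *-cong (×1-homo-* 256 (suc j)) ≈-refl ⟩
            256 · 1# * (suc j · 1#) * q
              ≤⟨ *-monoʳ-≤ q≥0 (*-monoˡ-≤ (·-nonneg 256) (≤-trans (logSum-dyadic h′ x≥0 x+1/h≈1 j lo)
                   (*-monoˡ-≤ (·-nonneg 4) (log-lower (2 ℕ.^ j))))) ⟩
            256 · 1# * (4 · 1# * L) * q
              ≈⟨ solve 4 (λ a b L q → a :* (b :* L) :* q := a :* b :* q :* L) ≈-refl (256 · 1#) (4 · 1#) L q ⟩
            256 · 1# * (4 · 1#) * q * L
              ≈⟨ *-cong (*-cong (×1-homo-* 256 4) ≈-refl) ≈-refl ⟨
            1024 · 1# * q * L
              ≤⟨ dense ⟩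
            ρ ∎)
          where
          128R≤ : 128 ℕ.* suc (suc j) ℕ.≤ 256 ℕ.* suc j
          128R≤ = ℕ.≤-trans (ℕ.*-monoʳ-≤ 128 (ℕ.s≤s (ℕ.m≤n+m (suc j) j)))
            (ℕ.≤-reflexive (S.solve 1 (λ j → S.con 128 S.:*
              (S.con 1 S.:+ (j S.:+ (S.con 1 S.:+ j))) S.:= S.con 256 S.:* (S.con 1 S.:+ j)) refl j))
            where module S = ℕ.+-*-Solver
          mass : ∑ _ μ ≈ 1#
          mass = ≈-trans (∑-filter (λ A → T? (𝒜 A)) (subsets m))
            (≈-trans (∑-cong (subsets m) (λ A → *-comm [ T? (𝒜 A) ] (μ A)))
            (conditional-supported ϑ-bernoulli 𝒜 b≥0 b-inverse))
          spread : ∀ S → ∑ _ (λ A → μ A * [ S ⊆? A ]) ≤ q ^ ∣ S ∣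
          spread S = ≤-trans (≤-reflexive (∑-filter (λ A → T? (𝒜 A)) (subsets m)))
            (≤-trans (∑-mono (subsets m) (λ A → []*≤ (T? (𝒜 A)) (*-nonneg (μ≥0 A) ([]-nonneg (S ⊆? A)))))
              (conditional-spread ϑ-bernoulli 𝒜 b≥0 b-inverse S))

      open IsBernoulli ρ-bernoulli using (𝔼ₚ-mono; 𝔼ₚ-const)

      𝔼ᶜₚ-1 : 𝔼ᶜ {m} (λ cs → 𝔼ₚ ρ ρ̄ {m} (λ S → 1#)) ≈ 1#
      𝔼ᶜₚ-1 = ≈-trans (𝔼ⁿ-cong (allFin (suc h′)) _ (λ cs → 𝔼ₚ-const 1#)) (𝔼ᶜ-const 1#)

    contains-rainbow-whp : 1# ≤ 𝔼ᶜ (λ cs → 𝔼ₚ ρ ρ̄ (λ S → [ containsRainbow? 𝒜 (cs , S) ])) + (½ ^ s + ½ ^ s)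
    contains-rainbow-whp = begin
      1#
        ≈⟨ 𝔼ᶜₚ-1 ⟨
      𝔼ᶜ (λ cs → 𝔼ₚ ρ ρ̄ (λ S → 1#))
        ≈⟨ 𝔼ⁿ-cong (allFin (suc h′)) _ (λ cs → 𝔼ₚ-cong (λ S → []-¬ (containsRainbow? 𝒜 (cs , S)))) ⟨
      𝔼ᶜ (λ cs → 𝔼ₚ ρ ρ̄ (λ S → [ containsRainbow? 𝒜 (cs , S) ] + [ ¬? (containsRainbow? 𝒜 (cs , S)) ]))
        ≈⟨ ≈-trans (𝔼ⁿ-cong (allFin (suc h′)) _ (λ cs → 𝔼ₚ-+)) (𝔼ⁿ-+ (allFin (suc h′)) _) ⟩
      𝔼ᶜ (λ cs → 𝔼ₚ ρ ρ̄ (λ S → [ containsRainbow? 𝒜 (cs , S) ])) + 𝔼ᶜ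
        (λ cs → 𝔼ₚ ρ ρ̄ (λ S → [ ¬? (containsRainbow? 𝒜 (cs , S)) ]))
        ≤⟨ +-mono-≤ ≤-refl no-rainbow ⟩
      𝔼ᶜ (λ cs → 𝔼ₚ ρ ρ̄ (λ S → [ containsRainbow? 𝒜 (cs , S) ])) + (½ ^ s + ½ ^ s) ∎

    contains-rainbow≤1 : 𝔼ᶜ (λ cs → 𝔼ₚ ρ ρ̄ (λ S → [ containsRainbow? 𝒜 (cs , S) ])) ≤ 1#
    contains-rainbow≤1 = ≤-trans (𝔼ᶜ-mono (λ cs → 𝔼ₚ-mono (λ S → []≤1 (containsRainbow? 𝒜 (cs , S)))))
      (≤-reflexive 𝔼ᶜₚ-1)

    -- Forgetting which points were retained only enlarges the event.
    admits-rainbow-whp : 1# ≤ 𝔼ᶜ (λ cs → [ admitsRainbow? 𝒜 cs ]) + (½ ^ s + ½ ^ s)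
    admits-rainbow-whp = ≤-trans contains-rainbow-whp (+-mono-≤ (𝔼ᶜ-mono (λ cs → ≤-trans (𝔼ₚ-mono (λ S →
      []-mono (containsRainbow? 𝒜 (cs , S)) (admitsRainbow? 𝒜 cs) (λ (A , A∈𝒜 , rainbow , _) → A , A∈𝒜 , rainbow)))
      (≤-reflexive (𝔼ₚ-const _)))) ≤-refl)

    admits-rainbow≤1 : 𝔼ᶜ (λ cs → [ admitsRainbow? 𝒜 cs ]) ≤ 1#
    admits-rainbow≤1 = ≤-trans (𝔼ᶜ-mono (λ cs → []≤1 (admitsRainbow? 𝒜 cs))) (≤-reflexive (𝔼ᶜ-const 1#))

  -- From s < 2^s; it reduces the smallness of the error to the Archimedean property of the
  -- rationals.
  ½^≤1/suc : ∀ s → ½ ^ s ≤ 1/suc s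
  ½^≤1/suc s = begin
    ½ ^ s
      ≈⟨ ≈-trans (*-congˡ (1/suc-inverse s)) (*-identityʳ _) ⟨
    ½ ^ s * (1/suc s * (suc s · 1#))
      ≤⟨ *-monoˡ-≤ (^-nonneg ½≥0 s) (*-monoˡ-≤ (0≤1/suc s) (·-mono-≤ (s<2^s s))) ⟩
    ½ ^ s * (1/suc s * ((2 ℕ.^ s) · 1#))
      ≈⟨ solve 3 (λ h w t → h :* (w :* t) := w :* (t :* h)) ≈-refl (½ ^ s) (1/suc s) ((2 ℕ.^ s) · 1#) ⟩
    1/suc s * ((2 ℕ.^ s) · 1# * ½ ^ s)
      ≈⟨ ≈-trans (*-congˡ (½^-cancel s)) (*-identityʳ _) ⟩
    1/suc s ∎
    where
    s<2^s : ∀ s → s ℕ.< 2 ℕ.^ s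
    s<2^s zero    = ℕ.≤-refl
    s<2^s (suc s) = ℕ.≤-trans (ℕ.+-mono-≤ (ℕ.m^n>0 2 s) (s<2^s s))
      (ℕ.+-monoʳ-≤ (2 ℕ.^ s) (ℕ.≤-reflexive (sym (ℕ.+-identityʳ _))))

-- Expectations as probabilities on finite spaces

module Probabilities (K : OrderedSemiring) where

  open FiniteSums K

  private variable
    A B : Set

  -- Shaped like `ℙ`, a sum with a conditional in each term, whereas the expectations above multiply
  -- by indicators.
  probability : {P : Pred A 0ℓ} → List A → (A → R) → Decidable P → R
  probability xs w P? = foldr _+_ 0# (map (λ x → if does (P? x) then w x else 0#) xs)

  if-indicator : {P : Set} (P? : Dec P) (x : R) → (if does P? then x else 0#) ≈ x * [ P? ]
  if-indicator (yes _) x = ≈-sym (*-identityʳ x)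
  if-indicator (no _)  x = ≈-sym (zeroʳ x)

  opaque
    unfolding ∑ 𝔼 𝔼ⁿ 𝔼ₚ subsets

    probability≈𝔼 : {P : Pred A 0ℓ} (xs : List A) (w : A → R) (P? : Decidable P) →
                    probability xs w P? ≈ 𝔼 xs w (λ x → [ P? x ])
    probability≈𝔼 xs w P? = ∑-cong xs (λ x → if-indicator (P? x) (w x))

    𝔼-weights : (xs : List A) {v w : A → R} → (∀ x → v x ≈ w x) → ∀ {f} → 𝔼 xs v f ≈ 𝔼 xs w f
    𝔼-weights xs v≈w = ∑-cong xs (λ x → *-cong (v≈w x) ≈-refl)

    𝔼-vectors : (xs : List A) (w : A → R) → ∀ {m} (f : Vec A m → R) → 𝔼 (vectors xs m) (∏ w) f ≈ 𝔼ⁿ xs w m f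
    𝔼-vectors xs w f = ≈-refl

    𝔼-percolation : (w : Side → R) → ∀ {n} (f : Subset n → R) →
                    𝔼 (vectors (inside ∷ outside ∷ []) n) (∏ w) f ≈ 𝔼ₚ (w inside) (w outside) f
    𝔼-percolation w {n} f = ∑-cong (vectors (inside ∷ outside ∷ []) n) (λ S → *-cong
      (∏-cong (λ { inside → ≈-refl ; outside → ≈-refl }) S) ≈-refl)

    𝔼-product : (xs : List A) (ys : List B) → ∀ v w (f : A × B → R) →
      𝔼 (cartesianProduct xs ys) (λ (x , y) → v x * w y) f ≈ 𝔼 xs v (λ x → 𝔼 ys w (λ y → f (x , y)))
    𝔼-product xs ys v w f = ≈-trans (∑-product (λ (x , y) → v x * w y * f (x , y)) _,_ xs ys)
      (∑-cong xs (λ x → ≈-trans (∑-cong ys (λ y → *-assoc (v x) (w y) (f (x , y)))) (∑-*ˡ (v x) ys)))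

    probability-subsets : ∀ {n} {P : Pred (Subset n) 0ℓ} (w : Subset n → R) (P? : Decidable P) →
      probability (vectors (inside ∷ outside ∷ []) n) w P? ≈ ∑ (subsets n) (λ A → w A * [ P? A ])
    probability-subsets {n} w P? = ∑-cong (vectors (inside ∷ outside ∷ []) n) (λ A → if-indicator (P? A) (w A))

    total-subsets : ∀ {n} (w : Subset n → R) → foldr _+_ 0# (map w (vectors (inside ∷ outside ∷ []) n)) ≈ ∑
      (subsets n) w
    total-subsets w = ≈-refl

  probability-percolation : (w : Side → R) → ∀ {n} {P : Pred (Subset n) 0ℓ} (P? : Decidable P) →
    probability (vectors (inside ∷ outside ∷ []) n) (∏ w) P? ≈ 𝔼ₚ (w inside) (w outside) (λ S → [ P? S ])
  probability-percolation w P? = ≈-trans (probability≈𝔼 _ _ P?) (𝔼-percolation w _)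

  probability-iid : (xs : List A) (u : A → R) → ∀ {m} {P : Pred (Vec A m) 0ℓ} (P? : Decidable P) →
    probability (vectors xs m) (∏ u) P? ≈ 𝔼ⁿ xs u m (λ v → [ P? v ])
  probability-iid xs u P? = ≈-trans (probability≈𝔼 _ _ P?) (𝔼-vectors xs u _)

  probability-cong : {P : Pred A 0ℓ} (xs : List A) {v w : A → R} → (∀ x → v x ≈ w x) → (P? : Decidable P) →
                     probability xs v P? ≈ probability xs w P?
  probability-cong xs v≈w P? = ≈-trans (probability≈𝔼 xs _ P?)
    (≈-trans (𝔼-weights xs v≈w) (≈-sym (probability≈𝔼 xs _ P?)))

  probability-iid-percolation : (xs : List A) (u : A → R) (w : Side → R) → ∀ {m n} {W : Vec A m × Subset n → R} →
    (∀ x y → W (x , y) ≈ ∏ u x * ∏ w y) → {P : Pred (Vec A m × Subset n) 0ℓ} (P? : Decidable P) →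
    probability (cartesianProduct (vectors xs m) (vectors (inside ∷ outside ∷ []) n)) W P? ≈
    𝔼ⁿ xs u m (λ v → 𝔼ₚ (w inside) (w outside) (λ S → [ P? (v , S) ]))
  probability-iid-percolation xs u w {m} {n} W≈ P? = ≈-trans
    (probability-cong (cartesianProduct (vectors xs m) (vectors (inside ∷ outside ∷ []) n))
    (λ (x , y) → W≈ x y) P?) (≈-trans (probability≈𝔼 _ _ P?)
    (≈-trans (𝔼-product (vectors xs m) (vectors (inside ∷ outside ∷ []) n) (∏ u) (∏ w) _)
      (≈-trans (𝔼-vectors xs u _) (𝔼ⁿ-cong xs u (λ v → 𝔼-percolation w _)))))

module RainbowTheorem (K : OrderedSemiring) where

  open FiniteSums K
  open Threshold K using (½)
  open Logarithm K using (logSum)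
  open ConditionalMeasure K
  open SpreadThreshold K
  open Probabilities K

  private
    powerset : ∀ m → List (Subset m)
    powerset m = vectors (inside ∷ outside ∷ []) m

  module _ {m : ℕ} (𝒜 : Family m) (wϑ : Side → R) (ϑ-bernoulli : IsBernoulli (wϑ inside) (wϑ outside))
           {b : R} (b≥0 : 0# ≤ b) (b-inverse : b * probability (powerset m) (∏ wϑ) (contains? 𝒜) ≈ 1#) where

    private
      b-inverse′ : b * 𝔼ₚ (wϑ inside) (wϑ outside) (λ S → [ contains? 𝒜 S ]) ≈ 1#
      b-inverse′ = ≈-trans (*-congˡ (≈-sym (probability-percolation wϑ (contains? 𝒜)))) b-inverse

    spread-measure : Σ (Subset m → R) λ μ →
      ((∀ A → 0# ≤ μ A) × foldr _+_ 0# (map μ (powerset m)) ≈ 1#) ×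
      (∀ S → probability (powerset m) μ (S ⊆?_) ≤ (wϑ inside * b) ^ ∣ S ∣) ×
      probability (powerset m) μ (λ A → T? (𝒜 A)) ≈ 1#
    spread-measure = conditional ϑ-bernoulli 𝒜 b≥0 b-inverse′ ,
      (conditional≥0 ϑ-bernoulli 𝒜 b≥0 b-inverse′ , ≈-trans (total-subsets _)
        (conditional-total ϑ-bernoulli 𝒜 b≥0 b-inverse′)) ,
      (λ S → ≤-trans (≤-reflexive (probability-subsets _ (S ⊆?_)))
        (conditional-spread ϑ-bernoulli 𝒜 b≥0 b-inverse′ S)) ,
      ≈-trans (probability-subsets _ (λ A → T? (𝒜 A))) (conditional-supported ϑ-bernoulli 𝒜 b≥0 b-inverse′)

    module _ {h′ : ℕ} (uniform : 𝒜 IsUniform suc h′)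
             {x L : R} (x≥0 : 0# ≤ x) (x+1/h≈1 : x + 1/suc h′ ≈ 1#) (log-lower : ∀ k → logSum x k ≤ L)
             (s : ℕ) (1≤s : 1 ℕ.≤ s) (large : 2 ℕ.^ 4 ℕ.^ s ℕ.≤ suc h′)
             (wρ : Side → R) (ρ-bernoulli : IsBernoulli (wρ inside) (wρ outside)) where

      rainbow-percolation : 1024 · 1# * (wϑ inside * b) * L ≤ wρ inside →
        (W : Vec (Fin (suc h′)) m × Subset m → R) → (∀ c S → W (c , S) ≈ ∏ (λ _ → 1/suc h′) c * ∏ wρ S) →
        let P = probability (cartesianProduct (vectors (allFin (suc h′)) m) (powerset m)) W (containsRainbow? 𝒜)
        in P ≤ 1# × 1# ≤ P + (½ ^ s + ½ ^ s)
      rainbow-percolation dense W W≈ =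
        ≤-trans (≤-reflexive eq) (contains-rainbow≤1 𝒜 uniform ϑ-bernoulli b≥0 b-inverse′ ρ-bernoulli x≥0 x+1/h≈1 log-lower dense s 1≤s large) ,
        ≤-trans (contains-rainbow-whp 𝒜 uniform ϑ-bernoulli b≥0 b-inverse′ ρ-bernoulli x≥0 x+1/h≈1 log-lower dense s 1≤s large)
          (+-mono-≤ (≤-reflexive (≈-sym eq)) ≤-refl)
        where eq = probability-iid-percolation (allFin (suc h′)) (λ _ → 1/suc h′) wρ W≈ (containsRainbow? 𝒜)

      rainbow-colouring : wρ inside ≈ 1# → wϑ inside * b * L ≤ 1/suc 1023 →
        let P = probability (vectors (allFin (suc h′)) m) (∏ (λ _ → 1/suc h′)) (admitsRainbow? 𝒜)
        in P ≤ 1# × 1# ≤ P + (½ ^ s + ½ ^ s)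
      rainbow-colouring ρ≈1 qL≤ =
        ≤-trans (≤-reflexive eq) (admits-rainbow≤1 𝒜 uniform ϑ-bernoulli b≥0 b-inverse′ ρ-bernoulli x≥0 x+1/h≈1 log-lower dense s 1≤s large) ,
        ≤-trans (admits-rainbow-whp 𝒜 uniform ϑ-bernoulli b≥0 b-inverse′ ρ-bernoulli x≥0 x+1/h≈1 log-lower dense s 1≤s large)
          (+-mono-≤ (≤-reflexive (≈-sym eq)) ≤-refl)
        where
        eq = probability-iid (allFin (suc h′)) (λ _ → 1/suc h′) (admitsRainbow? 𝒜)
        -- A pure colouring is the case ρ = 1, for which the density condition becomes q · L ≤
        -- 1/1024.
        dense : 1024 · 1# * (wϑ inside * b) * L ≤ wρ inside
        dense = begin
          1024 · 1# * (wϑ inside * b) * L ≈⟨ *-assoc _ _ _ ⟩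
          1024 · 1# * (wϑ inside * b * L) ≤⟨ *-monoˡ-≤ (·-nonneg 1024) qL≤ ⟩
          1024 · 1# * 1/suc 1023 ≈⟨ ≈-trans (*-comm _ _) (1/suc-inverse 1023) ⟩
          1# ≈⟨ ρ≈1 ⟨
          wρ inside ∎

  ½^+½^-small : ∀ N {t} → 1/suc N + 1/suc N ≤ t → ½ ^ suc N + ½ ^ suc N ≤ t
  ½^+½^-small N le = ≤-trans (+-mono-≤ step step) le
    where
    step : ½ ^ suc N ≤ 1/suc N
    step = ≤-trans (^-antitone (Threshold.½≥0 K) (Threshold.1/suc≤1 K 1) (ℕ.n≤1+n N)) (½^≤1/suc N)

-- Real numbers as an ordered semiring

module _ where
  open import Data.Rational.Base using (_+_; _*_; _-_; -_; _/_; ½; _≤_; _<_)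
  open +-*-Solver using (solve; _:=_; _:+_; _:*_; _:-_; con)
  open ℚ.≤-Reasoning

  ½-pos : ∀ {ε} → 0ℚ < ε → 0ℚ < ε * ½
  ½-pos {ε} ε>0 = subst (_< ε * ½) (ℚ.*-zeroˡ ½) (ℚ.*-monoˡ-<-pos ½ ε>0)

  ½+½≡ : ∀ ε → ε * ½ + ε * ½ ≡ ε
  ½+½≡ = solve 1 (λ ε → ε :* con ½ :+ ε :* con ½ := ε) refl

  *-nonnegℚ : ∀ {p q} → 0ℚ ≤ p → 0ℚ ≤ q → 0ℚ ≤ p * q
  *-nonnegℚ {p} {q} p≥0 q≥0 =
    subst (_≤ p * q) (ℚ.*-zeroˡ q) (ℚ.*-monoʳ-≤-nonNeg q {{ℚ.nonNegative q≥0}} p≥0)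

  *-posℚ : ∀ {p q} → 0ℚ < p → 0ℚ < q → 0ℚ < p * q
  *-posℚ {p} {q} p>0 q>0 =
    subst (_< p * q) (ℚ.*-zeroˡ q) (ℚ.*-monoˡ-<-pos q {{ℚ.positive q>0}} p>0)

  inv-inverseˡ : ∀ {p} → 0ℚ < p → inv p * p ≡ 1ℚ
  inv-inverseˡ {p} p>0 with p ℚ.≟ 0ℚ
  ... | yes p≡0 = contradiction p>0 (ℚ.<-irrefl (sym p≡0))
  ... | no  p≢0 = ℚ.*-inverseˡ p {{ℚ.≢-nonZero p≢0}}

  inv-pos : ∀ {p} → 0ℚ < p → 0ℚ < inv p
  inv-pos {p} p>0 = ℚ.*-cancelʳ-<-nonNeg p {{ℚ.nonNegative (ℚ.<⇒≤ p>0)}}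
    (ℚ.≤-<-trans (ℚ.≤-reflexive (ℚ.*-zeroˡ p)) (ℚ.<-≤-trans (ℚ.positive⁻¹ 1ℚ) (ℚ.≤-reflexive (sym (inv-inverseˡ p>0)))))

  x≤x+ε : ∀ x {ε} → 0ℚ ≤ ε → x ≤ x + ε
  x≤x+ε x {ε} ε≥0 = subst (_≤ x + ε) (ℚ.+-identityʳ x) (ℚ.+-monoʳ-≤ x ε≥0)

  p≤∣p∣ : ∀ p → p ≤ ℚ.∣ p ∣
  p≤∣p∣ p with ℚ.≤-total 0ℚ p
  ... | inj₁ p≥0 = ℚ.≤-reflexive (sym (ℚ.0≤p⇒∣p∣≡p p≥0))
  ... | inj₂ p≤0 = ℚ.≤-trans p≤0 (ℚ.0≤∣p∣ p)

  tolerance : ∀ ε D → 0ℚ < ε → 1ℚ + ε ≤ D → ∃[ δ ] 0ℚ < δ × δ ≤ 1ℚ × δ * D ≡ ε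
  tolerance ε D ε>0 1+ε≤D = with-reciprocal (inv D) (inv-pos D>0) (inv-inverseˡ D>0)
    where
    D>0 : 0ℚ < D
    D>0 = ℚ.<-≤-trans (ℚ.positive⁻¹ 1ℚ) (ℚ.≤-trans (x≤x+ε 1ℚ (ℚ.<⇒≤ ε>0)) 1+ε≤D)
    with-reciprocal : ∀ i → 0ℚ < i → i * D ≡ 1ℚ → ∃[ δ ] 0ℚ < δ × δ ≤ 1ℚ × δ * D ≡ ε
    with-reciprocal i i>0 iD≡1 = ε * i , *-posℚ ε>0 i>0 , ℚ.*-cancelʳ-≤-pos D {{ℚ.positive D>0}} (begin
      ε * i * D ≡⟨ δD≡ε ⟩
      ε ≤⟨ x≤x+ε ε (ℚ.nonNegative⁻¹ 1ℚ) ⟩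
      ε + 1ℚ ≡⟨ ℚ.+-comm ε 1ℚ ⟩
      1ℚ + ε ≤⟨ 1+ε≤D ⟩
      D ≡⟨ ℚ.*-identityˡ D ⟨
      1ℚ * D ∎) , δD≡ε
      where
      δD≡ε : ε * i * D ≡ ε
      δD≡ε = trans (ℚ.*-assoc ε i D) (trans (cong (ε *_) iD≡1) (ℚ.*-identityʳ ε))

  -- (a + δ)(b + δ) ≥ 0 with δ = ε/D, where D bounds a + b + δ.
  product-estimate : ∀ a b B C ε δ → 0ℚ < ε → 0ℚ < δ → δ ≤ 1ℚ → δ * ((B + C) + (1ℚ + ε)) ≡ ε →
    0ℚ ≤ a + δ → 0ℚ ≤ b + δ → ℚ.∣ a ∣ ≤ B → ℚ.∣ b ∣ ≤ C → 0ℚ ≤ a * b + ε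
  product-estimate a b B C ε δ ε>0 δ>0 δ≤1 δD≡ε a≥ b≥ ∣a∣≤ ∣b∣≤ = begin
    0ℚ ≤⟨ *-nonnegℚ a≥ b≥ ⟩
    (a + δ) * (b + δ) ≡⟨ expand a b δ ⟩
    a * b + δ * (a + b + δ) ≤⟨ ℚ.+-monoʳ-≤ (a * b) (ℚ.*-monoˡ-≤-nonNeg δ {{ℚ.nonNegative (ℚ.<⇒≤ δ>0)}} sum≤D) ⟩
    a * b + δ * ((B + C) + (1ℚ + ε)) ≡⟨ cong (a * b +_) δD≡ε ⟩
    a * b + ε ∎
    where
    expand : ∀ a b δ → (a + δ) * (b + δ) ≡ a * b + δ * (a + b + δ)
    expand = solve 3 (λ a b δ → (a :+ δ) :* (b :+ δ) := a :* b :+ δ :* (a :+ b :+ δ)) refl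
    sum≤D : a + b + δ ≤ (B + C) + (1ℚ + ε)
    sum≤D = ℚ.+-mono-≤ (ℚ.+-mono-≤ (ℚ.≤-trans (p≤∣p∣ a) ∣a∣≤) (ℚ.≤-trans (p≤∣p∣ b) ∣b∣≤))
      (ℚ.≤-trans δ≤1 (x≤x+ε 1ℚ (ℚ.<⇒≤ ε>0)))

  1/suc-positive : ∀ k → 0ℚ < ℤ.+ 1 / suc k
  1/suc-positive k = ℚ.positive⁻¹ (ℤ.+ 1 / suc k) {{ℚ.normalize-pos 1 (suc k)}}

  1/suc≤1ℚ : ∀ k → ℤ.+ 1 / suc k ≤ 1ℚ
  1/suc≤1ℚ k = ℚ.toℚᵘ-cancel-≤ (ℚᵘ.≤-respˡ-≃ (ℚᵘ.≃-sym (ℚ.toℚᵘ-fromℚᵘ (ℚᵘ.mkℚᵘ (ℤ.+ 1) k)))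
    (ℚᵘ.*≤* (ℤ.*-monoˡ-≤-nonNeg (ℤ.+ 1) (ℤ.+≤+ (ℕ.s≤s (ℕ.z≤n {k}))))))

  1/suc-inverseℚ : ∀ k → ℤ.+ 1 / suc k * (ℤ.+ suc k / 1) ≡ 1ℚ
  1/suc-inverseℚ k = trans (ℚ.*-comm (ℤ.+ 1 / suc k) (ℤ.+ suc k / 1)) (ℚ.toℚᵘ-injective (ℚᵘ.≃-trans
    (ℚ.toℚᵘ-homo-* (ℤ.+ suc k / 1) (ℤ.+ 1 / suc k)) (ℚᵘ.≃-trans
    (ℚᵘ.*-cong (ℚ.toℚᵘ-fromℚᵘ (ℚᵘ.mkℚᵘ (ℤ.+ suc k) 0)) (ℚ.toℚᵘ-fromℚᵘ (ℚᵘ.mkℚᵘ (ℤ.+ 1) k)))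
    (ℚᵘ.*≡* (cong ℤ.+_ (trans (ℕ.*-identityʳ _) (trans (ℕ.*-identityʳ (suc k))
      (sym (trans (ℕ.*-identityˡ _) (ℕ.*-identityˡ (suc k)))))))))))

  suc/1 : ∀ n → 1ℚ + ℤ.+ n / 1 ≡ ℤ.+ suc n / 1
  suc/1 n = ℚ.toℚᵘ-injective (ℚᵘ.≃-trans (ℚ.toℚᵘ-homo-+ 1ℚ (ℤ.+ n / 1)) (ℚᵘ.≃-trans
    (ℚᵘ.+-congʳ ℚᵘ.1ℚᵘ (ℚ.toℚᵘ-fromℚᵘ (ℚᵘ.mkℚᵘ (ℤ.+ n) 0)))
    (ℚᵘ.≃-trans (ℚᵘ.*≡* (cong (ℤ._* ℤ.+ 1) (cong (λ z → ℤ.+ 1 ℤ.+ z) (ℤ.*-identityʳ (ℤ.+ n)))))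
      (ℚᵘ.≃-sym (ℚ.toℚᵘ-fromℚᵘ (ℚᵘ.mkℚᵘ (ℤ.+ suc n) 0))))))

  archimedeanℚ : ∀ ε → 0ℚ < ε → ∃[ N ] ℤ.+ 1 / suc N ≤ ε
  archimedeanℚ (ℚ.mkℚ (ℤ.+ zero) d c)    (ℚ.*<* (ℤ.+<+ ()))
  archimedeanℚ (ℚ.mkℚ ℤ.-[1+ _ ] d c)    (ℚ.*<* ())
  archimedeanℚ (ℚ.mkℚ (ℤ.+ suc a) d c) _ = d , ℚ.toℚᵘ-cancel-≤
    (ℚᵘ.≤-respˡ-≃ (ℚᵘ.≃-sym (ℚ.toℚᵘ-fromℚᵘ (ℚᵘ.mkℚᵘ (ℤ.+ 1) d)))
      (ℚᵘ.*≤* (ℤ.*-monoʳ-≤-nonNeg (ℤ.+ suc d) (ℤ.+≤+ (ℕ.s≤s (ℕ.z≤n {a}))))))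

  -- The gap δ in t < ε is spent in halves: one absorbs the tolerance in 1 ≤ x + t, the other
  -- witnesses the strict inequality 1 - ε < x.
  near-one-lower : ∀ x t ε δ → 1ℚ ≤ x + t + δ * ½ → t + δ ≤ ε → 1ℚ - ε + δ * ½ ≤ x
  near-one-lower x t ε δ 1≤ t≤ = begin
    1ℚ - ε + δ * ½ ≤⟨ ℚ.+-monoˡ-≤ (δ * ½) (ℚ.+-monoˡ-≤ (- ε) 1≤) ⟩
    (x + t + δ * ½) - ε + δ * ½ ≡⟨ regroup x t ε δ ⟩
    x + (t + δ - ε) ≤⟨ ℚ.+-monoʳ-≤ x (ℚ.+-monoˡ-≤ (- ε) t≤) ⟩
    x + (ε - ε) ≡⟨ cong (x +_) (ℚ.+-inverseʳ ε) ⟩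
    x + 0ℚ ≡⟨ ℚ.+-identityʳ x ⟩
    x ∎
    where
    regroup : ∀ x t ε δ → (x + t + δ * ½) - ε + δ * ½ ≡ x + (t + δ - ε)
    regroup = solve 4 (λ x t ε δ → (x :+ t :+ δ :* con ½) :- ε :+ δ :* con ½ := x :+ (t :+ δ :- ε)) refl

  near-one-upper : ∀ x ε e → x ≤ 1ℚ + e * ½ → 0ℚ + e ≤ ε → x + e * ½ ≤ 1ℚ + ε
  near-one-upper x ε e x≤ e≤ = begin
    x + e * ½ ≤⟨ ℚ.+-monoˡ-≤ (e * ½) x≤ ⟩
    (1ℚ + e * ½) + e * ½ ≡⟨ ℚ.+-assoc 1ℚ (e * ½) (e * ½) ⟩
    1ℚ + (e * ½ + e * ½) ≡⟨ cong (1ℚ +_) (trans (½+½≡ e) (sym (ℚ.+-identityˡ e))) ⟩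
    1ℚ + (0ℚ + e) ≤⟨ ℚ.+-monoʳ-≤ 1ℚ e≤ ⟩
    1ℚ + ε ∎

open import Defs
open ℝ
open FinSpace
open +-*-Solver using (solve; _:=_; _:+_; _:*_; _:-_; :-_; con)

Eventually-× : ∀ {P Q} → Eventually P → Eventually Q → Eventually (λ n → P n × Q n)
Eventually-× (M , p) (N , q) = M ℕ.⊔ N , λ n M⊔N≤n →
  p n (ℕ.m⊔n≤o⇒m≤o M N M⊔N≤n) , q n (ℕ.m⊔n≤o⇒n≤o M N M⊔N≤n)

Eventually-map : ∀ {P Q} → (∀ n → P n → Q n) → Eventually P → Eventually Q
Eventually-map f (M , p) = M , λ n M≤n → f n (p n M≤n)

-- Implicit reals are passed explicitly throughout: ≤ and ≃ unfold, so they cannot be inferred.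
eventually-≤⇒≤ : ∀ {x y} → Eventually (λ n → seq x n ℚ.≤ seq y n) → x ≤ y
eventually-≤⇒≤ {x} {y} ev ε ε>0 = Eventually-map (λ n p → ℚ.≤-trans p (x≤x+ε (seq y n) (ℚ.<⇒≤ ε>0))) ev

pointwise-≤⇒≤ : ∀ {x y} → (∀ n → seq x n ℚ.≤ seq y n) → x ≤ y
pointwise-≤⇒≤ {x} {y} h = eventually-≤⇒≤ {x} {y} (0 , λ n _ → h n)

pointwise-≡⇒≃ : ∀ {x y} → (∀ n → seq x n ≡ seq y n) → x ≃ y
pointwise-≡⇒≃ {x} {y} h = pointwise-≤⇒≤ {x} {y} (λ n → ℚ.≤-reflexive (h n)) ,
  pointwise-≤⇒≤ {y} {x} (λ n → ℚ.≤-reflexive (sym (h n)))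

≤-reflℝ : ∀ {x} → x ≤ x
≤-reflℝ {x} = pointwise-≤⇒≤ {x} {x} (λ n → ℚ.≤-refl)

≤-transℝ : ∀ {x y z} → x ≤ y → y ≤ z → x ≤ z
≤-transℝ {x} {y} {z} x≤y y≤z ε ε>0 = Eventually-map (λ n (p , q) → begin
  seq x n ≤⟨ p ⟩
  seq y n ℚ.+ ε ℚ.* ℚ.½ ≤⟨ ℚ.+-monoˡ-≤ (ε ℚ.* ℚ.½) q ⟩
  seq z n ℚ.+ ε ℚ.* ℚ.½ ℚ.+ ε ℚ.* ℚ.½ ≡⟨ ℚ.+-assoc (seq z n) _ _ ⟩
  seq z n ℚ.+ (ε ℚ.* ℚ.½ ℚ.+ ε ℚ.* ℚ.½) ≡⟨ cong (seq z n ℚ.+_) (½+½≡ ε) ⟩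
  seq z n ℚ.+ ε ∎)
  (Eventually-× (x≤y (ε ℚ.* ℚ.½) (½-pos ε>0)) (y≤z (ε ℚ.* ℚ.½) (½-pos ε>0)))
  where open ℚ.≤-Reasoning

+-mono-≤ℝ : ∀ {x x′ y y′} → x ≤ x′ → y ≤ y′ → x + y ≤ x′ + y′
+-mono-≤ℝ {x} {x′} {y} {y′} x≤ y≤ ε ε>0 = Eventually-map (λ n (p , q) → begin
  seq x n ℚ.+ seq y n ≤⟨ ℚ.+-mono-≤ p q ⟩
  (seq x′ n ℚ.+ ε ℚ.* ℚ.½) ℚ.+ (seq y′ n ℚ.+ ε ℚ.* ℚ.½) ≡⟨ regroup (seq x′ n) (seq y′ n) ε ⟩
  seq x′ n ℚ.+ seq y′ n ℚ.+ ε ∎)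
  (Eventually-× (x≤ (ε ℚ.* ℚ.½) (½-pos ε>0)) (y≤ (ε ℚ.* ℚ.½) (½-pos ε>0)))
  where
  open ℚ.≤-Reasoning
  regroup : ∀ a b ε → (a ℚ.+ ε ℚ.* ℚ.½) ℚ.+ (b ℚ.+ ε ℚ.* ℚ.½) ≡ a ℚ.+ b ℚ.+ ε
  regroup = solve 3 (λ a b ε → (a :+ ε :* con ℚ.½) :+ (b :+ ε :* con ℚ.½) := a :+ b :+ ε) refl

+-cancelʳ-≤ℝ : ∀ z {x y} → x + z ≤ y + z → x ≤ y
+-cancelʳ-≤ℝ z {x} {y} le ε ε>0 = Eventually-map (λ n p → begin
  seq x n ≡⟨ cancel (seq x n) (seq z n) ⟩
  seq x n ℚ.+ seq z n ℚ.- seq z n ≤⟨ ℚ.+-monoˡ-≤ (ℚ.- seq z n) p ⟩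
  seq y n ℚ.+ seq z n ℚ.+ ε ℚ.- seq z n ≡⟨ cancel′ (seq y n) (seq z n) ε ⟩
  seq y n ℚ.+ ε ∎) (le ε ε>0)
  where
  open ℚ.≤-Reasoning
  cancel : ∀ a c → a ≡ a ℚ.+ c ℚ.- c
  cancel = solve 2 (λ a c → a := a :+ c :- c) refl
  cancel′ : ∀ b c ε → b ℚ.+ c ℚ.+ ε ℚ.- c ≡ b ℚ.+ ε
  cancel′ = solve 3 (λ b c ε → b :+ c :+ ε :- c := b :+ ε) refl

eventually-bounded : ∀ x → ∃[ B ] 0ℚ ℚ.≤ B × Eventually λ n → ℚ.∣ seq x n ∣ ℚ.≤ B
eventually-bounded x with cauchy x 1ℚ (ℚ.positive⁻¹ 1ℚ)
... | N , p = 1ℚ ℚ.+ ℚ.∣ b ∣ , ℚ.≤-trans (ℚ.0≤∣p∣ b)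
  (ℚ.≤-trans (x≤x+ε ℚ.∣ b ∣ (ℚ.nonNegative⁻¹ 1ℚ)) (ℚ.≤-reflexive (ℚ.+-comm ℚ.∣ b ∣ 1ℚ))) ,
  N , λ n N≤n → begin
    ℚ.∣ seq x n ∣ ≡⟨ cong ℚ.∣_∣ (split (seq x n) b) ⟩
    ℚ.∣ (seq x n ℚ.- b) ℚ.+ b ∣ ≤⟨ ℚ.∣p+q∣≤∣p∣+∣q∣ (seq x n ℚ.- b) b ⟩
    ℚ.∣ seq x n ℚ.- b ∣ ℚ.+ ℚ.∣ b ∣ ≤⟨ ℚ.+-monoˡ-≤ ℚ.∣ b ∣ (p n N N≤n ℕ.≤-refl) ⟩
    1ℚ ℚ.+ ℚ.∣ b ∣ ∎
  where
  open ℚ.≤-Reasoning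
  b = seq x N
  split : ∀ a b → a ≡ (a ℚ.- b) ℚ.+ b
  split = solve 2 (λ a b → a := (a :- b) :+ b) refl

-- A nonnegative real may have terms as low as -δ, so the cross terms of the product are controlled
-- by eventual bounds B and C on the factors.
*-nonnegℝ : ∀ {x y} → 0ℝ ≤ x → 0ℝ ≤ y → 0ℝ ≤ x * y
*-nonnegℝ {x} {y} x≥0 y≥0 ε ε>0 = go (eventually-bounded x) (eventually-bounded y)
  where
  go : (∃[ B ] 0ℚ ℚ.≤ B × Eventually λ n → ℚ.∣ seq x n ∣ ℚ.≤ B) →
       (∃[ C ] 0ℚ ℚ.≤ C × Eventually λ n → ℚ.∣ seq y n ∣ ℚ.≤ C) →
       Eventually λ n → 0ℚ ℚ.≤ seq x n ℚ.* seq y n ℚ.+ ε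
  go (B , B≥0 , xB) (C , C≥0 , yC)
    with δ , δ>0 , δ≤1 , δD≡ε ← tolerance ε ((B ℚ.+ C) ℚ.+ (1ℚ ℚ.+ ε)) ε>0
           (ℚ.≤-trans (ℚ.≤-reflexive (sym (ℚ.+-identityˡ (1ℚ ℚ.+ ε))))
             (ℚ.+-monoˡ-≤ (1ℚ ℚ.+ ε) (ℚ.≤-trans (ℚ.≤-reflexive (sym (ℚ.+-identityˡ 0ℚ))) (ℚ.+-mono-≤ B≥0 C≥0)))) =
    Eventually-map
      (λ n ((a≥ , b≥) , (∣a∣≤ , ∣b∣≤)) →
        product-estimate (seq x n) (seq y n) B C ε δ ε>0 δ>0 δ≤1 δD≡ε a≥ b≥ ∣a∣≤ ∣b∣≤)
      (Eventually-× (Eventually-× (x≥0 δ δ>0) (y≥0 δ δ>0)) (Eventually-× xB yC))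

*-monoʳ-≤ℝ : ∀ {x y z} → 0ℝ ≤ z → x ≤ y → x * z ≤ y * z
*-monoʳ-≤ℝ {x} {y} {z} z≥0 x≤y ε ε>0 = Eventually-map (λ n p → begin
  seq x n ℚ.* seq z n ≡⟨ ℚ.+-identityˡ _ ⟨
  0ℚ ℚ.+ seq x n ℚ.* seq z n ≤⟨ ℚ.+-monoˡ-≤ (seq x n ℚ.* seq z n) p ⟩
  (seq y n ℚ.- seq x n) ℚ.* seq z n ℚ.+ ε ℚ.+ seq x n ℚ.* seq z n ≡⟨ regroup (seq x n) (seq y n) (seq z n) ε ⟩
  seq y n ℚ.* seq z n ℚ.+ ε ∎)
  (*-nonnegℝ {y - x} {z} (λ ε ε>0 → Eventually-map (λ n p → begin
    0ℚ ≡⟨ ℚ.+-inverseʳ (seq x n) ⟨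
    seq x n ℚ.- seq x n ≤⟨ ℚ.+-monoˡ-≤ (ℚ.- seq x n) p ⟩
    seq y n ℚ.+ ε ℚ.- seq x n ≡⟨ regroup′ (seq x n) (seq y n) ε ⟩
    seq y n ℚ.- seq x n ℚ.+ ε ∎) (x≤y ε ε>0)) z≥0 ε ε>0)
  where
  open ℚ.≤-Reasoning
  regroup : ∀ a b c ε → (b ℚ.- a) ℚ.* c ℚ.+ ε ℚ.+ a ℚ.* c ≡ b ℚ.* c ℚ.+ ε
  regroup = solve 4 (λ a b c ε → (b :- a) :* c :+ ε :+ a :* c := b :* c :+ ε) refl
  regroup′ : ∀ a b ε → b ℚ.+ ε ℚ.- a ≡ b ℚ.- a ℚ.+ ε
  regroup′ = solve 3 (λ a b ε → b :+ ε :- a := b :- a :+ ε) refl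

≃-transℝ : ∀ {x y z} → x ≃ y → y ≃ z → x ≃ z
≃-transℝ {x} {y} {z} (a , b) (c , d) = ≤-transℝ {x} {y} {z} a c , ≤-transℝ {z} {y} {x} d b

-- x z + x B = x (z + B) with z + B ≥ 0, which reduces congruence to monotonicity.
*-congʳ-≤ℝ : ∀ {x y} z → x ≃ y → x * z ≤ y * z
*-congʳ-≤ℝ {x} {y} z (x≤y , y≤x) = +-cancelʳ-≤ℝ (x * b) {x * z} {y * z}
  (≤-transℝ {x * z + x * b} {x * (z + b)} {y * z + x * b} (proj₂ (distrib x z b))
  (≤-transℝ {x * (z + b)} {y * (z + b)} {y * z + x * b} (*-monoʳ-≤ℝ {x} {y} {z + b} z+b≥0 x≤y)
  (≤-transℝ {y * (z + b)} {y * z + y * b} {y * z + x * b} (proj₁ (distrib y z b))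
  (+-mono-≤ℝ {y * z} {y * z} {y * b} {x * b} (≤-reflℝ {y * z}) (*-monoʳ-≤ℝ {y} {x} {b} b≥0 y≤x)))))
  where
  open ℚ.≤-Reasoning
  B = proj₁ (eventually-bounded z)
  b = fromℚ B
  b≥0 : 0ℝ ≤ b
  b≥0 = pointwise-≤⇒≤ {0ℝ} {b} (λ _ → proj₁ (proj₂ (eventually-bounded z)))
  z+b≥0 : 0ℝ ≤ z + b
  z+b≥0 = eventually-≤⇒≤ {0ℝ} {z + b} (Eventually-map (λ n p → begin
    0ℚ ≡⟨ ℚ.+-inverseʳ (seq z n) ⟨
    seq z n ℚ.- seq z n ≤⟨ ℚ.+-monoʳ-≤ (seq z n)
      (ℚ.≤-trans (p≤∣p∣ (ℚ.- seq z n)) (ℚ.≤-trans (ℚ.≤-reflexive (ℚ.∣-p∣≡∣p∣ (seq z n))) p)) ⟩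
    seq z n ℚ.+ B ∎) (proj₂ (proj₂ (eventually-bounded z))))
  distrib : ∀ x y z → x * (y + z) ≃ x * y + x * z
  distrib x y z = pointwise-≡⇒≃ {x * (y + z)} {x * y + x * z} (λ n → ℚ.*-distribˡ-+ (seq x n) (seq y n) (seq z n))

*-comm≃ : ∀ x y → x * y ≃ y * x
*-comm≃ x y = pointwise-≡⇒≃ {x * y} {y * x} (λ n → ℚ.*-comm (seq x n) (seq y n))

*-cong≃ : ∀ {x x′ y y′} → x ≃ x′ → y ≃ y′ → x * y ≃ x′ * y′
*-cong≃ {x} {x′} {y} {y′} (x≤ , ≤x) (y≤ , ≤y) =
  half {x} {x′} {y} {y′} (x≤ , ≤x) (y≤ , ≤y) , half {x′} {x} {y′} {y} (≤x , x≤) (≤y , y≤)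
  where
  half : ∀ {x x′ y y′} → x ≃ x′ → y ≃ y′ → x * y ≤ x′ * y′
  half {x} {x′} {y} {y′} x≃ y≃ = ≤-transℝ {x * y} {x′ * y} {x′ * y′} (*-congʳ-≤ℝ {x} {x′} y x≃)
    (≤-transℝ {x′ * y} {y * x′} {x′ * y′} (proj₁ (*-comm≃ x′ y))
    (≤-transℝ {y * x′} {y′ * x′} {x′ * y′} (*-congʳ-≤ℝ {y} {y′} x′ y≃) (proj₁ (*-comm≃ y′ x′))))

ℝ-commutativeSemiring : CommutativeSemiring 0ℓ 0ℓ
ℝ-commutativeSemiring = record
  { Carrier = ℝ
  ; _≈_ = _≃_
  ; _+_ = _+_
  ; _*_ = _*_
  ; 0# = 0ℝ
  ; 1# = 1ℝ
  ; isCommutativeSemiring = record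
    { isSemiring = record
      { isSemiringWithoutAnnihilatingZero = record
        { +-isCommutativeMonoid = record
          { isMonoid = record
            { isSemigroup = record
              { isMagma = record
                { isEquivalence = record
                  { refl = λ {x} → ≤-reflℝ {x} , ≤-reflℝ {x}
                  ; sym = λ (a , b) → b , a
                  ; trans = λ {x} {y} {z} → ≃-transℝ {x} {y} {z} }
                ; ∙-cong = λ {x} {x′} {y} {y′} (a , b) (c , d) →
                    +-mono-≤ℝ {x} {x′} {y} {y′} a c , +-mono-≤ℝ {x′} {x} {y′} {y} b d }
              ; assoc = λ x y z → pointwise-≡⇒≃ {(x + y) + z} {x + (y + z)}
                (λ n → ℚ.+-assoc (seq x n) (seq y n) (seq z n)) }
            ; identity = (λ x → pointwise-≡⇒≃ {0ℝ + x} {x} (λ n → ℚ.+-identityˡ (seq x n))) ,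
                         (λ x → pointwise-≡⇒≃ {x + 0ℝ} {x} (λ n → ℚ.+-identityʳ (seq x n))) }
          ; comm = λ x y → pointwise-≡⇒≃ {x + y} {y + x} (λ n → ℚ.+-comm (seq x n) (seq y n)) }
        ; *-cong = λ {x} {x′} {y} {y′} → *-cong≃ {x} {x′} {y} {y′}
        ; *-assoc = λ x y z → pointwise-≡⇒≃ {(x * y) * z} {x * (y * z)} (λ n → ℚ.*-assoc (seq x n) (seq y n) (seq z n))
        ; *-identity = (λ x → pointwise-≡⇒≃ {1ℝ * x} {x} (λ n → ℚ.*-identityˡ (seq x n))) ,
                       (λ x → pointwise-≡⇒≃ {x * 1ℝ} {x} (λ n → ℚ.*-identityʳ (seq x n)))
        ; distrib = (λ x y z → pointwise-≡⇒≃ {x * (y + z)} {x * y + x * z}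
          (λ n → ℚ.*-distribˡ-+ (seq x n) (seq y n) (seq z n))) ,
                    (λ x y z → pointwise-≡⇒≃ {(y + z) * x} {y * x + z * x}
                      (λ n → ℚ.*-distribʳ-+ (seq x n) (seq y n) (seq z n))) }
      ; zero = (λ x → pointwise-≡⇒≃ {0ℝ * x} {0ℝ} (λ n → ℚ.*-zeroˡ (seq x n))) ,
               (λ x → pointwise-≡⇒≃ {x * 0ℝ} {0ℝ} (λ n → ℚ.*-zeroʳ (seq x n))) }
    ; *-comm = *-comm≃ } }

open Mult (CommutativeSemiring.semiring ℝ-commutativeSemiring) using () renaming (_×_ to _·ℝ_)

seq-· : ∀ n k → seq (n ·ℝ 1ℝ) k ≡ ℤ.+ n ℚ./ 1
seq-· zero    k = refl
seq-· (suc n) k = trans (cong (1ℚ ℚ.+_) (seq-· n k)) (suc/1 n)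

ℝ-ordered : OrderedSemiring
ℝ-ordered = record
  { commutativeSemiring = ℝ-commutativeSemiring
  ; _≤_ = _≤_
  ; isPartialOrder = record
    { isPreorder = record
      { isEquivalence = CommutativeSemiring.isEquivalence ℝ-commutativeSemiring
      ; reflexive = proj₁
      ; trans = λ {x} {y} {z} → ≤-transℝ {x} {y} {z} }
    ; antisym = _,_ }
  ; +-mono-≤ = λ {x} {x′} {y} {y′} → +-mono-≤ℝ {x} {x′} {y} {y′}
  ; +-cancelʳ-≤ = λ z {x} {y} → +-cancelʳ-≤ℝ z {x} {y}
  ; *-monoʳ-≤ = λ {x} {y} {z} → *-monoʳ-≤ℝ {x} {y} {z}
  ; 0≤1 = pointwise-≤⇒≤ {0ℝ} {1ℝ} (λ _ → ℚ.nonNegative⁻¹ 1ℚ)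
  ; 1/suc = λ n → fromℚ (ℤ.+ 1 ℚ./ suc n)
  ; 0≤1/suc = λ n → pointwise-≤⇒≤ {0ℝ} {fromℚ (ℤ.+ 1 ℚ./ suc n)} (λ _ → ℚ.<⇒≤ (1/suc-positive n))
  ; 1/suc-inverse = λ n → pointwise-≡⇒≃ {fromℚ (ℤ.+ 1 ℚ./ suc n) * (suc n ·ℝ 1ℝ)} {1ℝ}
      (λ k → trans (cong (ℤ.+ 1 ℚ./ suc n ℚ.*_) (seq-· (suc n) k)) (1/suc-inverseℚ n))
  }

<⇒≤ℝ : ∀ {x y} → x < y → x ≤ y
<⇒≤ℝ {x} {y} (δ , δ>0 , ev) = eventually-≤⇒≤ {x} {y}
  (Eventually-map (λ n → ℚ.≤-trans (x≤x+ε (seq x n) (ℚ.<⇒≤ δ>0))) ev)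

module _ (x : ℝ) (x>0 : 0ℝ < x) where

  private
    eventually-positive : Eventually λ n → 0ℚ ℚ.< seq x n
    eventually-positive = let δ , δ>0 , ev = x>0 in
      Eventually-map (λ n 0+δ≤x → ℚ.<-≤-trans δ>0 (ℚ.≤-trans (ℚ.≤-reflexive (sym (ℚ.+-identityˡ δ))) 0+δ≤x)) ev

  0≤recip : 0ℝ ≤ recip x x>0
  0≤recip = eventually-≤⇒≤ {0ℝ} {recip x x>0} (Eventually-map (λ n pos → ℚ.<⇒≤ (inv-pos pos)) eventually-positive)

  -- The identity holds termwise only from some index on; earlier terms of x may vanish, and there
  -- `inv` is 0.
  recip-inverse : recip x x>0 * x ≃ 1ℝ
  recip-inverse =
    eventually-≤⇒≤ {recip x x>0 * x} {1ℝ}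
      (Eventually-map (λ n pos → ℚ.≤-reflexive (inv-inverseˡ pos)) eventually-positive) ,
    eventually-≤⇒≤ {1ℝ} {recip x x>0 * x}
      (Eventually-map (λ n pos → ℚ.≤-reflexive (sym (inv-inverseˡ pos))) eventually-positive)

-- The finite bounds for real weights

module Kℝ = FiniteSums ℝ-ordered

complement : ∀ p → p + (1ℝ - p) ≃ 1ℝ
complement p = pointwise-≡⇒≃ {p + (1ℝ - p)} {1ℝ} (λ n → eq (seq p n))
  where
  eq : ∀ p → p ℚ.+ (1ℚ ℚ.- p) ≡ 1ℚ
  eq = solve 1 (λ p → p :+ (con 1ℚ :- p) := con 1ℚ) refl

0≤1-p : ∀ p → p ≤ 1ℝ → 0ℝ ≤ 1ℝ - p
0≤1-p p p≤1 = +-cancelʳ-≤ℝ p {0ℝ} {1ℝ - p} (≤-transℝ {0ℝ + p} {1ℝ} {1ℝ - p + p}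
  (≤-transℝ {0ℝ + p} {p} {1ℝ} (proj₁ (Kℝ.+-identityˡ p)) p≤1)
  (proj₂ (Kℝ.≈-trans {1ℝ - p + p} {p + (1ℝ - p)} {1ℝ} (Kℝ.+-comm (1ℝ - p) p) (complement p))))

isBernoulli : ∀ p → 0ℝ ≤ p → p ≤ 1ℝ → Kℝ.IsBernoulli p (1ℝ - p)
isBernoulli p p≥0 p≤1 = Kℝ.bern p≥0 (0≤1-p p p≤1) (complement p)

module Logℝ = Logarithm ℝ-ordered
module Rainbowℝ = RainbowTheorem ℝ-ordered

seq-^ : ∀ p k n → seq (fromℚ p Kℝ.^ k) n ≡ p ^ℚ k
seq-^ p zero    n = refl
seq-^ p (suc k) n = cong (p ℚ.*_) (seq-^ p k n)

seq-logSum : ∀ p k n → seq (Logℝ.logSum (fromℚ p) k) n ≡ log-series p k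
seq-logSum p zero    n = refl
seq-logSum p (suc k) n = cong₂ (λ a b → a ℚ.+ b ℚ.* (ℤ.+ 1 ℚ./ suc k)) (seq-logSum p k n) (seq-^ p (suc k) n)

module _ {p : ℚ} (p≥0 : 0ℚ ℚ.≤ p) where

  ^ℚ-nonneg : ∀ k → 0ℚ ℚ.≤ p ^ℚ k
  ^ℚ-nonneg zero    = ℚ.nonNegative⁻¹ 1ℚ
  ^ℚ-nonneg (suc k) = *-nonnegℚ p≥0 (^ℚ-nonneg k)

  log-series-mono : ∀ {k l} → k ℕ.≤′ l → log-series p k ℚ.≤ log-series p l
  log-series-mono (ℕ.≤′-reflexive refl) = ℚ.≤-refl
  log-series-mono {l = suc l} (ℕ.≤′-step k≤l) = ℚ.≤-trans (log-series-mono k≤l)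
    (x≤x+ε (log-series p l) (*-nonnegℚ (^ℚ-nonneg (suc l)) (ℚ.<⇒≤ (1/suc-positive l))))

module _ (h′ : ℕ) where

  private
    p : ℚ
    p = 1ℚ ℚ.- ℤ.+ 1 ℚ./ suc h′

    p≥0 : 0ℚ ℚ.≤ p
    p≥0 = ℚ.≤-trans (ℚ.≤-reflexive (sym (ℚ.+-inverseʳ (ℤ.+ 1 ℚ./ suc h′))))
      (ℚ.+-monoˡ-≤ (ℚ.- (ℤ.+ 1 ℚ./ suc h′)) (1/suc≤1ℚ h′))

  1-1/suc : ℝ
  1-1/suc = fromℚ p

  1-1/suc≥0 : 0ℝ ≤ 1-1/suc
  1-1/suc≥0 = pointwise-≤⇒≤ {0ℝ} {1-1/suc} (λ _ → p≥0)

  1-1/suc+1/suc : 1-1/suc + fromℚ (ℤ.+ 1 ℚ./ suc h′) ≃ 1ℝ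
  1-1/suc+1/suc = pointwise-≡⇒≃ {1-1/suc + fromℚ (ℤ.+ 1 ℚ./ suc h′)} {1ℝ} (λ _ → eq (ℤ.+ 1 ℚ./ suc h′))
    where
    eq : ∀ r → (1ℚ ℚ.- r) ℚ.+ r ≡ 1ℚ
    eq = solve 1 (λ r → (con 1ℚ :- r) :+ r := con 1ℚ) refl

  -- The n-th rational approximation of `log` is the n-th partial sum, and the partial sums
  -- increase, so from index k on the k-th one lies below.
  logSum≤log : ∀ k → Logℝ.logSum 1-1/suc k ≤ log (suc h′)
  logSum≤log k = eventually-≤⇒≤ {Logℝ.logSum 1-1/suc k} {log (suc h′)} (k , λ n k≤n →
    ℚ.≤-trans (ℚ.≤-reflexive (seq-logSum p k n)) (log-series-mono p≥0 (ℕ.≤⇒≤′ k≤n)))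

module _ where
  open Threshold ℝ-ordered using (½)

  -- Of the margin e in 0 < ε, one half bounds the error, a quarter is the tolerance of ≤, and the
  -- last quarter witnesses the strict inequality.
  small-power : ∀ ε → 0ℝ < ε → ∃[ N ] ½ Kℝ.^ suc N + ½ Kℝ.^ suc N < ε
  small-power ε (e , e>0 , ev) with N , 1/N≤ ← archimedeanℚ (e ℚ.* ℚ.½ ℚ.* ℚ.½) (½-pos (½-pos e>0)) =
    N , e ℚ.* ℚ.½ ℚ.* ℚ.½ , ½-pos (½-pos e>0) ,
    Eventually-map (λ n (small , e≤ε) → gap (seq (½ Kℝ.^ suc N + ½ Kℝ.^ suc N) n) (seq ε n) small e≤ε)
      (Eventually-× (Rainbowℝ.½^+½^-small N {fromℚ (e ℚ.* ℚ.½)} (sum≤ N 1/N≤) (e ℚ.* ℚ.½ ℚ.* ℚ.½)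
        (½-pos (½-pos e>0))) ev)
    where
    open ℚ.≤-Reasoning
    sum≤ : ∀ N → ℤ.+ 1 ℚ./ suc N ℚ.≤ e ℚ.* ℚ.½ ℚ.* ℚ.½ →
           fromℚ (ℤ.+ 1 ℚ./ suc N) + fromℚ (ℤ.+ 1 ℚ./ suc N) ≤ fromℚ (e ℚ.* ℚ.½)
    sum≤ N le = pointwise-≤⇒≤ {fromℚ (ℤ.+ 1 ℚ./ suc N) + fromℚ (ℤ.+ 1 ℚ./ suc N)} {fromℚ (e ℚ.* ℚ.½)}
      (λ _ → ℚ.≤-trans (ℚ.+-mono-≤ le le) (ℚ.≤-reflexive (½+½≡ (e ℚ.* ℚ.½))))
    regroup : ∀ e → e ℚ.* ℚ.½ ℚ.+ e ℚ.* ℚ.½ ℚ.* ℚ.½ ℚ.+ e ℚ.* ℚ.½ ℚ.* ℚ.½ ≡ 0ℚ ℚ.+ e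
    regroup = solve 1 (λ e → e :* con ℚ.½ :+ e :* con ℚ.½ :* con ℚ.½ :+ e :* con ℚ.½ :* con ℚ.½ := con 0ℚ :+ e) refl
    gap : ∀ t z → t ℚ.≤ e ℚ.* ℚ.½ ℚ.+ e ℚ.* ℚ.½ ℚ.* ℚ.½ → 0ℚ ℚ.+ e ℚ.≤ z → t ℚ.+ e ℚ.* ℚ.½ ℚ.* ℚ.½ ℚ.≤ z
    gap t z small e≤z = begin
      t ℚ.+ e ℚ.* ℚ.½ ℚ.* ℚ.½ ≤⟨ ℚ.+-monoˡ-≤ (e ℚ.* ℚ.½ ℚ.* ℚ.½) small ⟩
      e ℚ.* ℚ.½ ℚ.+ e ℚ.* ℚ.½ ℚ.* ℚ.½ ℚ.+ e ℚ.* ℚ.½ ℚ.* ℚ.½ ≡⟨ regroup e ⟩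
      0ℚ ℚ.+ e ≤⟨ e≤z ⟩
      z ∎

near-one : ∀ {x t ε} → 0ℝ < ε → x ≤ 1ℝ → 1ℝ ≤ x + t → t < ε → 1ℝ - ε < x × x < 1ℝ + ε
near-one {x} {t} {ε} (e , e>0 , ev) x≤1 1≤x+t (δ , δ>0 , t<ε) =
  (δ ℚ.* ℚ.½ , ½-pos δ>0 , Eventually-map (λ n (a , b) → near-one-lower (seq x n) (seq t n) (seq ε n) δ a b)
    (Eventually-× (1≤x+t (δ ℚ.* ℚ.½) (½-pos δ>0)) t<ε)) ,
  (e ℚ.* ℚ.½ , ½-pos e>0 , Eventually-map (λ n (a , b) → near-one-upper (seq x n) (seq ε n) e a b)
    (Eventually-× (x≤1 (e ℚ.* ℚ.½) (½-pos e>0)) ev))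

fromℚ-positive : ∀ p → 0ℚ ℚ.< p → 0ℝ < fromℚ p
fromℚ-positive p p>0 = p , p>0 , 0 , λ _ _ → ℚ.≤-reflexive (ℚ.+-identityˡ p)

error : ℕ → ℝ
error s = Threshold.½ ℝ-ordered Kℝ.^ s + Threshold.½ ℝ-ordered Kℝ.^ s

module ℙK = Probabilities ℝ-ordered

seq-^-Kℝ : ∀ {x y} → (∀ n → seq x n ≡ seq y n) → ∀ k n → seq (x Kℝ.^ k) n ≡ seq (y ^ k) n
seq-^-Kℝ x≡y zero    n = refl
seq-^-Kℝ x≡y (suc k) n = cong₂ ℚ._*_ (x≡y n) (seq-^-Kℝ x≡y k n)

ℙ≃probability : ∀ {A : Set} {P : Pred A 0ℓ} (X : FinSpace A) (w : A → ℝ) (P? : Decidable P) →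
                (∀ x n → seq (mass X x) n ≡ seq (w x) n) →
                ℙ X P? ≃ ℙK.probability (outcomes X) w P?
ℙ≃probability X w P? mass≡w = pointwise-≡⇒≃ {ℙ X P?} {ℙK.probability (outcomes X) w P?} (go (outcomes X))
  where
  seq-if : ∀ b x n → seq (if b then mass X x else 0ℝ) n ≡ seq (if b then w x else 0ℝ) n
  seq-if true  x n = mass≡w x n
  seq-if false x n = refl
  go : ∀ xs n → seq (∑ xs (λ x → if does (P? x) then mass X x else 0ℝ)) n ≡ seq (ℙK.probability xs w P?) n
  go []       n = refl
  go (x ∷ xs) n = cong₂ ℚ._+_ (seq-if (does (P? x)) x n) (go xs n)

-- Both sums compute to the same expression, so the bounds carry over unchanged.
probability⇒ℙ : ∀ {A : Set} {P : Pred A 0ℓ} (X : FinSpace A) (P? : Decidable P) t →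
  (let p = ℙK.probability (outcomes X) (mass X) P?) → p ≤ 1ℝ × 1ℝ ≤ p + t → ℙ X P? ≤ 1ℝ × 1ℝ ≤ ℙ X P? + t
probability⇒ℙ X P? t bounds = bounds

spread-measure⇒SupportsSpread : ∀ {m} {𝒜 : Family m} {q q′ : ℝ} → (∀ n → seq q n ≡ seq q′ n) →
  (Σ (Subset m → ℝ) λ μ →
    ((∀ A → 0ℝ ≤ μ A) × foldr Kℝ._+_ Kℝ.0# (map μ (vectors (inside ∷ outside ∷ []) m)) ≃ 1ℝ) ×
    (∀ S → ℙK.probability (vectors (inside ∷ outside ∷ []) m) μ (S ⊆?_) ≤ q Kℝ.^ ∣ S ∣) ×
    ℙK.probability (vectors (inside ∷ outside ∷ []) m) μ (λ A → T? (𝒜 A)) ≃ 1ℝ) →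
  SupportsSpread 𝒜 q′
spread-measure⇒SupportsSpread {q = q} {q′} q≡q′ (μ , prob , spread , supported) = μ , prob ,
  (λ S → ≤-transℝ {ℙ (measureOn μ) (S ⊆?_)} {q Kℝ.^ ∣ S ∣} {q′ ^ ∣ S ∣} (spread S)
    (pointwise-≤⇒≤ {q Kℝ.^ ∣ S ∣} {q′ ^ ∣ S ∣} (λ n → ℚ.≤-reflexive (seq-^-Kℝ q≡q′ ∣ S ∣ n)))) , supported

module _ {m : ℕ} (𝒜 : Family m) (ϑ : ℝ) (ϑ>0 : 0ℝ < ϑ) (ϑ≤1 : ϑ ≤ 1ℝ)
         (a>0 : 0ℝ < ℙ (percolation m ϑ) (contains? 𝒜)) where

  private
    a b q : ℝ
    a = ℙ (percolation m ϑ) (contains? 𝒜)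
    b = recip a a>0
    q = ϑ * b

    wϑ = mass (bernoulli ϑ)

    ϑ-bernoulli : Kℝ.IsBernoulli ϑ (1ℝ - ϑ)
    ϑ-bernoulli = isBernoulli ϑ (<⇒≤ℝ {0ℝ} {ϑ} ϑ>0) ϑ≤1

  private
    p : ℝ
    p = ℙK.probability (vectors (inside ∷ outside ∷ []) m) (Kℝ.∏ wϑ) (contains? 𝒜)

    a≃p : a ≃ p
    a≃p = ℙ≃probability (percolation m ϑ) (Kℝ.∏ wϑ) (contains? 𝒜) (λ _ _ → refl)

    b≥0 : 0ℝ ≤ b
    b≥0 = 0≤recip a a>0

    b-inverse : b * p ≃ 1ℝ
    b-inverse = ≃-transℝ {b * p} {b * a} {1ℝ}
      (*-cong≃ {b} {b} {p} {a} (≤-reflℝ {b} , ≤-reflℝ {b}) (proj₂ a≃p , proj₁ a≃p)) (recip-inverse a a>0)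

  supports-spread : SupportsSpread 𝒜 (ϑ * recip (ℙ (percolation m ϑ) (contains? 𝒜)) a>0)
  supports-spread = spread-measure⇒SupportsSpread {q = wϑ inside * b}
    {ϑ * recip (ℙ (percolation m ϑ) (contains? 𝒜)) a>0} (λ _ → refl)
    (Rainbowℝ.spread-measure 𝒜 wϑ ϑ-bernoulli {b} b≥0 b-inverse)

  rainbow-in-percolation : ∀ {h} → 𝒜 IsUniform h → ∀ s → 1 ℕ.≤ s → 2 ℕ.^ 4 ℕ.^ s ℕ.≤ h → ∀ ρ → 0ℝ < ρ → ρ ≤ 1ℝ →
    2ℝ * fromℚ (ℤ.+ 512 ℚ./ 1) * q * log h ≤ ρ →
    let P = ℙ (colouring m h ⊗ percolation m ρ) (containsRainbow? 𝒜) in P ≤ 1ℝ × 1ℝ ≤ P + error s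
  rainbow-in-percolation {zero} _ s _ large = contradiction large (ℕ.<⇒≱ (ℕ.m^n>0 2 (4 ℕ.^ s)))
  rainbow-in-percolation {suc h′} uniform s 1≤s large ρ ρ>0 ρ≤1 dense =
    probability⇒ℙ X (containsRainbow? 𝒜) (error s)
      (Rainbowℝ.rainbow-percolation 𝒜 wϑ ϑ-bernoulli {b} b≥0 b-inverse uniform
      {1-1/suc h′} {L} (1-1/suc≥0 h′) (1-1/suc+1/suc h′) (logSum≤log h′) s 1≤s large (mass (bernoulli ρ))
      (isBernoulli ρ (<⇒≤ℝ {0ℝ} {ρ} ρ>0) ρ≤1)
      -- The required 1024 is 2 · 512, which fixes the threshold constant.
      (≤-transℝ {1024 ·ℝ 1ℝ * (wϑ inside * b) * L} {2ℝ * fromℚ (ℤ.+ 512 ℚ./ 1) * q * L} {ρ}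
        (pointwise-≤⇒≤ {1024 ·ℝ 1ℝ * (wϑ inside * b) * L} {2ℝ * fromℚ (ℤ.+ 512 ℚ./ 1) * q * L}
          (λ n → ℚ.≤-reflexive (cong (λ c → c ℚ.* seq q n ℚ.* seq L n) (seq-· 1024 n)))) dense)
      (mass X) X≃)
    where
    L = log (suc h′)
    X = colouring m (suc h′) ⊗ percolation m ρ
    X≃ : ∀ c S → mass X (c , S) ≃ Kℝ.∏ (λ _ → Kℝ.1/suc h′) c * Kℝ.∏ (mass (bernoulli ρ)) S
    X≃ c S = pointwise-≡⇒≃ {mass X (c , S)} {Kℝ.∏ (λ _ → Kℝ.1/suc h′) c * Kℝ.∏ (mass (bernoulli ρ)) S} (λ _ → refl)

  rainbow-in-colouring : ∀ {h} → 𝒜 IsUniform h → ∀ s → 1 ℕ.≤ s → 2 ℕ.^ 4 ℕ.^ s ℕ.≤ h →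
    q * log h ≤ fromℚ (ℤ.+ 1 ℚ./ 1024) →
    let P = ℙ (colouring m h) (admitsRainbow? 𝒜) in P ≤ 1ℝ × 1ℝ ≤ P + error s
  rainbow-in-colouring {zero} _ s _ large = contradiction large (ℕ.<⇒≱ (ℕ.m^n>0 2 (4 ℕ.^ s)))
  rainbow-in-colouring {suc h′} uniform s 1≤s large small =
    probability⇒ℙ (colouring m (suc h′)) (admitsRainbow? 𝒜) (error s)
      (Rainbowℝ.rainbow-colouring 𝒜 wϑ ϑ-bernoulli {b} b≥0 b-inverse uniform
      {1-1/suc h′} {L} (1-1/suc≥0 h′) (1-1/suc+1/suc h′) (logSum≤log h′) s 1≤s large (mass (bernoulli 1ℝ))
      (isBernoulli 1ℝ (pointwise-≤⇒≤ {0ℝ} {1ℝ} (λ _ → ℚ.nonNegative⁻¹ 1ℚ)) (≤-reflℝ {1ℝ}))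
      (≤-reflℝ {1ℝ} , ≤-reflℝ {1ℝ})
      (≤-transℝ {wϑ inside * b * L} {q * L} {fromℚ (ℤ.+ 1 ℚ./ 1024)}
        (pointwise-≤⇒≤ {wϑ inside * b * L} {q * L} (λ n → ℚ.≤-refl)) small))
    where L = log (suc h′)

-- Passage to the limit

tends-to-one : (P : ℕ → ℝ) (h : ℕ → ℕ) → (∀ M → Eventually λ n → M ℕ.≤ h n) → (Q : ℕ → Set) → Eventually Q →
  (∀ n s → Q n → 1 ℕ.≤ s → 2 ℕ.^ 4 ℕ.^ s ℕ.≤ h n → P n ≤ 1ℝ × 1ℝ ≤ P n + error s) → P ⟶ 1ℝ
tends-to-one P h h→∞ Q eventually-Q bound ε ε>0 = from-tail (proj₁ (small-power ε ε>0)) (proj₂ (small-power ε ε>0))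
  where
  from-tail : ∀ N → error (suc N) < ε → Eventually λ n → 1ℝ - ε < P n × P n < 1ℝ + ε
  -- The parameter s = N + 1 is fixed by ε first; since h tends to infinity, 2^(4^s) ≤ h n then
  -- holds eventually.
  from-tail N small = Eventually-map {λ n → 2 ℕ.^ 4 ℕ.^ suc N ℕ.≤ h n × Q n} {λ n → 1ℝ - ε < P n × P n < 1ℝ + ε}
     (λ n lq → close n (bound n (suc N) (proj₂ lq) (ℕ.s≤s ℕ.z≤n) (proj₁ lq)))
       (Eventually-× (h→∞ (2 ℕ.^ 4 ℕ.^ suc N)) eventually-Q)
    where
    close : ∀ n → P n ≤ 1ℝ × 1ℝ ≤ P n + error (suc N) → 1ℝ - ε < P n × P n < 1ℝ + ε
    close n b = near-one {P n} {error (suc N)} {ε} ε>0 (proj₁ b) (proj₂ b) small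

theorem1p15 :
    ∃[ Cₜᵣ ] ∃[ cₛₚ ] 0ℝ < Cₜᵣ × 0ℝ < cₛₚ ×
    ((m h : ℕ → ℕ) (𝒜 : ∀ n → Family (m n)) →
     (∀ n → 𝒜 n IsUniform h n) →
     (∀ M → Eventually λ n → M ℕ.≤ h n) →
     (ϑ : ℕ → ℝ) → (∀ n → 0ℝ < ϑ n × ϑ n ≤ 1ℝ) →
     let a : ℕ → ℝ
         a n = ℙ (percolation (m n) (ϑ n)) (contains? (𝒜 n))
     in
     (a>0 : ∀ n → 0ℝ < a n) →
     let q : ℕ → ℝ
         q n = ϑ n * recip (a n) (a>0 n)
     in
     Eventually (λ n → q n ≤ ½ℝ) →
     (∀ n → SupportsSpread (𝒜 n) (q n))
     ×
     ((ρ : ℕ → ℝ) → (∀ n → 0ℝ < ρ n × ρ n ≤ 1ℝ) →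
      (∀ n → 2ℝ * Cₜᵣ * q n * log (h n) ≤ ρ n) →
      (λ n → ℙ (colouring (m n) (h n) ⊗ percolation (m n) (ρ n))
               (containsRainbow? (𝒜 n))) ⟶ 1ℝ)
     ×
     (Eventually (λ n → q n * log (h n) ≤ cₛₚ) →
      (λ n → ℙ (colouring (m n) (h n)) (admitsRainbow? (𝒜 n))) ⟶ 1ℝ))
theorem1p15 = fromℚ (ℤ.+ 512 ℚ./ 1) , fromℚ (ℤ.+ 1 ℚ./ 1024) ,
  fromℚ-positive (ℤ.+ 512 ℚ./ 1) (ℚ.positive⁻¹ (ℤ.+ 512 ℚ./ 1)) ,
  fromℚ-positive (ℤ.+ 1 ℚ./ 1024) (ℚ.positive⁻¹ (ℤ.+ 1 ℚ./ 1024)) ,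
  λ m h 𝒜 uniform h→∞ ϑ ϑ-bounds a>0 _ →
    (λ n → supports-spread (𝒜 n) (ϑ n) (proj₁ (ϑ-bounds n)) (proj₂ (ϑ-bounds n)) (a>0 n)) ,
    (λ ρ ρ-bounds dense → tends-to-one (λ n → ℙ (colouring (m n) (h n) ⊗ percolation (m n) (ρ n)) (containsRainbow? (𝒜 n))) h h→∞
      (λ _ → Unit.⊤) (0 , λ _ _ → Unit.tt)
      (λ n s _ 1≤s large → rainbow-in-percolation (𝒜 n) (ϑ n) (proj₁ (ϑ-bounds n)) (proj₂ (ϑ-bounds n)) (a>0 n)
        (uniform n) s 1≤s large (ρ n) (proj₁ (ρ-bounds n)) (proj₂ (ρ-bounds n)) (dense n))) ,
    (λ small → tends-to-one (λ n → ℙ (colouring (m n) (h n)) (admitsRainbow? (𝒜 n))) h h→∞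
      (λ n → ϑ n * recip (ℙ (percolation (m n) (ϑ n)) (contains? (𝒜 n))) (a>0 n) * log (h n) ≤ fromℚ (ℤ.+ 1 ℚ./ 1024)) small
      (λ n s small-n 1≤s large → rainbow-in-colouring (𝒜 n) (ϑ n) (proj₁ (ϑ-bounds n)) (proj₂ (ϑ-bounds n)) (a>0 n)
        (uniform n) s 1≤s large small-n))
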